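{- For any $\gamma>0$, there exists some $d_0=d_0(\gamma)$ such that $\mathrm{PL}_{d_0}(\gamma)$ fails. Quantitatively, we have $d_0(\gamma)=\exp(O(\gamma^{ -1}))$.
   Context: For a point $p$ and a line $\ell$ in $\mathbb{R}^d$, $d_\infty(p,\ell):=\min_{q\in\ell}\|p-q\|_\infty$. For a dimension $d$ and a real number $\gamma$, $\mathrm{PL}_d(\gamma)$ is the following proposition: for every large $n$ and any points $p_1,\dots,p_n\in[0,1]^d$ and lines $\ell_1,\dots,\ell_n$ with $p_i\in\ell_i$, there exist $i\neq j$ with $d_\infty(p_i,\ell_j)\le n^{ -\frac{1}{d-\gamma}+o(1)}$. Here $o(1)$ denotes a quantity tending to $0$ as $n\to\infty$. The notation $f=O(g)$ means that there is a positive constant $C$ such that $|f(x)|\le C g(x)$ for all $x$.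
   Formalization: The bound d_0(γ) = exp(O(1/γ)) is stated for 0 < γ ≤ 1 only; for all γ > 0 it is false, since for large γ it would force d_0 = 1, where PL holds because all distances are 0. Existence of d_0 > γ is proved for every γ > 0. -}

module Defs where

open import Data.Fin.Base using (Fin)
open import Data.Integer.Base as ℤ using (+_)
import Data.Integer.Properties as ℤ
open import Data.Nat.Base as ℕ using (ℕ; zero; suc)
import Data.Nat.Properties as ℕ
open import Data.Product.Base using (∃-syntax; _×_; _,_; proj₁; proj₂)
open import Data.Rational.Base as ℚ using (ℚ; 0ℚ; 1ℚ; ½)
import Data.Rational.Properties as ℚ
open import Data.Rational.Solver using (module +-*-Solver)
open import Data.Sum.Base using (_⊎_; inj₁; inj₂)
open import Data.Vec.Functional using (Vector; foldr; map; zipWith)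
open import Relation.Binary.PropositionalEquality
open import Relation.Nullary using (yes; no; contradiction)

------------------------------------------------------------------------
-- Estimates in ℚ

module Estimates where
  open import Data.Rational.Base using (_+_; _-_; _*_; -_; _⊔_; _≤_; _<_; ∣_∣)
  open ℚ.≤-Reasoning
  open +-*-Solver using (solve; _:+_; _:*_; :-_; _:-_; _:=_; con)

  *-pos : ∀ p q → 0ℚ < p → 0ℚ < q → 0ℚ < p * q
  *-pos p q 0<p 0<q =
    ℚ.positive⁻¹ (p * q) {{ℚ.pos*pos⇒pos p {{ℚ.positive 0<p}} q {{ℚ.positive 0<q}}}}

  halve : ∀ ε → 0ℚ < ε → ∃[ δ ] (0ℚ < δ × δ + δ ≡ ε)
  halve ε 0<ε = ½ * ε , *-pos ½ ε (ℚ.positive⁻¹ ½) 0<ε ,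
    trans (sym (ℚ.*-distribʳ-+ ε ½ ½)) (ℚ.*-identityˡ ε)

  *-monoʳ : ∀ r p q → 0ℚ ≤ r → p ≤ q → r * p ≤ r * q
  *-monoʳ r _ _ 0≤r p≤q = ℚ.*-monoˡ-≤-nonNeg r {{ℚ.nonNegative 0≤r}} p≤q

  *-mono : ∀ p q r s → 0ℚ ≤ p → 0ℚ ≤ s → p ≤ q → r ≤ s → p * r ≤ q * s
  *-mono p q r s 0≤p 0≤s p≤q r≤s = begin
    p * r  ≤⟨ *-monoʳ p r s 0≤p r≤s ⟩
    p * s  ≤⟨ ℚ.*-monoʳ-≤-nonNeg s {{ℚ.nonNegative 0≤s}} p≤q ⟩
    q * s  ∎

  *-nonNeg : ∀ p q → 0ℚ ≤ p → 0ℚ ≤ q → 0ℚ ≤ p * q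
  *-nonNeg p q 0≤p 0≤q = begin
    0ℚ      ≡⟨ sym (ℚ.*-zeroʳ p) ⟩
    p * 0ℚ  ≤⟨ *-monoʳ p 0ℚ q 0≤p 0≤q ⟩
    p * q   ∎

  *-cancel : ∀ r p q → 0ℚ < r → r * p ≤ r * q → p ≤ q
  *-cancel r _ _ 0<r = ℚ.*-cancelˡ-≤-pos r {{ℚ.positive 0<r}}

  inverse : ∀ p → 0ℚ < p → ∃[ q ] (0ℚ < q × q * p ≡ 1ℚ)
  inverse p 0<p = (ℚ.1/ p) , ℚ.positive⁻¹ _ {{ℚ.1/pos⇒pos p}} , ℚ.*-inverseˡ p
    where instance
      _ = ℚ.positive 0<p
      _ = ℚ.pos⇒nonZero p

  abs-≤ : ∀ {p s} → p ≤ s → - p ≤ s → ∣ p ∣ ≤ s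
  abs-≤ {p} p≤s -p≤s with ℚ.∣p∣≡p∨∣p∣≡-p p
  ... | inj₁ eq = subst (_≤ _) (sym eq) p≤s
  ... | inj₂ eq = subst (_≤ _) (sym eq) -p≤s

  p≤∣p∣ : ∀ p → p ≤ ∣ p ∣
  p≤∣p∣ p with ℚ.≤-total 0ℚ p
  ... | inj₁ 0≤p = ℚ.≤-reflexive (sym (ℚ.0≤p⇒∣p∣≡p 0≤p))
  ... | inj₂ p≤0 = ℚ.≤-trans p≤0 (ℚ.0≤∣p∣ p)

  ∣-∣-comm : ∀ p q → ∣ p - q ∣ ≡ ∣ q - p ∣
  ∣-∣-comm p q = trans (sym (ℚ.∣-p∣≡∣p∣ (p - q)))
    (cong ∣_∣ (solve 2 (λ p q → :- (p :- q) := q :- p) refl p q))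

  dist-≤ : ∀ {p q s} → p ≤ q + s → q ≤ p + s → ∣ p - q ∣ ≤ s
  dist-≤ {p} {q} {s} h k = abs-≤
    (begin p - q      ≤⟨ ℚ.+-monoˡ-≤ (- q) h ⟩
           q + s - q  ≡⟨ solve 2 (λ q s → q :+ s :- q := s) refl q s ⟩
           s ∎)
    (begin - (p - q)  ≡⟨ solve 2 (λ p q → :- (p :- q) := q :- p) refl p q ⟩
           q - p      ≤⟨ ℚ.+-monoˡ-≤ (- p) k ⟩
           p + s - p  ≡⟨ solve 2 (λ q s → q :+ s :- q := s) refl p s ⟩
           s ∎)

  ≤+dist : ∀ p q → p ≤ q + ∣ p - q ∣
  ≤+dist p q = begin
    p              ≡⟨ solve 2 (λ p q → p := q :+ (p :- q)) refl p q ⟩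
    q + (p - q)    ≤⟨ ℚ.+-monoʳ-≤ q (p≤∣p∣ (p - q)) ⟩
    q + ∣ p - q ∣  ∎

  triangle : ∀ p q r → ∣ p - r ∣ ≤ ∣ p - q ∣ + ∣ q - r ∣
  triangle p q r = begin
    ∣ p - r ∣                ≡⟨ cong ∣_∣ (solve 3 (λ p q r → p :- r := (p :- q) :+ (q :- r)) refl p q r) ⟩
    ∣ (p - q) + (q - r) ∣    ≤⟨ ℚ.∣p+q∣≤∣p∣+∣q∣ (p - q) (q - r) ⟩
    ∣ p - q ∣ + ∣ q - r ∣    ∎

  +-dist : ∀ a b c d → ∣ (a + b) - (c + d) ∣ ≤ ∣ a - c ∣ + ∣ b - d ∣
  +-dist a b c d = begin
    ∣ (a + b) - (c + d) ∣    ≡⟨ cong ∣_∣ (solve 4 (λ a b c d → (a :+ b) :- (c :+ d) := (a :- c) :+ (b :- d)) refl a b c d) ⟩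
    ∣ (a - c) + (b - d) ∣    ≤⟨ ℚ.∣p+q∣≤∣p∣+∣q∣ (a - c) (b - d) ⟩
    ∣ a - c ∣ + ∣ b - d ∣    ∎

  *-dist : ∀ a b c d → ∣ a * b - c * d ∣ ≤ ∣ a ∣ * ∣ b - d ∣ + ∣ d ∣ * ∣ a - c ∣
  *-dist a b c d = begin
    ∣ a * b - c * d ∣                    ≡⟨ cong ∣_∣ (solve 4 (λ a b c d → a :* b :- c :* d := a :* (b :- d) :+ d :* (a :- c)) refl a b c d) ⟩
    ∣ a * (b - d) + d * (a - c) ∣        ≤⟨ ℚ.∣p+q∣≤∣p∣+∣q∣ (a * (b - d)) (d * (a - c)) ⟩
    ∣ a * (b - d) ∣ + ∣ d * (a - c) ∣    ≡⟨ cong₂ _+_ (ℚ.∣p*q∣≡∣p∣*∣q∣ a (b - d)) (ℚ.∣p*q∣≡∣p∣*∣q∣ d (a - c)) ⟩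
    ∣ a ∣ * ∣ b - d ∣ + ∣ d ∣ * ∣ a - c ∣ ∎

  p≤p+q : ∀ {p q} → 0ℚ ≤ q → p ≤ p + q
  p≤p+q {p} {q} 0≤q = subst (_≤ p + q) (ℚ.+-identityʳ p) (ℚ.+-monoʳ-≤ p 0≤q)

  p≤q+p : ∀ {p q} → 0ℚ ≤ q → p ≤ q + p
  p≤q+p {p} {q} 0≤q = subst (_≤ q + p) (ℚ.+-identityˡ p) (ℚ.+-monoˡ-≤ p 0≤q)

  ⊔-≤ : ∀ a b c d → a ⊔ b ≤ (c ⊔ d) + (∣ a - c ∣ + ∣ b - d ∣)
  ⊔-≤ a b c d = ℚ.⊔-lub
    (begin a                                  ≤⟨ ≤+dist a c ⟩
           c + ∣ a - c ∣                      ≤⟨ ℚ.+-mono-≤ (ℚ.p≤p⊔q c d) (p≤p+q (ℚ.0≤∣p∣ (b - d))) ⟩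
           (c ⊔ d) + (∣ a - c ∣ + ∣ b - d ∣)  ∎)
    (begin b                                  ≤⟨ ≤+dist b d ⟩
           d + ∣ b - d ∣                      ≤⟨ ℚ.+-mono-≤ (ℚ.p≤q⊔p c d) (p≤q+p (ℚ.0≤∣p∣ (a - c))) ⟩
           (c ⊔ d) + (∣ a - c ∣ + ∣ b - d ∣)  ∎)

  ⊔-dist : ∀ a b c d → ∣ (a ⊔ b) - (c ⊔ d) ∣ ≤ ∣ a - c ∣ + ∣ b - d ∣
  ⊔-dist a b c d = dist-≤ (⊔-≤ a b c d)
    (subst (λ s → c ⊔ d ≤ (a ⊔ b) + s) (cong₂ _+_ (∣-∣-comm c a) (∣-∣-comm d b)) (⊔-≤ c d a b))


  cancel : ∀ p p⁻¹ r → p⁻¹ * p ≡ 1ℚ → p * (p⁻¹ * r) ≡ r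
  cancel p p⁻¹ r eq = begin-equality
    p * (p⁻¹ * r)  ≡⟨ solve 3 (λ p i r → p :* (i :* r) := i :* p :* r) refl p p⁻¹ r ⟩
    p⁻¹ * p * r    ≡⟨ cong (_* r) eq ⟩
    1ℚ * r         ≡⟨ ℚ.*-identityˡ r ⟩
    r              ∎

  *-dist-≤ : ∀ a b c d p q r s → ∣ a ∣ ≤ p → ∣ d ∣ ≤ q → ∣ b - d ∣ ≤ r → ∣ a - c ∣ ≤ s →
             ∣ a * b - c * d ∣ ≤ p * r + q * s
  *-dist-≤ a b c d p q r s hp hq hr hs = begin
    ∣ a * b - c * d ∣
      ≤⟨ *-dist a b c d ⟩
    ∣ a ∣ * ∣ b - d ∣ + ∣ d ∣ * ∣ a - c ∣
      ≤⟨ ℚ.+-mono-≤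
           (*-mono (∣ a ∣) p (∣ b - d ∣) r (ℚ.0≤∣p∣ a) (ℚ.≤-trans (ℚ.0≤∣p∣ (b - d)) hr) hp hr)
           (*-mono (∣ d ∣) q (∣ a - c ∣) s (ℚ.0≤∣p∣ d) (ℚ.≤-trans (ℚ.0≤∣p∣ (a - c)) hs) hq hs) ⟩
    p * r + q * s ∎
------------------------------------------------------------------------
-- Cauchy sequences of rationals

IsCauchy : (ℕ → ℚ) → Set
IsCauchy x = ∀ ε → 0ℚ ℚ.< ε →
  ∃[ N ] ∀ m n → N ℕ.≤ m → N ℕ.≤ n → ℚ.∣ x m ℚ.- x n ∣ ℚ.≤ ε

inv : ℚ → ℚ
inv q with q ℚ.≟ 0ℚ
... | yes _   = 0ℚ
... | no  q≢0 = ℚ.1/_ q {{ℚ.≢-nonZero q≢0}}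

ℕ→ℚ : ℕ → ℚ
ℕ→ℚ n = + n ℚ./ 1

-- expTerm q k = qᵏ / k!
expTerm : ℚ → ℕ → ℚ
expTerm q zero    = 1ℚ
expTerm q (suc k) = expTerm q k ℚ.* q ℚ.* (+ 1 ℚ./ suc k)

-- expSum q n = Σ_{k ≤ n} qᵏ / k!
expSum : ℚ → ℕ → ℚ
expSum q zero    = expTerm q zero
expSum q (suc n) = expSum q n ℚ.+ expTerm q (suc n)

module CauchyProofs where
  open import Data.Rational.Base using (_+_; _-_; _*_; -_; _⊔_; _≤_; _<_; ∣_∣; _/_; mkℚ)
  open import Data.Rational.Unnormalised.Base using (mkℚᵘ; *≤*; *≡*)
  import Data.Rational.Unnormalised.Properties as ℚᵘ
  open Estimates
  open ℚ.≤-Reasoning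
  open +-*-Solver using (solve; _:+_; _:*_; :-_; _:-_; _:=_; con)

  private variable x y : ℕ → ℚ

  ⊔≤ˡ : ∀ m n {k} → m ℕ.⊔ n ℕ.≤ k → m ℕ.≤ k
  ⊔≤ˡ m n = ℕ.m⊔n≤o⇒m≤o m n

  ⊔≤ʳ : ∀ m n {k} → m ℕ.⊔ n ℕ.≤ k → n ℕ.≤ k
  ⊔≤ʳ m n = ℕ.m⊔n≤o⇒n≤o m n

  const-cauchy : ∀ q → IsCauchy (λ _ → q)
  const-cauchy q ε 0<ε = 0 , λ _ _ _ _ →
    subst (_≤ ε) (sym (cong ∣_∣ (ℚ.+-inverseʳ q))) (ℚ.<⇒≤ 0<ε)

  nonexpansive₂ : (_∙_ : ℚ → ℚ → ℚ) →
                  (∀ a b c d → ∣ (a ∙ b) - (c ∙ d) ∣ ≤ ∣ a - c ∣ + ∣ b - d ∣) →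
                  IsCauchy x → IsCauchy y → IsCauchy (λ n → x n ∙ y n)
  nonexpansive₂ {x} {y} _∙_ dist cx cy ε 0<ε
    with δ , 0<δ , eq ← halve ε 0<ε
    with N₁ , h₁ ← cx δ 0<δ | N₂ , h₂ ← cy δ 0<δ
    = N₁ ℕ.⊔ N₂ , λ m n N≤m N≤n → begin
      ∣ (x m ∙ y m) - (x n ∙ y n) ∣    ≤⟨ dist (x m) (y m) (x n) (y n) ⟩
      ∣ x m - x n ∣ + ∣ y m - y n ∣    ≤⟨ ℚ.+-mono-≤ (h₁ m n (⊔≤ˡ N₁ N₂ N≤m) (⊔≤ˡ N₁ N₂ N≤n)) (h₂ m n (⊔≤ʳ N₁ N₂ N≤m) (⊔≤ʳ N₁ N₂ N≤n)) ⟩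
      δ + δ                            ≡⟨ eq ⟩
      ε                                ∎

  +-cauchy : IsCauchy x → IsCauchy y → IsCauchy (λ n → x n + y n)
  +-cauchy {x} {y} = nonexpansive₂ {x} {y} _+_ +-dist

  ⊔-cauchy : IsCauchy x → IsCauchy y → IsCauchy (λ n → x n ⊔ y n)
  ⊔-cauchy {x} {y} = nonexpansive₂ {x} {y} _⊔_ ⊔-dist

  neg-cauchy : IsCauchy x → IsCauchy (λ n → - x n)
  neg-cauchy {x} cx ε 0<ε with N , h ← cx ε 0<ε = N , λ m n N≤m N≤n → begin
    ∣ - x m - - x n ∣  ≡⟨ cong ∣_∣ (solve 2 (λ a b → :- a :- :- b := b :- a) refl (x m) (x n)) ⟩
    ∣ x n - x m ∣      ≤⟨ h n m N≤n N≤m ⟩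
    ε                  ∎

  bounded : IsCauchy x → ∃[ B ] (0ℚ < B × ∃[ N ] ∀ n → N ℕ.≤ n → ∣ x n ∣ ≤ B)
  bounded {x} cx with N , h ← cx 1ℚ (ℚ.positive⁻¹ 1ℚ) =
    ∣ x N ∣ + 1ℚ , ℚ.<-≤-trans (ℚ.positive⁻¹ 1ℚ) (p≤q+p (ℚ.0≤∣p∣ (x N))) , N , λ n N≤n → begin
      ∣ x n ∣                      ≡⟨ cong ∣_∣ (solve 2 (λ a b → a := b :+ (a :- b)) refl (x n) (x N)) ⟩
      ∣ x N + (x n - x N) ∣        ≤⟨ ℚ.∣p+q∣≤∣p∣+∣q∣ (x N) (x n - x N) ⟩
      ∣ x N ∣ + ∣ x n - x N ∣      ≤⟨ ℚ.+-monoʳ-≤ ∣ x N ∣ (h n N N≤n ℕ.≤-refl) ⟩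
      ∣ x N ∣ + 1ℚ                 ∎

  *-cauchy : IsCauchy x → IsCauchy y → IsCauchy (λ n → x n * y n)
  *-cauchy {x} {y} cx cy ε 0<ε =
    let A , 0<A , M₁ , a = bounded {x} cx
        B , 0<B , M₂ , b = bounded {y} cy
        A⁻¹ , 0<A⁻¹ , eqA = inverse A 0<A
        B⁻¹ , 0<B⁻¹ , eqB = inverse B 0<B
        δ , 0<δ , eq = halve ε 0<ε
        N₁ , h₁ = cx (B⁻¹ * δ) (*-pos B⁻¹ δ 0<B⁻¹ 0<δ)
        N₂ , h₂ = cy (A⁻¹ * δ) (*-pos A⁻¹ δ 0<A⁻¹ 0<δ)
        L = M₁ ℕ.⊔ M₂ ; R = N₁ ℕ.⊔ N₂
    in
    L ℕ.⊔ R , λ m n N≤m N≤n → begin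
      ∣ x m * y m - x n * y n ∣
        ≤⟨ *-dist-≤ (x m) (y m) (x n) (y n) A B (A⁻¹ * δ) (B⁻¹ * δ)
             (a m (⊔≤ˡ M₁ M₂ (⊔≤ˡ L R N≤m))) (b n (⊔≤ʳ M₁ M₂ (⊔≤ˡ L R N≤n)))
             (h₂ m n (⊔≤ʳ N₁ N₂ (⊔≤ʳ L R N≤m)) (⊔≤ʳ N₁ N₂ (⊔≤ʳ L R N≤n)))
             (h₁ m n (⊔≤ˡ N₁ N₂ (⊔≤ʳ L R N≤m)) (⊔≤ˡ N₁ N₂ (⊔≤ʳ L R N≤n))) ⟩
      A * (A⁻¹ * δ) + B * (B⁻¹ * δ)
        ≡⟨ cong₂ _+_ (cancel A A⁻¹ δ eqA) (cancel B B⁻¹ δ eqB) ⟩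
      δ + δ
        ≡⟨ eq ⟩
      ε ∎

  inv-inverse : ∀ {q} → 0ℚ < q → q * inv q ≡ 1ℚ
  inv-inverse {q} 0<q with q ℚ.≟ 0ℚ
  ... | yes refl = contradiction 0<q (ℚ.<-irrefl refl)
  ... | no  q≢0  = ℚ.*-inverseʳ q {{ℚ.≢-nonZero q≢0}}

  inv-nonNeg : ∀ {q} → 0ℚ < q → 0ℚ ≤ inv q
  inv-nonNeg {q} 0<q = *-cancel q 0ℚ (inv q) 0<q (begin
    q * 0ℚ     ≡⟨ ℚ.*-zeroʳ q ⟩
    0ℚ         ≤⟨ ℚ.<⇒≤ (ℚ.positive⁻¹ 1ℚ) ⟩
    1ℚ         ≡⟨ sym (inv-inverse 0<q) ⟩
    q * inv q  ∎)

  inv-≤ : ∀ {δ δ⁻¹ q} → 0ℚ < δ⁻¹ → δ⁻¹ * δ ≡ 1ℚ → 0ℚ < q → δ ≤ q → inv q ≤ δ⁻¹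
  inv-≤ {δ} {δ⁻¹} {q} 0<δ⁻¹ eq 0<q δ≤q = *-cancel q (inv q) δ⁻¹ 0<q (begin
    q * inv q  ≡⟨ inv-inverse 0<q ⟩
    1ℚ         ≡⟨ sym eq ⟩
    δ⁻¹ * δ    ≤⟨ *-monoʳ δ⁻¹ δ q (ℚ.<⇒≤ 0<δ⁻¹) δ≤q ⟩
    δ⁻¹ * q    ≡⟨ ℚ.*-comm δ⁻¹ q ⟩
    q * δ⁻¹    ∎)

  inv-cauchy : (∃[ δ ] (0ℚ < δ × ∃[ N ] ∀ n → N ℕ.≤ n → δ ≤ x n)) →
               IsCauchy x → IsCauchy (λ n → inv (x n))
  inv-cauchy {x} (δ , 0<δ , M , big) cx ε 0<ε
    with E , 0<E , eq ← inverse δ 0<δ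
    with N , h ← cx (δ * δ * ε) (*-pos (δ * δ) ε (*-pos δ δ 0<δ 0<δ) 0<ε)
    = M ℕ.⊔ N , λ m n N≤m N≤n →
      let bm = big m (⊔≤ˡ M N N≤m) ; bn = big n (⊔≤ˡ M N N≤n)
          0<xm = ℚ.<-≤-trans 0<δ bm ; 0<xn = ℚ.<-≤-trans 0<δ bn
          u = inv (x m) ; v = inv (x n)
      in begin
        ∣ u - v ∣
          ≡⟨ cong ∣_∣ (cong₂ _-_ (sym (ℚ.*-identityʳ u)) (sym (ℚ.*-identityʳ v))) ⟩
        ∣ u * 1ℚ - v * 1ℚ ∣
          ≡⟨ cong ∣_∣ (cong₂ _-_ (cong (u *_) (sym (inv-inverse 0<xn))) (cong (v *_) (sym (inv-inverse 0<xm)))) ⟩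
        ∣ u * (x n * v) - v * (x m * u) ∣
          ≡⟨ cong ∣_∣ (solve 4 (λ u v a b → u :* (b :* v) :- v :* (a :* u) := u :* v :* (b :- a)) refl u v (x m) (x n)) ⟩
        ∣ u * v * (x n - x m) ∣
          ≡⟨ ℚ.∣p*q∣≡∣p∣*∣q∣ (u * v) (x n - x m) ⟩
        ∣ u * v ∣ * ∣ x n - x m ∣
          ≡⟨ cong (_* ∣ x n - x m ∣) (ℚ.0≤p⇒∣p∣≡p (*-nonNeg u v (inv-nonNeg 0<xm) (inv-nonNeg 0<xn))) ⟩
        u * v * ∣ x n - x m ∣
          ≤⟨ *-mono (u * v) (E * E) (∣ x n - x m ∣) (δ * δ * ε) (*-nonNeg u v (inv-nonNeg 0<xm) (inv-nonNeg 0<xn))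
               (ℚ.<⇒≤ (*-pos (δ * δ) ε (*-pos δ δ 0<δ 0<δ) 0<ε))
               (*-mono u E v E (inv-nonNeg 0<xm) (ℚ.<⇒≤ 0<E) (inv-≤ 0<E eq 0<xm bm) (inv-≤ 0<E eq 0<xn bn))
               (h n m (⊔≤ʳ M N N≤n) (⊔≤ʳ M N N≤m)) ⟩
        E * E * (δ * δ * ε)
          ≡⟨ solve 3 (λ E d e → E :* E :* (d :* d :* e) := (E :* d) :* ((E :* d) :* e)) refl E δ ε ⟩
        E * δ * (E * δ * ε)
          ≡⟨ cong (λ z → z * (z * ε)) eq ⟩
        1ℚ * (1ℚ * ε)
          ≡⟨ trans (ℚ.*-identityˡ (1ℚ * ε)) (ℚ.*-identityˡ ε) ⟩
        ε ∎

  ℕ→ℚ-mono : ∀ {m n} → m ℕ.≤ n → ℕ→ℚ m ≤ ℕ→ℚ n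
  ℕ→ℚ-mono {m} {n} m≤n = ℚ.toℚᵘ-cancel-≤
    (ℚᵘ.≤-respˡ-≃ (ℚᵘ.≃-sym (ℚ.toℚᵘ-fromℚᵘ (mkℚᵘ (+ m) 0)))
    (ℚᵘ.≤-respʳ-≃ (ℚᵘ.≃-sym (ℚ.toℚᵘ-fromℚᵘ (mkℚᵘ (+ n) 0)))
    (*≤* (ℤ.*-monoʳ-≤-nonNeg (+ 1) (ℤ.+≤+ m≤n)))))

  archimedean : ∀ q → ∃[ n ] q ≤ ℕ→ℚ n
  archimedean q@(mkℚ i d _) = ℤ.∣ i ∣ , ℚ.toℚᵘ-cancel-≤
    (ℚᵘ.≤-respʳ-≃ (ℚᵘ.≃-sym (ℚ.toℚᵘ-fromℚᵘ (mkℚᵘ (+ ℤ.∣ i ∣) 0)))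
    (*≤* (ℤ.≤-trans (ℤ.*-monoʳ-≤-nonNeg (+ 1) (i≤+∣i∣ i))
         (ℤ.*-monoˡ-≤-nonNeg (+ ℤ.∣ i ∣) (ℤ.+≤+ (ℕ.s≤s ℕ.z≤n))))))
    where
    i≤+∣i∣ : ∀ i → i ℤ.≤ + ℤ.∣ i ∣
    i≤+∣i∣ (+ n)      = ℤ.≤-refl
    i≤+∣i∣ ℤ.-[1+ n ] = ℤ.-≤+

  1/suc-inverse : ∀ k → (+ 1 / suc k) * ℕ→ℚ (suc k) ≡ 1ℚ
  1/suc-inverse k = ℚ.toℚᵘ-injective
    (ℚᵘ.≃-trans (ℚ.toℚᵘ-homo-* (+ 1 / suc k) (ℕ→ℚ (suc k)))
    (ℚᵘ.≃-trans (ℚᵘ.*-cong (ℚ.toℚᵘ-fromℚᵘ (mkℚᵘ (+ 1) k)) (ℚ.toℚᵘ-fromℚᵘ (mkℚᵘ (+ suc k) 0)))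
    (*≡* (trans (ℤ.*-identityʳ (+ 1 ℤ.* + suc k)) (trans (ℤ.*-identityˡ (+ suc k))
         (trans (cong (λ j → + suc j) (sym (ℕ.*-identityʳ k))) (sym (ℤ.*-identityˡ (+ suc (k ℕ.* 1))))))))))

  ℕ→ℚ-suc : ∀ k → ℕ→ℚ (suc k) ≡ ℕ→ℚ k + 1ℚ
  ℕ→ℚ-suc k = ℚ.toℚᵘ-injective
    (ℚᵘ.≃-trans (ℚ.toℚᵘ-fromℚᵘ (mkℚᵘ (+ suc k) 0))
    (ℚᵘ.≃-trans (*≡* (cong (ℤ._* + 1) suc-eq))
    (ℚᵘ.≃-trans (ℚᵘ.+-cong (ℚᵘ.≃-sym (ℚ.toℚᵘ-fromℚᵘ (mkℚᵘ (+ k) 0))) (ℚᵘ.≃-refl {mkℚᵘ (+ 1) 0}))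
    (ℚᵘ.≃-sym (ℚ.toℚᵘ-homo-+ (ℕ→ℚ k) 1ℚ)))))
    where
    suc-eq : + suc k ≡ + k ℤ.* + 1 ℤ.+ + 1 ℤ.* + 1
    suc-eq = trans (ℤ.+-comm (+ 1) (+ k)) (cong (ℤ._+ + 1) (sym (ℤ.*-identityʳ (+ k))))

  0<1/suc : ∀ k → 0ℚ < + 1 / suc k
  0<1/suc k = ℚ.positive⁻¹ (+ 1 / suc k) {{ℚ.normalize-pos 1 (suc k)}}

  0<ℕ→ℚ-suc : ∀ k → 0ℚ < ℕ→ℚ (suc k)
  0<ℕ→ℚ-suc k = ℚ.positive⁻¹ (ℕ→ℚ (suc k)) {{ℚ.normalize-pos (suc k) 1}}

  expTerm-suc : ∀ q k → expTerm q (suc k) * ℕ→ℚ (suc k) ≡ expTerm q k * q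
  expTerm-suc q k = begin-equality
    expTerm q k * q * r * c    ≡⟨ ℚ.*-assoc (expTerm q k * q) r c ⟩
    expTerm q k * q * (r * c)  ≡⟨ cong (expTerm q k * q *_) (1/suc-inverse k) ⟩
    expTerm q k * q * 1ℚ       ≡⟨ ℚ.*-identityʳ (expTerm q k * q) ⟩
    expTerm q k * q            ∎
    where r = + 1 / suc k ; c = ℕ→ℚ (suc k)

  module _ (B : ℚ) (0<B : 0ℚ < B) where

    t T : ℕ → ℚ
    t = expTerm B
    T = expSum B

    0<t : ∀ k → 0ℚ < t k
    0<t zero    = ℚ.positive⁻¹ 1ℚ
    0<t (suc k) = *-pos (t k * B) (+ 1 / suc k) (*-pos (t k) B (0<t k) 0<B) (0<1/suc k)

    0≤t : ∀ k → 0ℚ ≤ t k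
    0≤t k = ℚ.<⇒≤ (0<t k)

    ∣expTerm∣≤ : ∀ {q} → ∣ q ∣ ≤ B → ∀ k → ∣ expTerm q k ∣ ≤ t k
    ∣expTerm∣≤ q≤B zero = ℚ.≤-refl
    ∣expTerm∣≤ {q} q≤B (suc k) = begin
      ∣ expTerm q k * q * r ∣        ≡⟨ ℚ.∣p*q∣≡∣p∣*∣q∣ (expTerm q k * q) r ⟩
      ∣ expTerm q k * q ∣ * ∣ r ∣    ≡⟨ cong₂ _*_ (ℚ.∣p*q∣≡∣p∣*∣q∣ (expTerm q k) q) (ℚ.0≤p⇒∣p∣≡p (ℚ.<⇒≤ (0<1/suc k))) ⟩
      ∣ expTerm q k ∣ * ∣ q ∣ * r    ≤⟨ *-mono (∣ expTerm q k ∣ * ∣ q ∣) (t k * B) r r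
                                          (*-nonNeg (∣ expTerm q k ∣) (∣ q ∣) (ℚ.0≤∣p∣ (expTerm q k)) (ℚ.0≤∣p∣ q)) (ℚ.<⇒≤ (0<1/suc k))
                                          (*-mono (∣ expTerm q k ∣) (t k) (∣ q ∣) B (ℚ.0≤∣p∣ (expTerm q k)) (ℚ.<⇒≤ 0<B) (∣expTerm∣≤ q≤B k) q≤B) ℚ.≤-refl ⟩
      t k * B * r                    ∎
      where r = + 1 / suc k

    tail-dominated : ∀ {q} → ∣ q ∣ ≤ B → ∀ n k → ∣ expSum q (k ℕ.+ n) - expSum q n ∣ ≤ T (k ℕ.+ n) - T n
    tail-dominated {q} q≤B n zero = begin
      ∣ expSum q n - expSum q n ∣  ≡⟨ cong ∣_∣ (ℚ.+-inverseʳ (expSum q n)) ⟩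
      0ℚ                           ≡⟨ sym (ℚ.+-inverseʳ (T n)) ⟩
      T n - T n                    ∎
    tail-dominated {q} q≤B n (suc k) = begin
      ∣ S + s - S₀ ∣         ≡⟨ cong ∣_∣ (solve 3 (λ S s S₀ → S :+ s :- S₀ := (S :- S₀) :+ s) refl S s S₀) ⟩
      ∣ (S - S₀) + s ∣       ≤⟨ ℚ.∣p+q∣≤∣p∣+∣q∣ (S - S₀) s ⟩
      ∣ S - S₀ ∣ + ∣ s ∣     ≤⟨ ℚ.+-mono-≤ (tail-dominated q≤B n k) (∣expTerm∣≤ q≤B (suc (k ℕ.+ n))) ⟩
      (T (k ℕ.+ n) - T n) + t (suc (k ℕ.+ n))
                             ≡⟨ solve 3 (λ S s S₀ → (S :- S₀) :+ s := S :+ s :- S₀) refl (T (k ℕ.+ n)) (t (suc (k ℕ.+ n))) (T n) ⟩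
      T (k ℕ.+ n) + t (suc (k ℕ.+ n)) - T n ∎
      where S = expSum q (k ℕ.+ n) ; s = expTerm q (suc (k ℕ.+ n)) ; S₀ = expSum q n

    module _ {a b : ℚ} (a≤B : ∣ a ∣ ≤ B) (b≤B : ∣ b ∣ ≤ B) where
      private
        δ = ∣ a - b ∣
        d : ℕ → ℚ
        d k = ∣ expTerm a k - expTerm b k ∣

      lip-suc : ∀ k → d k * B ≤ δ * (ℕ→ℚ k * t k) → d (suc k) ≤ δ * t k
      lip-suc k h = begin
        ∣ ta * a * r - tb * b * r ∣      ≡⟨ cong ∣_∣ (solve 3 (λ x y r → x :* r :- y :* r := (x :- y) :* r) refl (ta * a) (tb * b) r) ⟩
        ∣ (ta * a - tb * b) * r ∣        ≡⟨ ℚ.∣p*q∣≡∣p∣*∣q∣ (ta * a - tb * b) r ⟩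
        ∣ ta * a - tb * b ∣ * ∣ r ∣      ≡⟨ cong (∣ ta * a - tb * b ∣ *_) (ℚ.0≤p⇒∣p∣≡p 0≤r) ⟩
        ∣ ta * a - tb * b ∣ * r          ≤⟨ ℚ.*-monoʳ-≤-nonNeg r {{ℚ.nonNegative 0≤r}} (*-dist-≤ ta a tb b (t k) B δ (d k) (∣expTerm∣≤ a≤B k) b≤B ℚ.≤-refl ℚ.≤-refl) ⟩
        (t k * δ + B * d k) * r          ≤⟨ ℚ.*-monoʳ-≤-nonNeg r {{ℚ.nonNegative 0≤r}} (ℚ.+-monoʳ-≤ (t k * δ) (subst (_≤ δ * (ℕ→ℚ k * t k)) (ℚ.*-comm (d k) B) h)) ⟩
        (t k * δ + δ * (ℕ→ℚ k * t k)) * r  ≡⟨ solve 4 (λ t δ n r → (t :* δ :+ δ :* (n :* t)) :* r := (δ :* t) :* (r :* (n :+ con 1ℚ))) refl (t k) δ (ℕ→ℚ k) r ⟩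
        δ * t k * (r * (ℕ→ℚ k + 1ℚ))     ≡⟨ cong (λ z → δ * t k * (r * z)) (sym (ℕ→ℚ-suc k)) ⟩
        δ * t k * (r * ℕ→ℚ (suc k))      ≡⟨ cong (δ * t k *_) (1/suc-inverse k) ⟩
        δ * t k * 1ℚ                     ≡⟨ ℚ.*-identityʳ (δ * t k) ⟩
        δ * t k                          ∎
        where
        ta = expTerm a k ; tb = expTerm b k ; r = + 1 / suc k
        0≤r = ℚ.<⇒≤ (0<1/suc k)

      lip-weighted : ∀ k → d k * B ≤ δ * (ℕ→ℚ k * t k)
      lip-weighted zero = ℚ.≤-reflexive (trans (ℚ.*-zeroˡ B) (sym (ℚ.*-zeroʳ δ)))
      lip-weighted (suc k) = begin
        d (suc k) * B                     ≤⟨ ℚ.*-monoʳ-≤-nonNeg B {{ℚ.nonNegative (ℚ.<⇒≤ 0<B)}} (lip-suc k (lip-weighted k)) ⟩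
        δ * t k * B                       ≡⟨ ℚ.*-assoc δ (t k) B ⟩
        δ * (t k * B)                     ≡⟨ cong (δ *_) (sym (expTerm-suc B k)) ⟩
        δ * (t (suc k) * ℕ→ℚ (suc k))     ≡⟨ cong (δ *_) (ℚ.*-comm (t (suc k)) (ℕ→ℚ (suc k))) ⟩
        δ * (ℕ→ℚ (suc k) * t (suc k))     ∎

      lip-sum′ : ∀ n → ∣ expSum a n - expSum b n ∣ + δ * t n ≤ δ * T n
      lip-sum′ zero = ℚ.≤-reflexive (ℚ.+-identityˡ (δ * 1ℚ))
      lip-sum′ (suc n) = begin
        ∣ (Sa + sa) - (Sb + sb) ∣ + δ * t (suc n)   ≤⟨ ℚ.+-monoˡ-≤ (δ * t (suc n)) (+-dist Sa sa Sb sb) ⟩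
        ∣ Sa - Sb ∣ + d (suc n) + δ * t (suc n)     ≤⟨ ℚ.+-monoˡ-≤ (δ * t (suc n)) (ℚ.+-monoʳ-≤ ∣ Sa - Sb ∣ (lip-suc n (lip-weighted n))) ⟩
        ∣ Sa - Sb ∣ + δ * t n + δ * t (suc n)       ≤⟨ ℚ.+-monoˡ-≤ (δ * t (suc n)) (lip-sum′ n) ⟩
        δ * T n + δ * t (suc n)                     ≡⟨ sym (ℚ.*-distribˡ-+ δ (T n) (t (suc n))) ⟩
        δ * (T n + t (suc n))                       ∎
        where Sa = expSum a n ; sa = expTerm a (suc n) ; Sb = expSum b n ; sb = expTerm b (suc n)

      lip-sum : ∀ n → ∣ expSum a n - expSum b n ∣ ≤ δ * T n
      lip-sum n = ℚ.≤-trans (p≤p+q (*-nonNeg δ (t n) (ℚ.0≤∣p∣ (a - b)) (0≤t n))) (lip-sum′ n)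

    K : ℕ
    K = proj₁ (archimedean (B + B))

    halving : ∀ n → K ℕ.≤ n → t (suc n) + t (suc n) ≤ t n
    halving n K≤n = *-cancel c (t (suc n) + t (suc n)) (t n) (0<ℕ→ℚ-suc n) (begin
      c * (t (suc n) + t (suc n))          ≡⟨ solve 2 (λ c t → c :* (t :+ t) := t :* c :+ t :* c) refl c (t (suc n)) ⟩
      t (suc n) * c + t (suc n) * c        ≡⟨ cong₂ _+_ (expTerm-suc B n) (expTerm-suc B n) ⟩
      t n * B + t n * B                    ≡⟨ sym (ℚ.*-distribˡ-+ (t n) B B) ⟩
      t n * (B + B)                        ≤⟨ *-monoʳ (t n) (B + B) c (0≤t n)
                                                (ℚ.≤-trans (proj₂ (archimedean (B + B))) (ℕ→ℚ-mono (ℕ.m≤n⇒m≤1+n K≤n))) ⟩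
      t n * c                              ≡⟨ ℚ.*-comm (t n) c ⟩
      c * t n                              ∎)
      where c = ℕ→ℚ (suc n)

    T+t-antitone : ∀ n → K ℕ.≤ n → ∀ k → T (k ℕ.+ n) + t (k ℕ.+ n) ≤ T n + t n
    T+t-antitone n K≤n zero = ℚ.≤-refl
    T+t-antitone n K≤n (suc k) = begin
      T m + t (suc m) + t (suc m)    ≡⟨ ℚ.+-assoc (T m) (t (suc m)) (t (suc m)) ⟩
      T m + (t (suc m) + t (suc m))  ≤⟨ ℚ.+-monoʳ-≤ (T m) (halving m (ℕ.≤-trans K≤n (ℕ.m≤n+m n k))) ⟩
      T m + t m                      ≤⟨ T+t-antitone n K≤n k ⟩
      T n + t n                      ∎
      where m = k ℕ.+ n

    T-tail : ∀ n → K ℕ.≤ n → ∀ k → T (k ℕ.+ n) - T n ≤ t n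
    T-tail n K≤n k = begin
      T (k ℕ.+ n) - T n  ≤⟨ ℚ.+-monoˡ-≤ (- T n) (ℚ.≤-trans (p≤p+q {T (k ℕ.+ n)} (0≤t (k ℕ.+ n))) (T+t-antitone n K≤n k)) ⟩
      T n + t n - T n    ≡⟨ solve 2 (λ T t → T :+ t :- T := t) refl (T n) (t n) ⟩
      t n                ∎

    t-bounded : ∀ k → t (k ℕ.+ K) ≤ t K
    t-bounded zero    = ℚ.≤-refl
    t-bounded (suc k) = ℚ.≤-trans (p≤p+q (0≤t (suc (k ℕ.+ K))))
      (ℚ.≤-trans (halving (k ℕ.+ K) (ℕ.m≤n+m K k)) (t-bounded k))

    t-null : ∀ η → 0ℚ < η → ∃[ M ] (K ℕ.≤ M × ∀ n → M ℕ.≤ n → t n ≤ η)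
    t-null η 0<η =
      let η⁻¹ , 0<η⁻¹ , eq = inverse η 0<η
          J , J-big = archimedean (η⁻¹ * (t K * B))
          bound : ∀ n → K ℕ.⊔ J ℕ.≤ n → t (suc n) ≤ η
          bound n le = *-cancel (ℕ→ℚ (suc n)) (t (suc n)) η (0<ℕ→ℚ-suc n) (begin
            ℕ→ℚ (suc n) * t (suc n)   ≡⟨ ℚ.*-comm (ℕ→ℚ (suc n)) (t (suc n)) ⟩
            t (suc n) * ℕ→ℚ (suc n)   ≡⟨ expTerm-suc B n ⟩
            t n * B                   ≤⟨ ℚ.*-monoʳ-≤-nonNeg B {{ℚ.nonNegative (ℚ.<⇒≤ 0<B)}}
                                           (subst (λ j → t j ≤ t K) (ℕ.m∸n+n≡m (⊔≤ˡ K J le)) (t-bounded (n ℕ.∸ K))) ⟩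
            t K * B                   ≡⟨ sym (cancel η η⁻¹ (t K * B) eq) ⟩
            η * (η⁻¹ * (t K * B))     ≤⟨ *-monoʳ η (η⁻¹ * (t K * B)) (ℕ→ℚ (suc n)) (ℚ.<⇒≤ 0<η)
                                           (ℚ.≤-trans J-big (ℕ→ℚ-mono (ℕ.m≤n⇒m≤1+n (⊔≤ʳ K J le)))) ⟩
            η * ℕ→ℚ (suc n)           ≡⟨ ℚ.*-comm η (ℕ→ℚ (suc n)) ⟩
            ℕ→ℚ (suc n) * η           ∎)
      in suc (K ℕ.⊔ J) , ℕ.m≤n⇒m≤1+n (ℕ.m≤m⊔n K J) ,
         λ { (suc n) (ℕ.s≤s le) → bound n le }

    tail-small : ∀ η → 0ℚ < η → ∃[ M ] (K ℕ.≤ M × ∀ q → ∣ q ∣ ≤ B → ∀ m n → M ℕ.≤ m → M ℕ.≤ n →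
                 ∣ expSum q m - expSum q n ∣ ≤ η)
    tail-small η 0<η =
      let M , K≤M , small = t-null η 0<η
          ordered : ∀ q → ∣ q ∣ ≤ B → ∀ m n → M ℕ.≤ n → n ℕ.≤ m → ∣ expSum q m - expSum q n ∣ ≤ η
          ordered q q≤B m n M≤n n≤m = subst (λ j → ∣ expSum q j - expSum q n ∣ ≤ η) (ℕ.m∸n+n≡m n≤m)
            (ℚ.≤-trans (tail-dominated q≤B n (m ℕ.∸ n))
            (ℚ.≤-trans (T-tail n (ℕ.≤-trans K≤M M≤n) (m ℕ.∸ n)) (small n M≤n)))
      in M , K≤M , λ q q≤B m n M≤m M≤n → case-total (ℕ.≤-total n m)
           (ordered q q≤B m n M≤n)
           (λ m≤n → subst (_≤ η) (∣-∣-comm (expSum q n) (expSum q m)) (ordered q q≤B n m M≤m m≤n))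
      where
      case-total : ∀ {P Q R : Set} → P ⊎ Q → (P → R) → (Q → R) → R
      case-total (inj₁ p) f g = f p
      case-total (inj₂ q) f g = g q

    D : ℚ
    D = T K + t K

    T≤D : ∀ n → K ℕ.≤ n → T n ≤ D
    T≤D n K≤n = subst (λ j → T j ≤ D) (ℕ.m∸n+n≡m K≤n)
      (ℚ.≤-trans (p≤p+q (0≤t (n ℕ.∸ K ℕ.+ K))) (T+t-antitone K ℕ.≤-refl (n ℕ.∸ K)))

    0<T : ∀ n → 0ℚ < T n
    0<T zero    = 0<t zero
    0<T (suc n) = ℚ.<-≤-trans (0<T n) (p≤p+q (0≤t (suc n)))

    0<D : 0ℚ < D
    0<D = ℚ.<-≤-trans (0<T K) (p≤p+q (0≤t K))

  exp-cauchy : IsCauchy x → IsCauchy (λ n → expSum (x n) n)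
  exp-cauchy {x} cx ε 0<ε =
    let B , 0<B , N₁ , bnd = bounded {x} cx
        δ , 0<δ , eq = halve ε 0<ε
        M , K≤M , tail = tail-small B 0<B δ 0<δ
        D⁻¹ , 0<D⁻¹ , eqD = inverse (D B 0<B) (0<D B 0<B)
        N₂ , h = cx (D⁻¹ * δ) (*-pos D⁻¹ δ 0<D⁻¹ 0<δ)
        L = N₁ ℕ.⊔ M
    in L ℕ.⊔ N₂ , λ m n N≤m N≤n →
      let xm≤B = bnd m (⊔≤ˡ N₁ M (⊔≤ˡ L N₂ N≤m)) ; xn≤B = bnd n (⊔≤ˡ N₁ M (⊔≤ˡ L N₂ N≤n))
          M≤m = ⊔≤ʳ N₁ M (⊔≤ˡ L N₂ N≤m) ; M≤n = ⊔≤ʳ N₁ M (⊔≤ˡ L N₂ N≤n)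
      in begin
        ∣ expSum (x m) m - expSum (x n) n ∣
          ≤⟨ triangle (expSum (x m) m) (expSum (x n) m) (expSum (x n) n) ⟩
        ∣ expSum (x m) m - expSum (x n) m ∣ + ∣ expSum (x n) m - expSum (x n) n ∣
          ≤⟨ ℚ.+-mono-≤ (lip-sum B 0<B xm≤B xn≤B m) (tail (x n) xn≤B m n M≤m M≤n) ⟩
        ∣ x m - x n ∣ * expSum B m + δ
          ≤⟨ ℚ.+-monoˡ-≤ δ (*-mono (∣ x m - x n ∣) (D⁻¹ * δ) (expSum B m) (D B 0<B) (ℚ.0≤∣p∣ (x m - x n)) (ℚ.<⇒≤ (0<D B 0<B))
               (h m n (⊔≤ʳ L N₂ N≤m) (⊔≤ʳ L N₂ N≤n)) (T≤D B 0<B m (ℕ.≤-trans K≤M M≤m))) ⟩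
        D⁻¹ * δ * D B 0<B + δ
          ≡⟨ cong (_+ δ) (trans (ℚ.*-comm (D⁻¹ * δ) (D B 0<B)) (cancel (D B 0<B) D⁻¹ δ eqD)) ⟩
        δ + δ
          ≡⟨ eq ⟩
        ε ∎

open CauchyProofs using (const-cauchy; +-cauchy; neg-cauchy; *-cauchy; ⊔-cauchy; inv-cauchy; exp-cauchy)

------------------------------------------------------------------------
-- Real numbers, as Cauchy sequences of rationals

record ℝ : Set where
  constructor real
  field
    seq    : ℕ → ℚ
    cauchy : IsCauchy seq

open ℝ public

infix  4 _≈_ _≤_ _<_
infixl 6 _+_ _-_ _⊔_
infixl 7 _*_
infixr 8 _^_
infix  8 -_

_≈_ _≤_ _<_ : ℝ → ℝ → Set
x ≈ y = ∀ ε → 0ℚ ℚ.< ε → ∃[ N ] ∀ n → N ℕ.≤ n → ℚ.∣ seq x n ℚ.- seq y n ∣ ℚ.≤ ε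
x ≤ y = ∀ ε → 0ℚ ℚ.< ε → ∃[ N ] ∀ n → N ℕ.≤ n → seq x n ℚ.≤ seq y n ℚ.+ ε
x < y = ∃[ δ ] (0ℚ ℚ.< δ × ∃[ N ] ∀ n → N ℕ.≤ n → seq x n ℚ.+ δ ℚ.≤ seq y n)

fromℚ : ℚ → ℝ
fromℚ q = real (λ _ → q) (const-cauchy q)

fromℕ : ℕ → ℝ
fromℕ n = fromℚ (ℕ→ℚ n)

0ℝ 1ℝ : ℝ
0ℝ = fromℚ 0ℚ
1ℝ = fromℚ 1ℚ

_+_ _*_ _⊔_ : ℝ → ℝ → ℝ
x + y = real (λ n → seq x n ℚ.+ seq y n) (+-cauchy {seq x} {seq y} (cauchy x) (cauchy y))
x * y = real (λ n → seq x n ℚ.* seq y n) (*-cauchy {seq x} {seq y} (cauchy x) (cauchy y))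
x ⊔ y = real (λ n → seq x n ℚ.⊔ seq y n) (⊔-cauchy {seq x} {seq y} (cauchy x) (cauchy y))

-_ ∣_∣ : ℝ → ℝ
- x   = real (λ n → ℚ.- seq x n) (neg-cauchy {seq x} (cauchy x))
∣ x ∣ = x ⊔ - x

_-_ : ℝ → ℝ → ℝ
x - y = x + - y

_^_ : ℝ → ℕ → ℝ
x ^ zero  = 1ℝ
x ^ suc n = x * x ^ n

-- 1/x; the value inv 0ℚ = 0ℚ can only occur at finitely many indices.
recip : (x : ℝ) → 0ℝ < x → ℝ
recip x (δ , 0<δ , N , δ≤x) = real (λ n → inv (seq x n)) (inv-cauchy {seq x}
  (δ , 0<δ , N , λ n N≤n → subst (ℚ._≤ seq x n) (ℚ.+-identityˡ δ) (δ≤x n N≤n)) (cauchy x))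

-- The diagonal sequence Σ_{k ≤ n} xₙᵏ / k!, which represents Σ_k xᵏ / k!.
exp : ℝ → ℝ
exp x = real (λ n → expSum (seq x n) n) (exp-cauchy {seq x} (cauchy x))

-- y = nᵗ for n ≥ 1 and real t, by comparison with rational exponents:
-- y > 0, and for every rational r = (a − b) / (1 + q),
-- r ≤ t implies nʳ ≤ y, and t ≤ r implies y ≤ nʳ.
-- The inequalities are cleared of denominators and of negative powers.
IsPower : ℕ → ℝ → ℝ → Set
IsPower n t y = 0ℝ < y × (∀ a b q →
  (fromℕ a - fromℕ b ≤ fromℕ (suc q) * t → fromℕ n ^ a ≤ y ^ suc q * fromℕ n ^ b) ×
  (fromℕ (suc q) * t ≤ fromℕ a - fromℕ b → y ^ suc q * fromℕ n ^ b ≤ fromℕ n ^ a))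

TendsToZero : (ℕ → ℝ) → Set
TendsToZero ε = ∀ η → 0ℝ < η → ∃[ N ] ∀ n → N ℕ.≤ n → ∣ ε n ∣ ≤ η

------------------------------------------------------------------------
-- Points and lines in ℝᵈ

Point : ℕ → Set
Point d = Vector ℝ d

‖_‖∞ : ∀ {d} → Point d → ℝ
‖ v ‖∞ = foldr _⊔_ 0ℝ (map ∣_∣ v)

InUnitCube : ∀ {d} → Point d → Set
InUnitCube p = ∀ k → 0ℝ ≤ p k × p k ≤ 1ℝ

record Line (d : ℕ) : Set where
  field
    base      : Point d
    direction : Point d
    nonzero   : ∃[ k ] 0ℝ < ∣ direction k ∣

open Line public

infix 4 _∈_

_∈_ : ∀ {d} → Point d → Line d → Set
p ∈ ℓ = ∃[ t ] ∀ k → p k ≈ base ℓ k + t * direction ℓ k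

dist∞ : ∀ {d} → Point d → Point d → ℝ
dist∞ p q = ‖ zipWith _-_ p q ‖∞

-- δ = min_{q ∈ ℓ} ‖ p − q ‖∞
IsDistance : ∀ {d} → Point d → Line d → ℝ → Set
IsDistance p ℓ δ = (∃[ q ] (q ∈ ℓ × dist∞ p q ≈ δ)) × (∀ q → q ∈ ℓ → δ ≤ dist∞ p q)

-- PL d γ; the exponent −1/(d − γ) + o(1) needs d ≠ γ, and only d > γ is of
-- interest, since for d < γ the upper bound would exceed 1.  The term o(1)
-- depends only on d, γ and n, not on the points and lines.
PL : (d : ℕ) (γ : ℝ) → 0ℝ < fromℕ d - γ → Set
PL d γ γ<d =
  ∃[ ε ] (TendsToZero ε × ∃[ N ] ∀ n → N ℕ.≤ n →
    (p : Fin n → Point d) (ℓ : Fin n → Line d) →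
    (∀ i → InUnitCube (p i)) → (∀ i → p i ∈ ℓ i) →
    ∃[ i ] ∃[ j ] (i ≢ j × ∃[ δ ] ∃[ r ]
      (IsDistance (p i) (ℓ j) δ × IsPower n (- recip (fromℕ d - γ) γ<d + ε n) r × δ ≤ r)))

{-# OPTIONS --safe #-}

-- Fix K = 2ᵃ variables and a prime p, and let b = p^(K+2), M = b^(K+1).  In units
-- of 1/M, a point has as coordinates an integer with K base-b digits x_s < p^K and,
-- for every j < K, the coefficients of polynomials (up to M) in K variables from a
-- space of dimension < 4^K whose sum vanishes modulo p at w = (⌊x_s / p^j⌋)_s.  By
-- Hadamard's lemma there are slopes such that, when w moves to w′ along the line,
-- this sum changes by − N(w′ − w), where N is a form of degree K with N(u) ≡ 0 only
-- for u ≡ 0 modulo p.  So if another point is near the line, then its x_s agree with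
-- those of the given point in one base-p digit after the other, and the points are
-- equal.  Each constraint costs only a factor p, and the digits x_s only a factor
-- M^O(1/K), so that there are M^(d − O(1/K)) points in dimension d = exp(O(K)).
-- The power gained beats the constants and the o(1) when p → ∞.

module Submission where

open import Data.Bool.Base using (Bool; true; false)
open import Data.Fin.Base using (Fin; zero; suc; toℕ; fromℕ<; punchOut; combine; remQuot; finToFun; funToFin)
import Data.Fin.Properties as Fin
open import Data.Integer.Base as ℤ using (ℤ; +_; -[1+_]; 0ℤ; 1ℤ)
open import Data.Integer.DivMod using (_%ℕ_; _/ℕ_; a≡a%ℕn+[a/ℕn]*n; n%ℕd<d)
import Data.Integer.Properties as ℤ
open import Data.Integer.Tactic.RingSolver using (solve-∀)
open import Data.List.Base using ([]; _∷_)
open import Data.List.Relation.Unary.All using (_∷_)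
open import Data.Nat.Base as ℕ using (ℕ; zero; suc; NonZero; _!)
open import Data.Nat.Coprimality using (Coprime; coprime-Bézout)
import Data.Nat.Divisibility as ℕ
open import Data.Nat.DivMod using (_mod_; _/_; _%_; m%n<n; m<n⇒m%n≡m; m<n*o⇒m/o<n; m≡m%n+[m/n]*n; [m+kn]%n≡m%n; %-distribˡ-*)
open import Data.Nat.GCD using (module Bézout)
open import Data.Nat.ListAction using (product)
open import Data.Nat.Primality using (Prime; prime⇒nonZero; prime⇒nonTrivial; prime⇒irreducible; euclidsLemma)
open import Data.Nat.Primality.Factorisation using (factorise)
import Data.Nat.Properties as ℕ
import Data.Nat.Tactic.RingSolver as ℕ
open import Data.Product.Base using (Σ-syntax; ∃-syntax; _×_; _,_; proj₁; proj₂)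
open import Data.Product.Function.NonDependent.Propositional using (_×-↔_)
open import Data.Rational.Base as ℚ using (ℚ; 0ℚ; 1ℚ; ½)
import Data.Rational.Properties as ℚ
open import Data.Rational.Solver using (module +-*-Solver)
open import Data.Rational.Unnormalised.Base using (mkℚᵘ; *≤*; *≡*; _≃_)
import Data.Rational.Unnormalised.Properties as ℚᵘ
open import Data.Sum.Base using (_⊎_; inj₁; inj₂; [_,_]′)
open import Data.Sum.Function.Propositional using (_⊎-↔_)
open import Data.Unit.Base using (⊤; tt)
open import Data.Vec.Functional using (zipWith)
open import Defs using (module Estimates; module CauchyProofs; ℕ→ℚ)
open import Function.Base using (_∘_; it)
open import Function.Bundles using (_↔_; Inverse)
open import Function.Properties.Inverse using (↔-refl; ↔-sym; ↔-trans)
open import Relation.Binary.PropositionalEquality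
open import Relation.Nullary using (¬_; yes; no; contradiction)
open CauchyProofs using
  (ℕ→ℚ-mono; ℕ→ℚ-suc; 0<ℕ→ℚ-suc; archimedean; 1/suc-inverse; 0<1/suc; 0≤t; inv-inverse; inv-nonNeg; ⊔≤ˡ; ⊔≤ʳ)
open Estimates
open +-*-Solver using (solve; _:+_; _:*_; :-_; _:-_; _:=_; con)

-- Anisotropic binary forms modulo large primes

-- One congruence modulo p costs a factor p in the number of points, and an anisotropic form in K
-- variables makes it force K digits to agree at once. With K = 1 the constraints alone would cost a
-- fixed power of M.
--
-- A line has a single parameter, so the K variables must share one coordinate. A slope with
-- denominator p^j b^(e+1) reads the digit at position e alone. The digits above contribute
-- multiples of p, because p^(j+1) divides b; those below contribute less than 1/2, because each
-- digit uses less than a fraction 1/(2p) of its range; rounding to integers removes the rest. Hence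
-- b has two factors p to spare, and each polynomial is split into one summand for every variable s,
-- whose coefficients have slopes tuned to the digit of s. One more factor b in the shared
-- coordinate keeps all slopes at most 1.
--
-- The digits fill p^(K²) of the M = p^((K+1)(K+2)) values of their coordinate and the constraints
-- cost p^K. The total loss p^(4K+2) is less than M^(4/K), so K γ ≥ 5 leaves room for the o(1), and
-- K of order 1/γ is enough.

module _ where
  open import Data.Integer.Base using (_+_; _*_; _-_; -_)
  open import Data.Integer.Divisibility.Signed

  Anisotropic : ℕ → ℤ → Set
  Anisotropic p g = ∀ a b → + p ∣ a * a - g * (b * b) → + p ∣ a × + p ∣ b

  noMissedPoint : ∀ {n} (f : Fin n → Fin n) (k : Fin n) →
                  (∀ {i j} → f i ≡ f j → i ≡ j) → ¬ (∀ i → k ≢ f i)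
  noMissedPoint {suc n} f k inj missed = Fin.<⇒notInjective
    {f = λ i → punchOut (missed i)} (ℕ.n<1+n n) (λ {i} {j} eq → inj (Fin.punchOut-injective (missed i) (missed j) eq))

  -- If `f` were onto, it would have an injective section. This picks only one preimage of the
  -- common value of `i` and `j`, so it omits one of them, against the pigeonhole principle.
  missedValue : ∀ {n} (f : Fin n → Fin n) {i j} → i ≢ j → f i ≡ f j → ∃[ k ] (∀ i → f i ≢ k)
  missedValue {n} f {i} {j} i≢j fi≡fj with Fin.all? (λ k → Fin.any? (λ i → f i Fin.≟ k))
  ... | no ¬onto =
    let k , missed = Fin.¬∀⟶∃¬ n _ (λ k → Fin.any? (λ i → f i Fin.≟ k)) ¬onto
    in k , λ l eq → missed (l , eq)
  ... | yes onto = contradiction missed (noMissedPoint section k section-injective)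
    where
    section : Fin n → Fin n
    section k = proj₁ (onto k)

    section-injective : ∀ {k l} → section k ≡ section l → k ≡ l
    section-injective {k} {l} eq = trans (sym (proj₂ (onto k))) (trans (cong f eq) (proj₂ (onto l)))

    section-value : ∀ {k l} → l ≡ section k → section k ≡ section (f l)
    section-value {k} refl = cong section (sym (proj₂ (onto k)))

    k : Fin n
    k with section (f i) Fin.≟ i
    ... | yes _ = j
    ... | no  _ = i

    missed : ∀ l → k ≢ section l
    missed l eq with section (f i) Fin.≟ i
    ... | yes si = i≢j (trans (sym si) (trans (cong section fi≡fj) (sym (trans eq (section-value eq)))))
    ... | no ¬si = ¬si (sym (trans eq (section-value eq)))

  ∣-⇒%≡ : ∀ {p} .{{_ : NonZero p}} m n → + p ∣ + m - + n → m % p ≡ n % p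
  ∣-⇒%≡ {p} m n (divides (+ q) eq) = trans (cong (_% p) (ℤ.+-injective m≡)) ([m+kn]%n≡m%n n q p)
    where
    m≡ : + m ≡ + (n ℕ.+ q ℕ.* p)
    m≡ = begin
      + m                    ≡⟨ lemma (+ m) (+ n) ⟩
      + n + (+ m - + n)      ≡⟨ cong (_+_ (+ n)) (trans eq (sym (ℤ.pos-* q p))) ⟩
      + (n ℕ.+ q ℕ.* p)      ∎
      where
      open ≡-Reasoning
      lemma : ∀ a b → a ≡ b + (a - b)
      lemma = solve-∀
  ∣-⇒%≡ {p} m n (divides -[1+ q ] eq) = sym (trans (cong (_% p) (ℤ.+-injective n≡)) ([m+kn]%n≡m%n m (suc q) p))
    where
    n≡ : + n ≡ + (m ℕ.+ suc q ℕ.* p)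
    n≡ = begin
      + n                            ≡⟨ lemma (+ m) (+ n) ⟩
      + m - (+ m - + n)              ≡⟨ cong (λ z → + m - z) eq ⟩
      + m - - (+ suc q) * + p        ≡⟨ lemma₂ (+ m) (+ suc q) (+ p) ⟩
      + m + + suc q * + p            ≡⟨ cong (_+_ (+ m)) (sym (ℤ.pos-* (suc q) p)) ⟩
      + (m ℕ.+ suc q ℕ.* p)          ∎
      where
      open ≡-Reasoning
      lemma : ∀ a b → b ≡ a - (a - b)
      lemma = solve-∀
      lemma₂ : ∀ a b c → a - - b * c ≡ a + b * c
      lemma₂ = solve-∀

  -- Squaring identifies 1 and -1, which are distinct for a modulus of at least 3, so it misses some
  -- residue.
  nonResidue : ∀ k → let p = 3 ℕ.+ k in
               ∃[ g ] (g ℕ.< p × ∀ r → (r ℕ.* r) % p ≢ g)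
  nonResidue k =
    let g , missed = missedValue square {fromℕ< 1<p} {fromℕ< 2+k<p} 1≢-1 1²≡[-1]²
    in toℕ g , Fin.toℕ<n g , λ r eq → missed (r mod p) (Fin.toℕ-injective (begin
      toℕ (square (r mod p))                           ≡⟨ toℕ-square (r mod p) ⟩
      (toℕ (r mod p) ℕ.* toℕ (r mod p)) % p            ≡⟨ cong (λ s → (s ℕ.* s) % p) (toℕ-mod r) ⟩
      (r % p ℕ.* (r % p)) % p                          ≡⟨ sym (%-distribˡ-* r r p) ⟩
      (r ℕ.* r) % p                                    ≡⟨ eq ⟩
      toℕ g                                            ∎))
    where
    open ≡-Reasoning
    p = 3 ℕ.+ k

    toℕ-mod : ∀ m → toℕ (m mod p) ≡ m % p
    toℕ-mod m = Fin.toℕ-fromℕ< (m%n<n m p)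

    square : Fin p → Fin p
    square i = (toℕ i ℕ.* toℕ i) mod p

    toℕ-square : ∀ i → toℕ (square i) ≡ (toℕ i ℕ.* toℕ i) % p
    toℕ-square i = toℕ-mod (toℕ i ℕ.* toℕ i)

    1<p : 1 ℕ.< p
    1<p = ℕ.s≤s (ℕ.s≤s ℕ.z≤n)

    2+k<p : 2 ℕ.+ k ℕ.< p
    2+k<p = ℕ.n<1+n _

    1≢-1 : fromℕ< 1<p ≢ fromℕ< 2+k<p
    1≢-1 eq with () ← trans (sym (Fin.toℕ-fromℕ< 1<p)) (trans (cong toℕ eq) (Fin.toℕ-fromℕ< 2+k<p))

    1²≡[-1]² : square (fromℕ< 1<p) ≡ square (fromℕ< 2+k<p)
    1²≡[-1]² = Fin.toℕ-injective (begin
      toℕ (square (fromℕ< 1<p))                ≡⟨ toℕ-square (fromℕ< 1<p) ⟩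
      (toℕ (fromℕ< 1<p) ℕ.* toℕ (fromℕ< 1<p)) % p  ≡⟨ cong (λ s → (s ℕ.* s) % p) (Fin.toℕ-fromℕ< 1<p) ⟩
      1 % p                                    ≡⟨ sym ([m+kn]%n≡m%n 1 (suc k) p) ⟩
      (1 ℕ.+ suc k ℕ.* p) % p                  ≡⟨ cong (_% p) (lemma k) ⟩
      ((2 ℕ.+ k) ℕ.* (2 ℕ.+ k)) % p            ≡⟨ cong (λ s → (s ℕ.* s) % p) (sym (Fin.toℕ-fromℕ< 2+k<p)) ⟩
      (toℕ (fromℕ< 2+k<p) ℕ.* toℕ (fromℕ< 2+k<p)) % p ≡⟨ sym (toℕ-square (fromℕ< 2+k<p)) ⟩
      toℕ (square (fromℕ< 2+k<p))              ∎)
      where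
      lemma : ∀ k → 1 ℕ.+ suc k ℕ.* (3 ℕ.+ k) ≡ (2 ℕ.+ k) ℕ.* (2 ℕ.+ k)
      lemma = ℕ.solve-∀

  module _ {p} (pr : Prime p) where
    private instance
      _ = prime⇒nonZero pr
      _ = prime⇒nonTrivial pr

    prime-∣* : ∀ a b → + p ∣ a * b → + p ∣ a ⊎ + p ∣ b
    prime-∣* a b p∣ab with euclidsLemma ℤ.∣ a ∣ ℤ.∣ b ∣ pr (subst (p ℕ.∣_) (ℤ.∣i*j∣≡∣i∣*∣j∣ a b) (∣⇒∣ᵤ p∣ab))
    ... | inj₁ p∣a = inj₁ (∣ᵤ⇒∣ p∣a)
    ... | inj₂ p∣b = inj₂ (∣ᵤ⇒∣ p∣b)

    invertible : ∀ b → ¬ (+ p ∣ b) → ∃[ c ] + p ∣ c * b - 1ℤ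
    invertible b p∤b = to-ℤ (coprime-Bézout coprime)
      where
      coprime : Coprime p ℤ.∣ b ∣
      coprime (d∣p , d∣b) with prime⇒irreducible pr d∣p
      ... | inj₁ d≡1 = d≡1
      ... | inj₂ refl = contradiction (∣ᵤ⇒∣ d∣b) p∤b

      natural : ∀ c → + p ∣ c * + ℤ.∣ b ∣ - 1ℤ → ∃[ c ] + p ∣ c * b - 1ℤ
      natural c h with ℤ.+∣i∣≡i⊎+∣i∣≡-i b
      ... | inj₁ eq = c , subst (λ z → + p ∣ c * z - 1ℤ) eq h
      ... | inj₂ eq = - c , subst (+ p ∣_) (trans (cong (λ z → c * z - 1ℤ) eq) (lemma c b)) h
        where
        lemma : ∀ c b → c * - b - 1ℤ ≡ - c * b - 1ℤ
        lemma = solve-∀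

      to-ℤ : Bézout.Identity 1 p ℤ.∣ b ∣ → ∃[ c ] + p ∣ c * b - 1ℤ
      to-ℤ (Bézout.+- x y eq) = natural (- (+ y)) (divides (- (+ x)) (begin
        - (+ y) * B - 1ℤ       ≡⟨ lemma (+ y) B ⟩
        - (1ℤ + + y * B)       ≡⟨ cong (λ z → - (1ℤ + z)) (sym (ℤ.pos-* y ℤ.∣ b ∣)) ⟩
        - (+ (1 ℕ.+ y ℕ.* ℤ.∣ b ∣)) ≡⟨ cong (λ z → - (+ z)) eq ⟩
        - (+ (x ℕ.* p))        ≡⟨ cong -_ (ℤ.pos-* x p) ⟩
        - (+ x * + p)          ≡⟨ ℤ.neg-distribˡ-* (+ x) (+ p) ⟩
        - (+ x) * + p          ∎))
        where
        open ≡-Reasoning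
        B = + ℤ.∣ b ∣
        lemma : ∀ y B → - y * B - 1ℤ ≡ - (1ℤ + y * B)
        lemma = solve-∀
      to-ℤ (Bézout.-+ x y eq) = natural (+ y) (divides (+ x) (begin
        + y * B - 1ℤ                    ≡⟨ cong (_- 1ℤ) (sym (ℤ.pos-* y ℤ.∣ b ∣)) ⟩
        + (y ℕ.* ℤ.∣ b ∣) - 1ℤ            ≡⟨ cong (λ z → + z - 1ℤ) (sym eq) ⟩
        + (1 ℕ.+ x ℕ.* p) - 1ℤ          ≡⟨ cong (λ z → 1ℤ + z - 1ℤ) (ℤ.pos-* x p) ⟩
        1ℤ + + x * + p - 1ℤ             ≡⟨ lemma (+ x * + p) ⟩
        + x * + p                       ∎))
        where
        open ≡-Reasoning
        B = + ℤ.∣ b ∣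
        lemma : ∀ z → 1ℤ + z - 1ℤ ≡ z
        lemma = solve-∀

    anisotropic : ∀ {g} → g ℕ.< p → (∀ r → (r ℕ.* r) % p ≢ g) →
                  Anisotropic p (+ g)
    anisotropic {g} g<p nonresidue a b h with + p ∣? b
    ... | yes p∣b with prime-∣* a a (subst (+ p ∣_) (lemma (a * a) (+ g * (b * b))) (∣m∣n⇒∣m+n h (∣n⇒∣m*n (+ g) (∣m⇒∣m*n b p∣b))))
        where
        lemma : ∀ a b → a - b + b ≡ a
        lemma = solve-∀
    ...   | inj₁ p∣a = p∣a , p∣b
    ...   | inj₂ p∣a = p∣a , p∣b
    anisotropic {g} g<p nonresidue a b h | no p∤b =
      let c , p∣cb-1 = invertible b p∤b
          r = (a * c) %ℕ p
          q = (a * c) /ℕ p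
          r≡ : + r ≡ a * c - q * + p
          r≡ = trans (lemma (+ r) (q * + p)) (cong (_- q * + p) (sym (a≡a%ℕn+[a/ℕn]*n (a * c) p)))
          -- Modulo p, c is 1/b, so r = a/b would be a square root of g. The three summands are
          -- multiples of a² - g b², of c b - 1 and of p; the last accounts for the reduction of a c
          -- to r.
          r²-g≡ : c * c * (a * a - + g * (b * b)) + + g * (c * b + 1ℤ) * (c * b - 1ℤ) + q * (q * + p - a * c - a * c) * + p ≡ + (r ℕ.* r) - + g
          r²-g≡ = trans (expand a b c (+ g) q (+ p))
            (trans (cong (λ z → z * z - + g) (sym r≡)) (cong (_- + g) (sym (ℤ.pos-* r r))))
          p∣r²-g : + p ∣ + (r ℕ.* r) - + g
          p∣r²-g = subst (+ p ∣_) r²-g≡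
            (∣m∣n⇒∣m+n (∣m∣n⇒∣m+n (∣n⇒∣m*n (c * c) h) (∣n⇒∣m*n (+ g * (c * b + 1ℤ)) p∣cb-1))
                       (∣n⇒∣m*n (q * (q * + p - a * c - a * c)) ∣-refl))
      in contradiction (trans (∣-⇒%≡ (r ℕ.* r) g p∣r²-g) (m<n⇒m%n≡m g<p)) (nonresidue r)
      where
      lemma : ∀ r s → r ≡ r + s - s
      lemma = solve-∀
      expand : ∀ a b c g q p → c * c * (a * a - g * (b * b)) + g * (c * b + 1ℤ) * (c * b - 1ℤ) + q * (q * p - a * c - a * c) * p ≡ (a * c - q * p) * (a * c - q * p) - g
      expand = solve-∀

  ∣! : ∀ {m} n → 1 ℕ.≤ m → m ℕ.≤ n → m ℕ.∣ n !
  ∣! zero 1≤m m≤0 = contradiction (ℕ.≤-trans 1≤m m≤0) λ ()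
  ∣! (suc n) 1≤m m≤1+n with ℕ.m≤n⇒m<n∨m≡n m≤1+n
  ... | inj₁ m<1+n = ℕ.∣n⇒∣m*n (suc n) (∣! n 1≤m (ℕ.s≤s⁻¹ m<1+n))
  ... | inj₂ refl  = ℕ.m∣m*n (n !)

  -- Euclid: a prime factor of n! + 1 cannot be at most n.
  prime-above : ∀ n → ∃[ p ] (n ℕ.< p × Prime p)
  prime-above n with factorise (suc (n !))
  ... | record { factors = [] ; isFactorisation = eq } =
    contradiction (ℕ.suc-injective eq) (ℕ.≢-nonZero⁻¹ (n !) {{n ℕ.!≢0}})
  ... | record { factors = p ∷ ps ; isFactorisation = eq ; factorsPrime = pr ∷ _ } = p , n<p , pr
    where
    instance
      _ = prime⇒nonZero pr
      _ = prime⇒nonTrivial pr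

    p∣1+n! : p ℕ.∣ suc (n !)
    p∣1+n! = subst (p ℕ.∣_) (sym eq) (ℕ.m∣m*n (product ps))

    n<p : n ℕ.< p
    n<p with n ℕ.<? p
    ... | yes n<p = n<p
    ... | no  n≮p = contradiction (ℕ.∣1⇒≡1 (ℕ.∣m+n∣m⇒∣n (subst (p ℕ.∣_) (ℕ.+-comm 1 (n !)) p∣1+n!) (∣! n (ℕ.>-nonZero⁻¹ p) (ℕ.≮⇒≥ n≮p))))
                      (ℕ.nonTrivial⇒≢1 {p})

  anisotropic-prime : ∀ n → ∃[ p ] (n ℕ.< p × ∃[ g ] Anisotropic p g)
  anisotropic-prime n with prime-above (2 ℕ.+ n)
  ... | suc (suc (suc k)) , ℕ.s≤s (ℕ.s≤s (ℕ.s≤s n≤k)) , pr =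
    let g , g<p , nonresidue = nonResidue k
    in 3 ℕ.+ k , ℕ.s≤s (ℕ.m≤n⇒m≤1+n (ℕ.m≤n⇒m≤1+n n≤k)) , + g , anisotropic pr g<p nonresidue

-- Polynomials in 2ᵃ variables

module _ where
  open import Data.Integer.Base using (_+_; _*_; _-_; -_)
  open import Data.Integer.Divisibility.Signed
  open ≡-Reasoning

  Var : ℕ → Set
  Var zero    = ⊤
  Var (suc a) = Var a ⊎ Var a

  -- The recursion follows that of `form`, which squares and adds over disjoint halves, so no
  -- products mixing the halves occur. These are formal products: the same polynomial may have
  -- several coefficient vectors, and the constraints depend only on its values.
  Monomial : ℕ → Set
  Monomial zero    = Bool
  Monomial (suc a) = (Monomial a × Monomial a) ⊎ (Monomial a × Monomial a)

  ∑ : ∀ a → (Var a → ℤ) → ℤ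
  ∑ zero    f = f tt
  ∑ (suc a) f = ∑ a (f ∘ inj₁) + ∑ a (f ∘ inj₂)

  ∑-cong : ∀ a {f g} → (∀ s → f s ≡ g s) → ∑ a f ≡ ∑ a g
  ∑-cong zero    eq = eq tt
  ∑-cong (suc a) eq = cong₂ _+_ (∑-cong a (eq ∘ inj₁)) (∑-cong a (eq ∘ inj₂))

  ∑-+ : ∀ a f g → ∑ a (λ s → f s + g s) ≡ ∑ a f + ∑ a g
  ∑-+ zero    f g = refl
  ∑-+ (suc a) f g = trans (cong₂ _+_ (∑-+ a (f ∘ inj₁) (g ∘ inj₁)) (∑-+ a (f ∘ inj₂) (g ∘ inj₂)))
    (lemma (∑ a (f ∘ inj₁)) (∑ a (g ∘ inj₁)) (∑ a (f ∘ inj₂)) (∑ a (g ∘ inj₂)))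
    where
    lemma : ∀ a b c d → a + b + (c + d) ≡ a + c + (b + d)
    lemma = solve-∀

  ∑-* : ∀ a k f → ∑ a (λ s → k * f s) ≡ k * ∑ a f
  ∑-* zero    k f = refl
  ∑-* (suc a) k f = trans (cong₂ _+_ (∑-* a k (f ∘ inj₁)) (∑-* a k (f ∘ inj₂)))
    (sym (ℤ.*-distribˡ-+ k (∑ a (f ∘ inj₁)) (∑ a (f ∘ inj₂))))

  -- Monomials of level a + 1 are products of two monomials of level a, both in
  -- the left half or both in the right half of the variables.
  eval  : ∀ a → (Monomial a → ℤ) → (Var a → ℤ) → ℤ
  eval₂ : ∀ a → (Monomial a × Monomial a → ℤ) → (Var a → ℤ) → ℤ
  eval zero    c x = c false + c true * x tt
  eval (suc a) c x = eval₂ a (c ∘ inj₁) (x ∘ inj₁) + eval₂ a (c ∘ inj₂) (x ∘ inj₂)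
  eval₂ a c x = eval a (λ i → eval a (λ j → c (i , j)) x) x

  eval-cong  : ∀ a {c c′} x → (∀ i → c i ≡ c′ i) → eval a c x ≡ eval a c′ x
  eval₂-cong : ∀ a {c c′} x → (∀ i → c i ≡ c′ i) → eval₂ a c x ≡ eval₂ a c′ x
  eval-cong zero    x eq = cong₂ (λ u v → u + v * x tt) (eq false) (eq true)
  eval-cong (suc a) x eq = cong₂ _+_ (eval₂-cong a (x ∘ inj₁) (eq ∘ inj₁)) (eval₂-cong a (x ∘ inj₂) (eq ∘ inj₂))
  eval₂-cong a x eq = eval-cong a x λ i → eval-cong a x λ j → eq (i , j)

  eval-+  : ∀ a c c′ x → eval a (λ i → c i + c′ i) x ≡ eval a c x + eval a c′ x
  eval₂-+ : ∀ a c c′ x → eval₂ a (λ i → c i + c′ i) x ≡ eval₂ a c x + eval₂ a c′ x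
  eval-+ zero c c′ x = lemma (c false) (c′ false) (c true) (c′ true) (x tt)
    where
    lemma : ∀ a b c d x → a + b + (c + d) * x ≡ a + c * x + (b + d * x)
    lemma = solve-∀
  eval-+ (suc a) c c′ x = trans
    (cong₂ _+_ (eval₂-+ a (c ∘ inj₁) (c′ ∘ inj₁) (x ∘ inj₁)) (eval₂-+ a (c ∘ inj₂) (c′ ∘ inj₂) (x ∘ inj₂)))
    (lemma (eval₂ a (c ∘ inj₁) (x ∘ inj₁)) (eval₂ a (c′ ∘ inj₁) (x ∘ inj₁))
           (eval₂ a (c ∘ inj₂) (x ∘ inj₂)) (eval₂ a (c′ ∘ inj₂) (x ∘ inj₂)))
    where
    lemma : ∀ a b c d → a + b + (c + d) ≡ a + c + (b + d)
    lemma = solve-∀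
  eval₂-+ a c c′ x = trans
    (eval-cong a x λ i → eval-+ a (λ j → c (i , j)) (λ j → c′ (i , j)) x)
    (eval-+ a _ _ x)

  eval-*  : ∀ a k c x → eval a (λ i → k * c i) x ≡ k * eval a c x
  eval₂-* : ∀ a k c x → eval₂ a (λ i → k * c i) x ≡ k * eval₂ a c x
  eval-* zero k c x = lemma k (c false) (c true) (x tt)
    where
    lemma : ∀ k a b x → k * a + k * b * x ≡ k * (a + b * x)
    lemma = solve-∀
  eval-* (suc a) k c x = trans
    (cong₂ _+_ (eval₂-* a k (c ∘ inj₁) (x ∘ inj₁)) (eval₂-* a k (c ∘ inj₂) (x ∘ inj₂)))
    (sym (ℤ.*-distribˡ-+ k (eval₂ a (c ∘ inj₁) (x ∘ inj₁)) (eval₂ a (c ∘ inj₂) (x ∘ inj₂))))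
  eval₂-* a k c x = trans
    (eval-cong a x λ i → eval-* a k (λ j → c (i , j)) x)
    (eval-* a k _ x)

  eval-∑ : ∀ a b (c : Var b → Monomial a → ℤ) x →
           eval a (λ i → ∑ b (λ s → c s i)) x ≡ ∑ b (λ s → eval a (c s) x)
  eval-∑ a zero    c x = refl
  eval-∑ a (suc b) c x = trans
    (eval-+ a (λ i → ∑ b (λ s → c (inj₁ s) i)) (λ i → ∑ b (λ s → c (inj₂ s) i)) x)
    (cong₂ _+_ (eval-∑ a b (c ∘ inj₁) x) (eval-∑ a b (c ∘ inj₂) x))

  eval₂-⊗ : ∀ a c d x → eval₂ a (λ (i , j) → c i * d j) x ≡ eval a c x * eval a d x
  eval₂-⊗ a c d x = begin
    eval a (λ i → eval a (λ j → c i * d j) x) x  ≡⟨ eval-cong a x (λ i → trans (eval-* a (c i) d x) (ℤ.*-comm (c i) (eval a d x))) ⟩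
    eval a (λ i → eval a d x * c i) x            ≡⟨ eval-* a (eval a d x) c x ⟩
    eval a d x * eval a c x                      ≡⟨ ℤ.*-comm (eval a d x) (eval a c x) ⟩
    eval a c x * eval a d x                      ∎

  eval₂-zero : ∀ a x → eval₂ a (λ _ → 0ℤ) x ≡ 0ℤ
  eval₂-zero a x = eval₂-* a 0ℤ (λ _ → 0ℤ) x

  -- Serves in `hadamard₂` to pad a polynomial of level a to a sum of products of two.
  one : ∀ a → Monomial a → ℤ
  one zero    false = 1ℤ
  one zero    true  = 0ℤ
  one (suc a) (inj₁ (i , j)) = one a i * one a j
  one (suc a) (inj₂ _)       = 0ℤ

  eval-one : ∀ a x → eval a (one a) x ≡ 1ℤ
  eval-one zero    x = refl
  eval-one (suc a) x = cong₂ _+_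
    (trans (eval₂-⊗ a (one a) (one a) (x ∘ inj₁)) (cong₂ _*_ (eval-one a (x ∘ inj₁)) (eval-one a (x ∘ inj₁))))
    (eval₂-zero a (x ∘ inj₂))

  Divided : ∀ a → ((Var a → ℤ) → ℤ) → ((Var a → ℤ) → Var a → ℤ) → (Var a → ℤ) → Set
  Divided a f q w = ∀ w′ → f w′ ≡ f w + ∑ a (λ s → (w′ s - w s) * q w′ s)

  -- The coefficients of the quotients depend on w only, although the quotients are evaluated at w′:
  -- slopes have to be fixed before the other point is known. The quotients use the same monomials,
  -- so every coefficient of theirs can be the slope of an existing coordinate.
  hadamard  : ∀ a (c : Monomial a → ℤ) (w : Var a → ℤ) →
              Σ[ l ∈ (Var a → Monomial a → ℤ) ] Divided a (eval a c) (λ w′ s → eval a (l s) w′) w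
  hadamard₂ : ∀ a (c : Monomial a × Monomial a → ℤ) (w : Var a → ℤ) →
              Σ[ l ∈ (Var a → Monomial a × Monomial a → ℤ) ] Divided a (eval₂ a c) (λ w′ s → eval₂ a (l s) w′) w
  hadamard zero c w = (λ _ → λ { false → c true ; true → 0ℤ }) , λ w′ → lemma (c false) (c true) (w tt) (w′ tt)
    where
    lemma : ∀ a b w w′ → a + b * w′ ≡ a + b * w + (w′ - w) * (b + 0ℤ * w′)
    lemma = solve-∀
  hadamard (suc a) c w =
    let l₁ , h₁ = hadamard₂ a (c ∘ inj₁) (w ∘ inj₁)
        l₂ , h₂ = hadamard₂ a (c ∘ inj₂) (w ∘ inj₂)
    in
    (λ { (inj₁ s) (inj₁ i) → l₁ s i ; (inj₁ s) (inj₂ _) → 0ℤ ; (inj₂ s) (inj₁ _) → 0ℤ ; (inj₂ s) (inj₂ i) → l₂ s i }) ,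
    λ w′ → trans (cong₂ _+_ (h₁ (w′ ∘ inj₁)) (h₂ (w′ ∘ inj₂)))
      (trans (lemma (eval₂ a (c ∘ inj₁) (w ∘ inj₁)) _ (eval₂ a (c ∘ inj₂) (w ∘ inj₂)) _)
        (cong (_+_ (eval (suc a) c w)) (cong₂ _+_
          (∑-cong a λ s → cong ((w′ (inj₁ s) - w (inj₁ s)) *_)
            (trans (sym (ℤ.+-identityʳ _)) (cong (_+_ (eval₂ a (l₁ s) (w′ ∘ inj₁))) (sym (eval₂-zero a (w′ ∘ inj₂))))))
          (∑-cong a λ s → cong ((w′ (inj₂ s) - w (inj₂ s)) *_)
            (trans (sym (ℤ.+-identityˡ _)) (cong (_+ eval₂ a (l₂ s) (w′ ∘ inj₂)) (sym (eval₂-zero a (w′ ∘ inj₁)))))))))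
    where
    lemma : ∀ a b c d → a + b + (c + d) ≡ a + c + (b + d)
    lemma = solve-∀
  hadamard₂ a c w = l , proof
    where
    -- Write P(u, v) for the sum of c (i , j) with the first factor taken at u and the second at v.
    -- Then `A` divides P(w′, w′) - P(w′, w), and `B` divides P(w′, w) - P(w, w).
    R : Monomial a → ℤ
    R i = eval a (λ j → c (i , j)) w

    A : Monomial a → Var a → Monomial a → ℤ
    A i = proj₁ (hadamard a (λ j → c (i , j)) w)

    B : Var a → Monomial a → ℤ
    B = proj₁ (hadamard a R w)

    l : Var a → Monomial a × Monomial a → ℤ
    l s (i , j) = A i s j + B s i * one a j

    eval-l : ∀ w′ s → eval₂ a (l s) w′ ≡ eval a (λ i → eval a (A i s) w′) w′ + eval a (B s) w′
    eval-l w′ s = begin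
      eval₂ a (l s) w′
        ≡⟨ eval₂-+ a (λ (i , j) → A i s j) (λ (i , j) → B s i * one a j) w′ ⟩
      eval a (λ i → eval a (A i s) w′) w′ + eval₂ a (λ (i , j) → B s i * one a j) w′
        ≡⟨ cong (_+_ (eval a (λ i → eval a (A i s) w′) w′)) (eval₂-⊗ a (B s) (one a) w′) ⟩
      eval a (λ i → eval a (A i s) w′) w′ + eval a (B s) w′ * eval a (one a) w′
        ≡⟨ cong (λ z → eval a (λ i → eval a (A i s) w′) w′ + z) (trans (cong (eval a (B s) w′ *_) (eval-one a w′)) (ℤ.*-identityʳ _)) ⟩
      eval a (λ i → eval a (A i s) w′) w′ + eval a (B s) w′ ∎

    proof : Divided a (eval₂ a c) (λ w′ s → eval₂ a (l s) w′) w
    proof w′ = begin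
      eval a (λ i → eval a (λ j → c (i , j)) w′) w′
        ≡⟨ eval-cong a w′ (λ i → proj₂ (hadamard a (λ j → c (i , j)) w) w′) ⟩
      eval a (λ i → R i + ∑ a (λ s → δ s * eval a (A i s) w′)) w′
        ≡⟨ eval-+ a R _ w′ ⟩
      eval a R w′ + eval a (λ i → ∑ a (λ s → δ s * eval a (A i s) w′)) w′
        ≡⟨ cong₂ _+_ (proj₂ (hadamard a R w) w′)
             (trans (eval-∑ a a (λ s i → δ s * eval a (A i s) w′) w′) (∑-cong a λ s → eval-* a (δ s) (λ i → eval a (A i s) w′) w′)) ⟩
      eval a R w + ∑ a (λ s → δ s * eval a (B s) w′) + ∑ a (λ s → δ s * eval a (λ i → eval a (A i s) w′) w′)
        ≡⟨ trans (ℤ.+-assoc (eval a R w) _ _) (cong (_+_ (eval a R w)) (trans (sym (∑-+ a _ _)) (∑-cong a λ s →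
             trans (lemma (δ s) _ _) (cong (δ s *_) (sym (eval-l w′ s)))))) ⟩
      eval a R w + ∑ a (λ s → δ s * eval₂ a (l s) w′) ∎
      where
      δ : Var a → ℤ
      δ s = w′ s - w s
      lemma : ∀ d a b → d * a + d * b ≡ d * (b + a)
      lemma = solve-∀

  -- For non-square g, an anisotropic form of degree 2ᵃ in 2ᵃ variables.
  form : ∀ a → ℤ → (Var a → ℤ) → ℤ
  form zero    g u = u tt
  form (suc a) g u = form a g (u ∘ inj₁) * form a g (u ∘ inj₁) - g * (form a g (u ∘ inj₂) * form a g (u ∘ inj₂))

  form-zero : ∀ a g (w : Var a → ℤ) → form a g (λ s → w s - w s) ≡ 0ℤ
  form-zero zero    g w = ℤ.+-inverseʳ (w tt)
  form-zero (suc a) g w = trans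
    (cong₂ (λ u v → u * u - g * (v * v)) (form-zero a g (w ∘ inj₁)) (form-zero a g (w ∘ inj₂)))
    (lemma g)
    where
    lemma : ∀ g → 0ℤ * 0ℤ - g * (0ℤ * 0ℤ) ≡ 0ℤ
    lemma = solve-∀

  form-anisotropic : ∀ {p g} → Anisotropic p g → ∀ a u → + p ∣ form a g u → ∀ s → + p ∣ u s
  form-anisotropic h zero    u p∣u s = p∣u
  form-anisotropic h (suc a) u p∣f s with h (form a _ (u ∘ inj₁)) (form a _ (u ∘ inj₂)) p∣f | s
  ... | p∣f₁ , p∣f₂ | inj₁ s = form-anisotropic h a (u ∘ inj₁) p∣f₁ s
  ... | p∣f₁ , p∣f₂ | inj₂ s = form-anisotropic h a (u ∘ inj₂) p∣f₂ s

  shiftedForm : ∀ a g (w : Var a → ℤ) → Σ[ c ∈ (Monomial a → ℤ) ] ∀ w′ → eval a c w′ ≡ form a g (λ s → w′ s - w s)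
  shiftedForm zero g w = (λ { false → - w tt ; true → 1ℤ }) , λ w′ → lemma (w tt) (w′ tt)
    where
    lemma : ∀ w w′ → - w + 1ℤ * w′ ≡ w′ - w
    lemma = solve-∀
  shiftedForm (suc a) g w =
    let c₁ , h₁ = shiftedForm a g (w ∘ inj₁)
        c₂ , h₂ = shiftedForm a g (w ∘ inj₂)
    in
    (λ { (inj₁ (i , j)) → c₁ i * c₁ j ; (inj₂ (i , j)) → - g * (c₂ i * c₂ j) }) ,
    λ w′ → cong₂ _+_
      (trans (eval₂-⊗ a c₁ c₁ (w′ ∘ inj₁)) (cong₂ _*_ (h₁ (w′ ∘ inj₁)) (h₁ (w′ ∘ inj₁))))
      (trans (eval₂-* a (- g) (λ (i , j) → c₂ i * c₂ j) (w′ ∘ inj₂))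
        (trans (cong (- g *_) (trans (eval₂-⊗ a c₂ c₂ (w′ ∘ inj₂)) (cong₂ _*_ (h₂ (w′ ∘ inj₂)) (h₂ (w′ ∘ inj₂)))))
          (sym (ℤ.neg-distribˡ-* g _))))

  -- Up to its constant term, the value at w′ of the polynomial with coefficients
  -- y + (w′ − w) l is made to be − form (w′ − w), by Hadamard's lemma.
  escape : ∀ a g (y : Var a → Monomial a → ℤ) w → Σ[ l ∈ (Var a → Monomial a → ℤ) ] ∀ p c (w′ : Var a → ℤ) (y′ z : Var a → Monomial a → ℤ) →
           (∀ s i → y′ s i ≡ y s i + l s i * (w′ s - w s) + p * z s i) →
           p ∣ c + ∑ a (λ s → eval a (y s) w) → p ∣ c + ∑ a (λ s → eval a (y′ s) w′) →
           p ∣ form a g (λ s → w′ s - w s)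
  escape a g y w = l , proof
    where
    N = proj₁ (shiftedForm a g w)

    Y : (Var a → ℤ) → ℤ
    Y w′ = ∑ a (λ s → eval a (y s) w′)

    P : Monomial a → ℤ
    P i = - 1ℤ * (∑ a (λ s → y s i) + N i)

    eval-P : ∀ w′ → eval a P w′ ≡ - (Y w′ + form a g (λ s → w′ s - w s))
    eval-P w′ = begin
      eval a P w′                                             ≡⟨ eval-* a (- 1ℤ) _ w′ ⟩
      - 1ℤ * eval a (λ i → ∑ a (λ s → y s i) + N i) w′        ≡⟨ ℤ.-1*i≡-i _ ⟩
      - eval a (λ i → ∑ a (λ s → y s i) + N i) w′             ≡⟨ cong -_ (eval-+ a _ N w′) ⟩
      - (eval a (λ i → ∑ a (λ s → y s i)) w′ + eval a N w′)   ≡⟨ cong -_ (cong₂ _+_ (eval-∑ a a y w′) (proj₂ (shiftedForm a g w) w′)) ⟩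
      - (Y w′ + form a g (λ s → w′ s - w s))                  ∎

    l = proj₁ (hadamard a P w)

    proof : ∀ p c (w′ : Var a → ℤ) (y′ z : Var a → Monomial a → ℤ) →
           (∀ s i → y′ s i ≡ y s i + l s i * (w′ s - w s) + p * z s i) →
           p ∣ c + Y w → p ∣ c + ∑ a (λ s → eval a (y′ s) w′) →
           p ∣ form a g (λ s → w′ s - w s)
    proof p c w′ y′ z eq p∣f p∣f′ = subst (p ∣_) final (∣m∣n⇒∣m+n (∣m∣n⇒∣m-n p∣f p∣f′) (∣m⇒∣m*n Z ∣-refl))
      where
      F = form a g (λ s → w′ s - w s)
      Z = ∑ a (λ s → eval a (z s) w′)
      D = ∑ a (λ s → (w′ s - w s) * eval a (l s) w′)

      eval-y′ : ∀ s → eval a (y′ s) w′ ≡ eval a (y s) w′ + (w′ s - w s) * eval a (l s) w′ + p * eval a (z s) w′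
      eval-y′ s = begin
        eval a (y′ s) w′
          ≡⟨ eval-cong a w′ (λ i → trans (eq s i) (cong (λ t → y s i + t + p * z s i) (ℤ.*-comm (l s i) (w′ s - w s)))) ⟩
        eval a (λ i → y s i + (w′ s - w s) * l s i + p * z s i) w′
          ≡⟨ eval-+ a (λ i → y s i + (w′ s - w s) * l s i) (λ i → p * z s i) w′ ⟩
        eval a (λ i → y s i + (w′ s - w s) * l s i) w′ + eval a (λ i → p * z s i) w′
          ≡⟨ cong₂ _+_ (trans (eval-+ a (y s) _ w′) (cong (_+_ (eval a (y s) w′)) (eval-* a (w′ s - w s) (l s) w′))) (eval-* a p (z s) w′) ⟩
        eval a (y s) w′ + (w′ s - w s) * eval a (l s) w′ + p * eval a (z s) w′ ∎

      Y′≡ : ∑ a (λ s → eval a (y′ s) w′) ≡ Y w′ + D + p * Z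
      Y′≡ = trans (∑-cong a eval-y′) (trans (∑-+ a _ _) (cong₂ _+_ (∑-+ a _ _) (∑-* a p _)))

      -- The form vanishes at 0, so P has the value - Y w at w, and the change caused by the slopes
      -- is D = Y w - Y w′ - F.
      D≡ : - (Y w′ + F) ≡ - (Y w + 0ℤ) + D
      D≡ = trans (sym (eval-P w′)) (trans (proj₂ (hadamard a P w) w′)
        (cong (_+ D) (trans (eval-P w) (cong (λ t → - (Y w + t)) (form-zero a g w)))))

      final : c + Y w - (c + ∑ a (λ s → eval a (y′ s) w′)) + p * Z ≡ F
      final = begin
        c + Y w - (c + ∑ a (λ s → eval a (y′ s) w′)) + p * Z  ≡⟨ cong (λ t → c + Y w - (c + t) + p * Z) Y′≡ ⟩
        c + Y w - (c + (Y w′ + D + p * Z)) + p * Z            ≡⟨ lemma₁ c (Y w) (Y w′) D (p * Z) ⟩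
        - (Y w′ + (- (Y w + 0ℤ) + D))                         ≡⟨ cong (λ t → - (Y w′ + t)) (sym D≡) ⟩
        - (Y w′ + - (Y w′ + F))                               ≡⟨ lemma₂ (Y w′) F ⟩
        F                                                     ∎
        where
        lemma₁ : ∀ c y y′ d z → c + y - (c + (y′ + d + z)) + z ≡ - (y′ + (- (y + 0ℤ) + d))
        lemma₁ = solve-∀
        lemma₂ : ∀ y f → - (y + - (y + f)) ≡ f
        lemma₂ = solve-∀

-- Digits

vars : ℕ → ℕ
vars zero    = 1
vars (suc a) = vars a ℕ.+ vars a

position : ∀ a → Var a → ℕ
position zero    _        = 0
position (suc a) (inj₁ s) = position a s
position (suc a) (inj₂ s) = vars a ℕ.+ position a s

position<vars : ∀ a s → ∃[ r ] vars a ≡ suc (position a s) ℕ.+ r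
position<vars zero    _ = 0 , refl
position<vars (suc a) (inj₁ s) with r , eq ← position<vars a s =
  r ℕ.+ vars a , trans (cong (ℕ._+ vars a) eq) (ℕ.+-assoc (suc (position a s)) r (vars a))
position<vars (suc a) (inj₂ s) with r , eq ← position<vars a s =
  r , trans (cong (vars a ℕ.+_) eq) (lemma (vars a) (position a s) r)
  where
  lemma : ∀ k e r → k ℕ.+ (suc e ℕ.+ r) ≡ suc (k ℕ.+ e) ℕ.+ r
  lemma = ℕ.solve-∀

module Digits (b : ℕ) .{{_ : NonZero b}} where

  value : ∀ a → (Var a → ℕ) → ℕ
  value zero    x = x tt
  value (suc a) x = value a (x ∘ inj₁) ℕ.+ b ℕ.^ vars a ℕ.* value a (x ∘ inj₂)

  -- The factor `k` is headroom that passes from the single digits to whole numbers. It is 2p where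
  -- the part below a digit has to be negligible, and 1 where only the size matters.
  digitwise-< : ∀ k {v w m n} → k ℕ.* v ℕ.< m → k ℕ.* w ℕ.< n → k ℕ.* (v ℕ.+ m ℕ.* w) ℕ.< m ℕ.* n
  digitwise-< k {v} {w} {m} {n} kv<m kw<n = begin-strict
    k ℕ.* (v ℕ.+ m ℕ.* w)          ≡⟨ lemma k v m w ⟩
    k ℕ.* v ℕ.+ m ℕ.* (k ℕ.* w)    <⟨ ℕ.+-monoˡ-< (m ℕ.* (k ℕ.* w)) kv<m ⟩
    m ℕ.+ m ℕ.* (k ℕ.* w)          ≡⟨ sym (ℕ.*-suc m (k ℕ.* w)) ⟩
    m ℕ.* suc (k ℕ.* w)            ≤⟨ ℕ.*-monoʳ-≤ m kw<n ⟩
    m ℕ.* n                        ∎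
    where
    open ℕ.≤-Reasoning
    lemma : ∀ k v m w → k ℕ.* (v ℕ.+ m ℕ.* w) ≡ k ℕ.* v ℕ.+ m ℕ.* (k ℕ.* w)
    lemma = ℕ.solve-∀

  value-< : ∀ a k x → (∀ s → k ℕ.* x s ℕ.< b) → k ℕ.* value a x ℕ.< b ℕ.^ vars a
  value-< zero    k x small = subst (k ℕ.* x tt ℕ.<_) (sym (ℕ.*-identityʳ b)) (small tt)
  value-< (suc a) k x small = subst (k ℕ.* value (suc a) x ℕ.<_) (sym (ℕ.^-distribˡ-+-* b (vars a) (vars a)))
    (digitwise-< k (value-< a k (x ∘ inj₁) (small ∘ inj₁)) (value-< a k (x ∘ inj₂) (small ∘ inj₂)))

  split : ∀ a k x → (∀ s → k ℕ.* x s ℕ.< b) → ∀ s →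
          ∃[ low ] ∃[ high ] (value a x ≡ low ℕ.+ b ℕ.^ position a s ℕ.* (x s ℕ.+ b ℕ.* high) ×
                              k ℕ.* low ℕ.< b ℕ.^ position a s)
  split zero k x small tt = 0 , 0 , lemma (x tt) b , subst (ℕ._< 1) (sym (ℕ.*-zeroʳ k)) (ℕ.s≤s ℕ.z≤n)
    where
    lemma : ∀ x b → x ≡ 0 ℕ.+ 1 ℕ.* (x ℕ.+ b ℕ.* 0)
    lemma = ℕ.solve-∀
  split (suc a) k x small (inj₁ s)
    with low , high , eq , low< ← split a k (x ∘ inj₁) (small ∘ inj₁) s
    with r , Keq ← position<vars a s
    = low , high ℕ.+ b ℕ.^ r ℕ.* v , trans
        (cong₂ (λ u w → u ℕ.+ w ℕ.* v) eq (trans (cong (b ℕ.^_) Keq) (ℕ.^-distribˡ-+-* b (suc (position a s)) r)))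
        (lemma low (b ℕ.^ position a s) (x (inj₁ s)) b high (b ℕ.^ r) v) , low<
    where
    v = value a (x ∘ inj₂)
    lemma : ∀ l e x b h r v → l ℕ.+ e ℕ.* (x ℕ.+ b ℕ.* h) ℕ.+ b ℕ.* e ℕ.* r ℕ.* v ≡ l ℕ.+ e ℕ.* (x ℕ.+ b ℕ.* (h ℕ.+ r ℕ.* v))
    lemma = ℕ.solve-∀
  split (suc a) k x small (inj₂ s)
    with low , high , eq , low< ← split a k (x ∘ inj₂) (small ∘ inj₂) s
    = v ℕ.+ m ℕ.* low , high , trans (cong (λ w → v ℕ.+ m ℕ.* w) eq)
        (trans (lemma v m low (b ℕ.^ position a s) (x (inj₂ s) ℕ.+ b ℕ.* high)) (cong (λ e → v ℕ.+ m ℕ.* low ℕ.+ e ℕ.* (x (inj₂ s) ℕ.+ b ℕ.* high)) (sym m*e))) ,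
      subst (k ℕ.* (v ℕ.+ m ℕ.* low) ℕ.<_) (sym m*e) (digitwise-< k (value-< a k (x ∘ inj₁) (small ∘ inj₁)) low<)
    where
    v = value a (x ∘ inj₁)
    m = b ℕ.^ vars a
    m*e = ℕ.^-distribˡ-+-* b (vars a) (position a s)
    lemma : ∀ v m l e y → v ℕ.+ m ℕ.* (l ℕ.+ e ℕ.* y) ≡ v ℕ.+ m ℕ.* l ℕ.+ m ℕ.* e ℕ.* y
    lemma = ℕ.solve-∀

-- Iterated division instead of division by p^j, so that the next digit is reached by one division
-- by p, by definition.
quot : ∀ p .{{_ : NonZero p}} → ℕ → ℕ → ℕ
quot p zero    x = x
quot p (suc j) x = quot p j x / p

quot-< : ∀ p .{{_ : NonZero p}} i j x → x ℕ.< p ℕ.^ (j ℕ.+ i) → quot p j x ℕ.< p ℕ.^ i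
quot-< p i zero    x x< = x<
quot-< p i (suc j) x x< = m<n*o⇒m/o<n (subst (quot p j x ℕ.<_) (ℕ.*-comm p (p ℕ.^ i))
  (quot-< p (suc i) j x (subst (λ n → x ℕ.< p ℕ.^ n) (sym (ℕ.+-suc j i)) x<)))

module _ where
  open import Data.Integer.Base using (_+_; _*_; _-_; -_)
  open import Data.Integer.Divisibility.Signed

  /-difference : ∀ p .{{_ : NonZero p}} m n → + p ∣ + m - + n → + m - + n ≡ + p * (+ (m / p) - + (n / p))
  /-difference p m n p∣ = begin
    + m - + n
      ≡⟨ cong₂ (λ u v → + u - + v) (m≡m%n+[m/n]*n m p) (trans (m≡m%n+[m/n]*n n p) (cong (ℕ._+ n / p ℕ.* p) (sym (∣-⇒%≡ m n p∣)))) ⟩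
    + (m % p) + + (m / p ℕ.* p) - (+ (m % p) + + (n / p ℕ.* p))
      ≡⟨ cong₂ (λ u v → + (m % p) + u - (+ (m % p) + v)) (ℤ.pos-* (m / p) p) (ℤ.pos-* (n / p) p) ⟩
    + (m % p) + + (m / p) * + p - (+ (m % p) + + (n / p) * + p)
      ≡⟨ lemma (+ (m % p)) (+ (m / p)) (+ (n / p)) (+ p) ⟩
    + p * (+ (m / p) - + (n / p)) ∎
    where
    open ≡-Reasoning
    lemma : ∀ r u v p → r + u * p - (r + v * p) ≡ p * (u - v)
    lemma = solve-∀

  ∣m-n∣-< : ∀ k l {m n} → k ℕ.* m ℕ.< l → k ℕ.* n ℕ.< l → k ℕ.* ℤ.∣ + m - + n ∣ ℕ.< l
  ∣m-n∣-< k l {m} {n} km<l kn<l with ℕ.≤-total n m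
  ... | inj₁ n≤m = subst (λ z → k ℕ.* z ℕ.< l) (sym (cong ℤ.∣_∣ (trans (ℤ.m-n≡m⊖n m n) (ℤ.⊖-≥ n≤m))))
        (ℕ.≤-<-trans (ℕ.*-monoʳ-≤ k (ℕ.m∸n≤m m n)) km<l)
  ... | inj₂ m≤n = subst (λ z → k ℕ.* z ℕ.< l) (trans (sym (cong ℤ.∣_∣ (trans (ℤ.m-n≡m⊖n n m) (ℤ.⊖-≥ m≤n)))) (ℤ.∣i-j∣≡∣j-i∣ (+ n) (+ m)))
        (ℕ.≤-<-trans (ℕ.*-monoʳ-≤ k (ℕ.m∸n≤m n m)) kn<l)

  -- The rounding step: a multiple of B that is the sum of two errors, each below B/2, is zero. `X`
  -- stands for the deviation from the line, `Y` for the contribution of the lower digits.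
  small-multiple : ∀ B E X Y → + B * E ≡ X + Y → 2 ℕ.* ℤ.∣ X ∣ ℕ.< B → 2 ℕ.* ℤ.∣ Y ∣ ℕ.< B → E ≡ 0ℤ
  small-multiple B E X Y eq X< Y< = ℤ.∣i∣≡0⇒i≡0 (ℕ.n<1⇒n≡0 (ℕ.*-cancelˡ-< B ℤ.∣ E ∣ 1 (ℕ.*-cancelˡ-< 2 _ _ (begin-strict
    2 ℕ.* (B ℕ.* ℤ.∣ E ∣)              ≡⟨ cong (2 ℕ.*_) (sym (ℤ.∣i*j∣≡∣i∣*∣j∣ (+ B) E)) ⟩
    2 ℕ.* ℤ.∣ + B * E ∣                ≡⟨ cong (λ z → 2 ℕ.* ℤ.∣ z ∣) eq ⟩
    2 ℕ.* ℤ.∣ X + Y ∣                  ≤⟨ ℕ.*-monoʳ-≤ 2 (ℤ.∣i+j∣≤∣i∣+∣j∣ X Y) ⟩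
    2 ℕ.* (ℤ.∣ X ∣ ℕ.+ ℤ.∣ Y ∣)        ≡⟨ ℕ.*-distribˡ-+ 2 ℤ.∣ X ∣ ℤ.∣ Y ∣ ⟩
    2 ℕ.* ℤ.∣ X ∣ ℕ.+ 2 ℕ.* ℤ.∣ Y ∣    <⟨ ℕ.+-mono-< X< Y< ⟩
    B ℕ.+ B                            ≡⟨ lemma B ⟩
    2 ℕ.* (B ℕ.* 1)                    ∎))))
    where
    open ℕ.≤-Reasoning
    lemma : ∀ B → B ℕ.+ B ≡ 2 ℕ.* (B ℕ.* 1)
    lemma = ℕ.solve-∀

-- Points and lines

module Configuration
  (p J a : ℕ) {{_ : NonZero p}} (2≤p : 2 ℕ.≤ p) (g : ℤ)
  (anisotropic-g : Anisotropic p g)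
  where

  open import Data.Integer.Base using (_+_; _*_; _-_; -_)
  open import Data.Integer.Divisibility.Signed

  b : ℕ
  b = p ℕ.^ (2 ℕ.+ J)

  instance
    b≢0 : NonZero b
    b≢0 = ℕ.m^n≢0 p (2 ℕ.+ J)

  open Digits b public

  -- inj₁ j is the constant term of the j-th constraint.
  Coord : Set
  Coord = Fin J ⊎ (Fin J × (Var a × Monomial a))

  level : (Var a → ℕ) → Fin J → Var a → ℤ
  level x j s = + quot p (toℕ j) (x s)

  coefficients : (Coord → ℕ) → Fin J → Var a → Monomial a → ℤ
  coefficients y j s i = + y (inj₂ (j , s , i))

  constraint : (Var a → ℕ) → (Coord → ℕ) → Fin J → ℤ
  constraint x y j = + y (inj₁ j) + ∑ a (λ s → eval a (coefficients y j s) (level x j))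

  slope : (Var a → ℕ) → (Coord → ℕ) → Fin J → Var a → Monomial a → ℤ
  slope x y j = proj₁ (escape a g (coefficients y j) (level x j))

  -- The line of (x , y) has direction 1 in the coordinate time and
  -- numerator / denominator in the others.
  numerator : (Var a → ℕ) → (Coord → ℕ) → Coord → ℕ
  numerator x y (inj₁ _)           = 0
  numerator x y (inj₂ (j , s , i)) = slope x y j s i %ℕ p

  -- Dividing by pʲ makes the change of y modulo p depend on the j-th digits of x.
  denominator : Coord → ℕ
  denominator (inj₁ _)           = 1
  denominator (inj₂ (j , s , _)) = p ℕ.^ toℕ j ℕ.* (b ℕ.* b ℕ.^ position a s)

  denominator≢0 : ∀ c → NonZero (denominator c)
  denominator≢0 (inj₁ _) = _
  denominator≢0 (inj₂ (j , s , _)) =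
    ℕ.m*n≢0 _ _ {{ℕ.m^n≢0 p (toℕ j)}} {{ℕ.m*n≢0 b _ {{it}} {{ℕ.m^n≢0 b (position a s)}}}}

  -- The factor b reappears in `denominator`; without it the slopes for j = 0 at the lowest position
  -- could exceed 1.
  time : (Var a → ℕ) → ℕ
  time x = b ℕ.* value a x

  -- Here the two spare factors p of b are spent: one matches the bound p on the numerators, the
  -- other majorizes the 2 needed for rounding.
  digit-small : ∀ {n} → n ℕ.< p ℕ.^ J → 2 ℕ.* p ℕ.* n ℕ.< b
  digit-small {n} n< = begin-strict
    2 ℕ.* p ℕ.* n               <⟨ ℕ.*-monoʳ-< (2 ℕ.* p) {{ℕ.m*n≢0 2 p}} n< ⟩
    2 ℕ.* p ℕ.* p ℕ.^ J         ≤⟨ ℕ.*-monoˡ-≤ (p ℕ.^ J) (ℕ.*-monoˡ-≤ p 2≤p) ⟩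
    p ℕ.* p ℕ.* p ℕ.^ J         ≡⟨ ℕ.*-assoc p p (p ℕ.^ J) ⟩
    b                           ∎
    where open ℕ.≤-Reasoning

  -- The digits above position s enter with a factor b. Dividing by p^j must leave a factor p, so
  -- that they do not disturb the congruence modulo p.
  b-factor : (j : Fin J) → ∃[ c ] b ≡ p ℕ.^ toℕ j ℕ.* p ℕ.* c
  b-factor j with r , eq ← ℕ.m≤n⇒∃[o]m+o≡n (Fin.toℕ<n j) = p ℕ.* p ℕ.* p ℕ.^ r ,
    trans (cong (λ n → p ℕ.^ (2 ℕ.+ n)) (sym eq))
      (trans (cong (λ n → p ℕ.* (p ℕ.* (p ℕ.* n))) (ℕ.^-distribˡ-+-* p (toℕ j) r))
        (lemma p (p ℕ.^ toℕ j) (p ℕ.^ r)))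
    where
    lemma : ∀ p k r → p ℕ.* (p ℕ.* (p ℕ.* (k ℕ.* r))) ≡ k ℕ.* p ℕ.* (p ℕ.* p ℕ.* r)
    lemma = ℕ.solve-∀

  value-cong : ∀ a {x x′ : Var a → ℕ} → (∀ s → x s ≡ x′ s) → value a x ≡ value a x′
  value-cong zero    eq = eq _
  value-cong (suc a) eq = cong₂ (λ u v → u ℕ.+ b ℕ.^ vars a ℕ.* v) (value-cong a (eq ∘ inj₁)) (value-cong a (eq ∘ inj₂))

  -- `denominator` times the deviation, in units of 1/M, of the second point from the line of the
  -- first, taken where the line has the same `time` as the second point. So `Close` says that the
  -- deviation is less than half a unit.
  gap : (x x′ : Var a → ℕ) (y y′ : Coord → ℕ) → Coord → ℤ
  gap x x′ y y′ c = + denominator c * (+ y′ c - + y c) - + numerator x y c * (+ time x′ - + time x)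

  Close : (x x′ : Var a → ℕ) (y y′ : Coord → ℕ) → Set
  Close x x′ y y′ = ∀ c → 2 ℕ.* ℤ.∣ gap x x′ y y′ c ∣ ℕ.< denominator c

  module _ {x x′ : Var a → ℕ} {y y′ : Coord → ℕ}
           (x< : ∀ s → x s ℕ.< p ℕ.^ J) (x′< : ∀ s → x′ s ℕ.< p ℕ.^ J)
           (on : ∀ j → + p ∣ constraint x y j) (on′ : ∀ j → + p ∣ constraint x′ y′ j)
           (close : Close x x′ y y′) where

    module _ (j : Fin J) (δ : Var a → ℤ) (δ-digit : ∀ s → + x′ s - + x s ≡ + (p ℕ.^ toℕ j) * δ s) where

      -- Divided by the denominator, the change of time is δ s, plus a multiple of p from the higher
      -- digits, plus a remainder from the lower digits that stays below 1/2 even after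
      -- multiplication by the numerator. As y and y′ are integers, the remainder and the deviation
      -- from the line drop out.
      y-change : ∀ s i → ∃[ z ] + y′ (inj₂ (j , s , i)) ≡ + y (inj₂ (j , s , i)) + slope x y j s i * δ s + + p * z
      y-change s i
        with low , high , eq , low< ← split a (2 ℕ.* p) x (digit-small ∘ x<) s
        with low′ , high′ , eq′ , low′< ← split a (2 ℕ.* p) x′ (digit-small ∘ x′<) s
        with c , b≡ ← b-factor j
        = z , y′≡
        where
        open ≡-Reasoning
        k = inj₂ (j , s , i)
        e = b ℕ.^ position a s
        m = numerator x y k
        B = denominator k
        P = + (p ℕ.^ toℕ j)
        q = slope x y j s i /ℕ p
        t = + time x′ - + time x
        Δ = + y′ k - + y k
        Z = + c * (+ high′ - + high)
        E = Δ - + m * (δ s + + p * Z)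
        X = gap x x′ y y′ k
        Y = + m * (+ b * (+ low′ - + low))
        z = slope x y j s i * Z - q * δ s - q * (+ p * Z)

        time≡ : ∀ x l h → value a x ≡ l ℕ.+ e ℕ.* (x s ℕ.+ b ℕ.* h) →
                + time x ≡ + b * (+ l + + e * (+ x s + + b * + h))
        time≡ x l h eq = begin
          + (b ℕ.* value a x)                      ≡⟨ cong (λ v → + (b ℕ.* v)) eq ⟩
          + (b ℕ.* (l ℕ.+ e ℕ.* (x s ℕ.+ b ℕ.* h))) ≡⟨ ℤ.pos-* b _ ⟩
          + b * (+ l + + (e ℕ.* (x s ℕ.+ b ℕ.* h))) ≡⟨ cong (λ v → + b * (+ l + v)) (trans (ℤ.pos-* e _) (cong (λ v → + e * (+ x s + v)) (ℤ.pos-* b h))) ⟩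
          + b * (+ l + + e * (+ x s + + b * + h))  ∎

        B≡ : + B ≡ P * (+ b * + e)
        B≡ = trans (ℤ.pos-* (p ℕ.^ toℕ j) (b ℕ.* e)) (cong (P *_) (ℤ.pos-* b e))

        +b≡ : + b ≡ P * + p * + c
        +b≡ = trans (cong +_ b≡) (trans (ℤ.pos-* (p ℕ.^ toℕ j ℕ.* p) c) (cong (_* + c) (ℤ.pos-* (p ℕ.^ toℕ j) p)))

        t≡ : t ≡ + b * (+ low′ - + low) + + b * + e * (P * (δ s + + p * Z))
        t≡ = begin
          + time x′ - + time x
            ≡⟨ cong₂ _-_ (time≡ x′ low′ high′ eq′) (time≡ x low high eq) ⟩
          + b * (+ low′ + + e * (+ x′ s + + b * + high′)) - + b * (+ low + + e * (+ x s + + b * + high))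
            ≡⟨ lemma (+ b) (+ e) (+ low) (+ low′) (+ x s) (+ x′ s) (+ high) (+ high′) ⟩
          + b * (+ low′ - + low) + + b * + e * (+ x′ s - + x s + + b * (+ high′ - + high))
            ≡⟨ cong₂ (λ u v → + b * (+ low′ - + low) + + b * + e * (u + v * (+ high′ - + high))) (δ-digit s) +b≡ ⟩
          + b * (+ low′ - + low) + + b * + e * (P * δ s + P * + p * + c * (+ high′ - + high))
            ≡⟨ cong (λ v → + b * (+ low′ - + low) + + b * + e * v) (lemma₂ P (δ s) (+ p) (+ c) (+ high′ - + high)) ⟩
          + b * (+ low′ - + low) + + b * + e * (P * (δ s + + p * Z)) ∎
          where
          lemma : ∀ b e l l′ x x′ h h′ → b * (l′ + e * (x′ + b * h′)) - b * (l + e * (x + b * h)) ≡ b * (l′ - l) + b * e * (x′ - x + b * (h′ - h))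
          lemma = solve-∀
          lemma₂ : ∀ P d p c h → P * d + P * p * c * h ≡ P * (d + p * (c * h))
          lemma₂ = solve-∀

        BE≡ : + B * E ≡ X + Y
        BE≡ = begin
          + B * (Δ - + m * (δ s + + p * Z))
            ≡⟨ lemma (+ B) Δ (+ m) (δ s + + p * Z) ⟩
          + B * Δ - + m * (+ B * (δ s + + p * Z))
            ≡⟨ cong (λ v → + B * Δ - + m * (v * (δ s + + p * Z))) B≡ ⟩
          + B * Δ - + m * (P * (+ b * + e) * (δ s + + p * Z))
            ≡⟨ lemma₂ (+ B * Δ) (+ m) P (+ b) (+ e) (δ s + + p * Z) (+ low′ - + low) ⟩
          + B * Δ - + m * (+ b * (+ low′ - + low) + + b * + e * (P * (δ s + + p * Z))) + Y
            ≡⟨ cong (λ v → + B * Δ - + m * v + Y) (sym t≡) ⟩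
          X + Y ∎
          where
          lemma : ∀ B d m u → B * (d - m * u) ≡ B * d - m * (B * u)
          lemma = solve-∀
          lemma₂ : ∀ d m P b e u l → d - m * (P * (b * e) * u) ≡ d - m * (b * l + b * e * (P * u)) + m * (b * l)
          lemma₂ = solve-∀

        Y< : 2 ℕ.* ℤ.∣ Y ∣ ℕ.< B
        Y< = R.begin-strict
          2 ℕ.* ℤ.∣ Y ∣                R.≡⟨ cong (2 ℕ.*_) (trans (ℤ.∣i*j∣≡∣i∣*∣j∣ (+ m) _) (cong (m ℕ.*_) (ℤ.∣i*j∣≡∣i∣*∣j∣ (+ b) _))) ⟩
          2 ℕ.* (m ℕ.* (b ℕ.* L))      R.≤⟨ ℕ.*-monoʳ-≤ 2 (ℕ.*-monoˡ-≤ (b ℕ.* L) (ℕ.<⇒≤ (n%ℕd<d (slope x y j s i) p))) ⟩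
          2 ℕ.* (p ℕ.* (b ℕ.* L))      R.≡⟨ lemma p b L ⟩
          b ℕ.* (2 ℕ.* p ℕ.* L)        R.<⟨ ℕ.*-monoʳ-< b (∣m-n∣-< (2 ℕ.* p) e low′< low<) ⟩
          b ℕ.* e                      R.≤⟨ ℕ.m≤n*m (b ℕ.* e) (p ℕ.^ toℕ j) {{ℕ.m^n≢0 p (toℕ j)}} ⟩
          B                            R.∎
          where
          L = ℤ.∣ + low′ - + low ∣
          module R = ℕ.≤-Reasoning
          lemma : ∀ p b L → 2 ℕ.* (p ℕ.* (b ℕ.* L)) ≡ b ℕ.* (2 ℕ.* p ℕ.* L)
          lemma = ℕ.solve-∀

        y′≡ : + y′ k ≡ + y k + slope x y j s i * δ s + + p * z
        y′≡ = begin
          + y′ k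
            ≡⟨ lemma (+ y′ k) (+ y k) (+ m * (δ s + + p * Z)) ⟩
          + y k + + m * (δ s + + p * Z) + E
            ≡⟨ cong (_+_ (+ y k + + m * (δ s + + p * Z))) (small-multiple B E X Y BE≡ (close k) Y<) ⟩
          + y k + + m * (δ s + + p * Z) + 0ℤ
            ≡⟨ cong (λ v → + y k + v * (δ s + + p * Z) + 0ℤ) (trans (lemma₂ (+ m) (q * + p)) (cong (_- q * + p) (sym (a≡a%ℕn+[a/ℕn]*n (slope x y j s i) p)))) ⟩
          + y k + (slope x y j s i - q * + p) * (δ s + + p * Z) + 0ℤ
            ≡⟨ lemma₃ (+ y k) (slope x y j s i) q (+ p) (δ s) Z ⟩
          + y k + slope x y j s i * δ s + + p * z ∎
          where
          lemma : ∀ y′ y v → y′ ≡ y + v + (y′ - y - v)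
          lemma = solve-∀
          lemma₂ : ∀ m n → m ≡ m + n - n
          lemma₂ = solve-∀
          lemma₃ : ∀ y l q p d Z → y + (l - q * p) * (d + p * Z) + 0ℤ ≡ y + l * d + p * (l * Z - q * d - q * (p * Z))
          lemma₃ = solve-∀

    c-equal : ∀ j → + y′ (inj₁ j) ≡ + y (inj₁ j)
    c-equal j = ℤ.i-j≡0⇒i≡j _ _ (small-multiple 1 (+ y′ (inj₁ j) - + y (inj₁ j)) (gap x x′ y y′ (inj₁ j)) 0ℤ (lemma (+ y′ (inj₁ j) - + y (inj₁ j)) (+ time x′ - + time x)) (close (inj₁ j)) (ℕ.s≤s ℕ.z≤n))
      where
      lemma : ∀ d t → + 1 * d ≡ + 1 * d - + 0 * t + 0ℤ
      lemma = solve-∀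

    Agree : ℕ → Set
    Agree j = ∀ s → + x′ s - + x s ≡ + (p ℕ.^ j) * (+ quot p j (x′ s) - + quot p j (x s))

    -- If the x agree in their lowest j digits to base p, their difference divided by p^j is the
    -- change of `level`, which is what the slopes of level j respond to. The j-th constraint then
    -- makes the form of this change divisible by p, and anisotropy gives the next digit of every x
    -- s.
    agree-suc : ∀ j → Agree (toℕ j) → Agree (suc (toℕ j))
    agree-suc j agree s = begin
      + x′ s - + x s
        ≡⟨ agree s ⟩
      + (p ℕ.^ toℕ j) * (level x′ j s - level x j s)
        ≡⟨ cong (+ (p ℕ.^ toℕ j) *_) (/-difference p (quot p (toℕ j) (x′ s)) (quot p (toℕ j) (x s)) (p∣δ s)) ⟩
      + (p ℕ.^ toℕ j) * (+ p * (+ quot p (suc (toℕ j)) (x′ s) - + quot p (suc (toℕ j)) (x s)))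
        ≡⟨ trans (sym (ℤ.*-assoc (+ (p ℕ.^ toℕ j)) (+ p) _)) (cong (_* (+ quot p (suc (toℕ j)) (x′ s) - + quot p (suc (toℕ j)) (x s)))
             (trans (sym (ℤ.pos-* (p ℕ.^ toℕ j) p)) (cong +_ (ℕ.*-comm (p ℕ.^ toℕ j) p)))) ⟩
      + (p ℕ.^ suc (toℕ j)) * (+ quot p (suc (toℕ j)) (x′ s) - + quot p (suc (toℕ j)) (x s)) ∎
      where
      open ≡-Reasoning
      change = y-change j (λ s → level x′ j s - level x j s) agree
      p∣δ : ∀ s → + p ∣ level x′ j s - level x j s
      p∣δ = form-anisotropic anisotropic-g a _ (proj₂ (escape a g (coefficients y j) (level x j))
        (+ p) (+ y (inj₁ j)) (level x′ j) (coefficients y′ j) (λ s i → proj₁ (change s i)) (λ s i → proj₂ (change s i))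
        (on j) (subst (λ v → + p ∣ v + ∑ a (λ s → eval a (coefficients y′ j s) (level x′ j))) (c-equal j) (on′ j)))

    agree-upto : ∀ j → j ℕ.≤ J → Agree j
    agree-upto zero    _   s = sym (ℤ.*-identityˡ (+ x′ s - + x s))
    agree-upto (suc j) j<J =
      subst (Agree ∘ suc) (Fin.toℕ-fromℕ< j<J) (agree-suc (fromℕ< j<J)
        (subst Agree (sym (Fin.toℕ-fromℕ< j<J)) (agree-upto j (ℕ.<⇒≤ j<J))))

    close⇒x≡ : ∀ s → x′ s ≡ x s
    close⇒x≡ s = ℤ.+-injective (ℤ.i-j≡0⇒i≡j _ _ (begin
      + x′ s - + x s                                          ≡⟨ agree-upto J ℕ.≤-refl s ⟩
      + (p ℕ.^ J) * (+ quot p J (x′ s) - + quot p J (x s))    ≡⟨ cong₂ (λ u v → + (p ℕ.^ J) * (+ u - + v)) (vanish (x′ s) (x′< s)) (vanish (x s) (x< s)) ⟩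
      + (p ℕ.^ J) * 0ℤ                                        ≡⟨ ℤ.*-zeroʳ (+ (p ℕ.^ J)) ⟩
      0ℤ                                                      ∎))
      where
      open ≡-Reasoning
      vanish : ∀ n → n ℕ.< p ℕ.^ J → quot p J n ≡ 0
      vanish n n< = ℕ.n<1⇒n≡0 (quot-< p 0 J n (subst (λ k → n ℕ.< p ℕ.^ k) (sym (ℕ.+-identityʳ J)) n<))

    -- Equal x give equal times, and then the gap is a multiple of the denominator and less than
    -- half of it.
    close⇒y≡ : ∀ c → y′ c ≡ y c
    close⇒y≡ c = ℤ.+-injective (ℤ.i-j≡0⇒i≡j _ _ (small-multiple (denominator c) (+ y′ c - + y c) (gap x x′ y y′ c) 0ℤ eq (close c) (ℕ.>-nonZero⁻¹ _ {{denominator≢0 c}})))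
      where
      eq : + denominator c * (+ y′ c - + y c) ≡ + denominator c * (+ y′ c - + y c) - + numerator x y c * (+ time x′ - + time x) + 0ℤ
      eq = trans (lemma (+ denominator c * (+ y′ c - + y c)) (+ numerator x y c) (+ time x))
             (cong (λ v → + denominator c * (+ y′ c - + y c) - + numerator x y c * (+ v - + time x) + 0ℤ)
               (sym (cong (b ℕ.*_) (value-cong a close⇒x≡))))
        where
        lemma : ∀ d m t → d ≡ d - m * (t - t) + 0ℤ
        lemma = solve-∀

-- Enumeration of the points

monomials : ℕ → ℕ
monomials zero    = 2
monomials (suc a) = monomials a ℕ.* monomials a ℕ.+ monomials a ℕ.* monomials a

Var↔Fin : ∀ a → Var a ↔ Fin (vars a)
Var↔Fin zero    = ↔-sym Fin.1↔⊤
Var↔Fin (suc a) = ↔-trans (Var↔Fin a ⊎-↔ Var↔Fin a) (↔-sym Fin.+↔⊎)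

Monomial↔Fin : ∀ a → Monomial a ↔ Fin (monomials a)
Monomial↔Fin zero    = ↔-sym Fin.2↔Bool
Monomial↔Fin (suc a) = ↔-trans (square ⊎-↔ square) (↔-sym Fin.+↔⊎)
  where square = ↔-trans (Monomial↔Fin a ×-↔ Monomial↔Fin a) (↔-sym Fin.*↔×)

finToFun-injective : ∀ {m n} {i j : Fin (m ℕ.^ n)} → (∀ k → finToFun {m} {n} i k ≡ finToFun j k) → i ≡ j
finToFun-injective {m} {n} {i} {j} eq = trans (sym (Fin.funToFin-finToFin {n} {m} i))
  (trans (funToFin-cong n eq) (Fin.funToFin-finToFin {n} {m} j))
  where
  funToFin-cong : ∀ n {f g : Fin n → Fin m} → (∀ k → f k ≡ g k) → funToFin f ≡ funToFin g
  funToFin-cong zero    eq = refl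
  funToFin-cong (suc n) eq = cong₂ combine (eq zero) (funToFin-cong n (eq ∘ suc))

module _ {A : Set} {n : ℕ} (A↔Fin : A ↔ Fin n) where

  decode : ∀ {m} → Fin (m ℕ.^ n) → A → Fin m
  decode {m} i x = finToFun {m} {n} i (Inverse.to A↔Fin x)

  decode-injective : ∀ {m} {i j : Fin (m ℕ.^ n)} → (∀ x → decode i x ≡ decode j x) → i ≡ j
  decode-injective {m} {i} {j} eq = finToFun-injective {m} {n} λ k →
    subst (λ k → finToFun {m} {n} i k ≡ finToFun {m} {n} j k) (Inverse.strictlyInverseˡ A↔Fin k) (eq (Inverse.from A↔Fin k))

sideExponent coefficientCount dimension : (J a : ℕ) → ℕ
sideExponent J a     = vars a ℕ.+ suc J ℕ.* suc (vars a)
coefficientCount J a = J ℕ.* (vars a ℕ.* monomials a)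
dimension J a        = 1 ℕ.+ (J ℕ.+ coefficientCount J a)

-- side p J a = b^(vars a + 1) for b = p^(J + 2), with one factor p split off.
side count : (p J a : ℕ) → ℕ
side p J a  = p ℕ.^ sideExponent J a ℕ.* p
count p J a = (p ℕ.^ J) ℕ.^ vars a ℕ.* (side p J a ℕ.^ coefficientCount J a ℕ.* (p ℕ.^ sideExponent J a) ℕ.^ J)

module Points
  (p J a : ℕ) {{_ : NonZero p}} (2≤p : 2 ℕ.≤ p) (g : ℤ)
  (anisotropic-g : Anisotropic p g)
  where

  open import Data.Integer.Base using (_+_; _*_; _-_; -_)
  open import Data.Integer.Divisibility.Signed
  open Configuration p J a 2≤p g anisotropic-g public

  private
    M⁻ = p ℕ.^ sideExponent J a
    M  = side p J a

  Coefficient↔Fin : (Fin J × (Var a × Monomial a)) ↔ Fin (coefficientCount J a)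
  Coefficient↔Fin = ↔-trans (↔-refl ×-↔ ↔-trans (Var↔Fin a ×-↔ Monomial↔Fin a) (↔-sym Fin.*↔×)) (↔-sym Fin.*↔×)

  Axis↔Fin : (⊤ ⊎ Coord) ↔ Fin (dimension J a)
  Axis↔Fin = ↔-trans (↔-sym Fin.1↔⊤ ⊎-↔ ↔-trans (↔-refl ⊎-↔ Coefficient↔Fin) (↔-sym Fin.+↔⊎)) (↔-sym Fin.+↔⊎)

  module _ (i : Fin (count p J a)) where
    private
      x-code = proj₁ (remQuot {(p ℕ.^ J) ℕ.^ vars a} (M ℕ.^ coefficientCount J a ℕ.* M⁻ ℕ.^ J) i)
      yz-code = proj₂ (remQuot {(p ℕ.^ J) ℕ.^ vars a} (M ℕ.^ coefficientCount J a ℕ.* M⁻ ℕ.^ J) i)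
      y-code = proj₁ (remQuot {M ℕ.^ coefficientCount J a} (M⁻ ℕ.^ J) yz-code)
      z-code = proj₂ (remQuot {M ℕ.^ coefficientCount J a} (M⁻ ℕ.^ J) yz-code)

    xFin : Var a → Fin (p ℕ.^ J)
    xFin = decode (Var↔Fin a) x-code

    yFin : Fin J × (Var a × Monomial a) → Fin M
    yFin = decode Coefficient↔Fin y-code

    zFin : Fin J → Fin M⁻
    zFin = decode ↔-refl z-code

    xOf : Var a → ℕ
    xOf s = toℕ (xFin s)

    polynomialPart : Fin J → ℤ
    polynomialPart j = ∑ a (λ s → eval a (λ m → + toℕ (yFin (j , s , m))) (level xOf j))

    -- The constraint determines the constant term modulo p, so only its quotient by p is free. This
    -- is the whole price of a constraint.
    axisFin : Coord → Fin M
    axisFin (inj₁ j) = combine (zFin j) (fromℕ< (n%ℕd<d (- polynomialPart j) p))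
    axisFin (inj₂ k) = yFin k

    yOf : Coord → ℕ
    yOf c = toℕ (axisFin c)

    constrained : ∀ j → + p ∣ constraint xOf yOf j
    constrained j = divides (+ toℕ (zFin j) - (- S) /ℕ p) (begin
      + yOf (inj₁ j) + S
        ≡⟨ cong (λ v → + v + S) (trans (Fin.toℕ-combine (zFin j) _) (cong (p ℕ.* toℕ (zFin j) ℕ.+_) (Fin.toℕ-fromℕ< _))) ⟩
      + (p ℕ.* toℕ (zFin j)) + + ((- S) %ℕ p) + S
        ≡⟨ cong₂ (λ u v → u + v + S) (ℤ.pos-* p (toℕ (zFin j)))
             (trans (lemma (+ ((- S) %ℕ p)) ((- S) /ℕ p * + p)) (cong (_- (- S) /ℕ p * + p) (sym (a≡a%ℕn+[a/ℕn]*n (- S) p)))) ⟩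
      + p * + toℕ (zFin j) + (- S - (- S) /ℕ p * + p) + S
        ≡⟨ lemma₂ (+ p) (+ toℕ (zFin j)) S ((- S) /ℕ p) ⟩
      (+ toℕ (zFin j) - (- S) /ℕ p) * + p ∎)
      where
      open ≡-Reasoning
      S = polynomialPart j
      lemma : ∀ m n → m ≡ m + n - n
      lemma = solve-∀
      lemma₂ : ∀ p z s q → p * z + (- s - q * p) + s ≡ (z - q) * p
      lemma₂ = solve-∀

  point-injective : ∀ i j → (∀ s → xOf i s ≡ xOf j s) → (∀ c → yOf i c ≡ yOf j c) → i ≡ j
  point-injective i j x≡ y≡ = remQuot-injective {(p ℕ.^ J) ℕ.^ vars a} (M ℕ.^ coefficientCount J a ℕ.* M⁻ ℕ.^ J) i j
    (decode-injective (Var↔Fin a) λ s → Fin.toℕ-injective (x≡ s))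
    (remQuot-injective {M ℕ.^ coefficientCount J a} (M⁻ ℕ.^ J) _ _
      (decode-injective Coefficient↔Fin λ k → Fin.toℕ-injective (y≡ (inj₂ k)))
      (decode-injective (↔-refl {A = Fin J}) λ k → Fin.combine-injectiveˡ (zFin i k) _ (zFin j k) _ (Fin.toℕ-injective (y≡ (inj₁ k)))))
    where
    remQuot-injective : ∀ {m} n (i j : Fin (m ℕ.* n)) → proj₁ (remQuot {m} n i) ≡ proj₁ (remQuot {m} n j) →
                        proj₂ (remQuot {m} n i) ≡ proj₂ (remQuot {m} n j) → i ≡ j
    remQuot-injective {m} n i j eq eq′ = trans (sym (Fin.combine-remQuot {m} n i)) (trans (cong₂ combine eq eq′) (Fin.combine-remQuot {m} n j))

  close⇒≡ : ∀ i j → Close (xOf i) (xOf j) (yOf i) (yOf j) → j ≡ i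
  close⇒≡ i j close = point-injective j i
    (close⇒x≡ (λ s → Fin.toℕ<n (xFin i s)) (λ s → Fin.toℕ<n (xFin j s)) (constrained i) (constrained j) close)
    (close⇒y≡ (λ s → Fin.toℕ<n (xFin i s)) (λ s → Fin.toℕ<n (xFin j s)) (constrained i) (constrained j) close)

  side≡ : M ≡ b ℕ.^ suc (vars a)
  side≡ = begin
    M⁻ ℕ.* p                        ≡⟨ ℕ.*-comm M⁻ p ⟩
    p ℕ.^ ((2 ℕ.+ J) ℕ.* suc (vars a))       ≡⟨ sym (ℕ.^-*-assoc p (2 ℕ.+ J) (suc (vars a))) ⟩
    b ℕ.^ suc (vars a)                       ∎
    where open ≡-Reasoning

  y<side : ∀ i c → yOf i c ℕ.< M
  y<side i c = Fin.toℕ<n (axisFin i c)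

  time<side : ∀ i → time (xOf i) ℕ.< M
  time<side i = subst (time (xOf i) ℕ.<_) (sym side≡) (ℕ.*-monoʳ-< b
    (subst (ℕ._< b ℕ.^ vars a) (ℕ.*-identityˡ _) (value-< a 1 (xOf i) λ s →
      ℕ.≤-<-trans (ℕ.*-monoˡ-≤ (xOf i s) (ℕ.>-nonZero⁻¹ (2 ℕ.* p) {{ℕ.m*n≢0 2 p}})) (digit-small (Fin.toℕ<n (xFin i s))))))

  -- Slopes of at most 1 do not magnify an error in time when it is carried over to the other
  -- coordinates.
  numerator≤denominator : ∀ i c → numerator (xOf i) (yOf i) c ℕ.≤ denominator c
  numerator≤denominator i (inj₁ _) = ℕ.z≤n
  numerator≤denominator i (inj₂ (j , s , m)) = begin
    slope (xOf i) (yOf i) j s m %ℕ p              ≤⟨ ℕ.<⇒≤ (n%ℕd<d (slope (xOf i) (yOf i) j s m) p) ⟩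
    p                                             ≤⟨ ℕ.m≤m*n p (p ℕ.^ (1 ℕ.+ J)) {{ℕ.m^n≢0 p (1 ℕ.+ J)}} ⟩
    b                                             ≤⟨ ℕ.m≤m*n b (b ℕ.^ position a s) {{ℕ.m^n≢0 b (position a s)}} ⟩
    b ℕ.* b ℕ.^ position a s                      ≤⟨ ℕ.m≤n*m (b ℕ.* b ℕ.^ position a s) (p ℕ.^ toℕ j) {{ℕ.m^n≢0 p (toℕ j)}} ⟩
    denominator (inj₂ (j , s , m))                ∎
    where open ℕ.≤-Reasoning

-- Rational coordinates

ℤ→ℚ : ℤ → ℚ
ℤ→ℚ i = i ℚ./ 1

toℚᵘ-ℤ→ℚ : ∀ i → ℚ.toℚᵘ (ℤ→ℚ i) ≃ mkℚᵘ i 0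
toℚᵘ-ℤ→ℚ i = ℚ.toℚᵘ-fromℚᵘ (mkℚᵘ i 0)

ℤ→ℚ-injective-≃ : ∀ i q → ℚ.toℚᵘ q ≃ mkℚᵘ i 0 → ℤ→ℚ i ≡ q
ℤ→ℚ-injective-≃ i q eq = ℚ.toℚᵘ-injective (ℚᵘ.≃-trans (toℚᵘ-ℤ→ℚ i) (ℚᵘ.≃-sym eq))

ℤ→ℚ-+ : ∀ i j → ℤ→ℚ (i ℤ.+ j) ≡ ℤ→ℚ i ℚ.+ ℤ→ℚ j
ℤ→ℚ-+ i j = ℤ→ℚ-injective-≃ (i ℤ.+ j) _ (ℚᵘ.≃-trans (ℚ.toℚᵘ-homo-+ (ℤ→ℚ i) (ℤ→ℚ j))
  (ℚᵘ.≃-trans (ℚᵘ.+-cong (toℚᵘ-ℤ→ℚ i) (toℚᵘ-ℤ→ℚ j))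
    (*≡* (cong (ℤ._* + 1) (cong₂ ℤ._+_ (ℤ.*-identityʳ i) (ℤ.*-identityʳ j))))))

ℤ→ℚ-* : ∀ i j → ℤ→ℚ (i ℤ.* j) ≡ ℤ→ℚ i ℚ.* ℤ→ℚ j
ℤ→ℚ-* i j = ℤ→ℚ-injective-≃ (i ℤ.* j) _ (ℚᵘ.≃-trans (ℚ.toℚᵘ-homo-* (ℤ→ℚ i) (ℤ→ℚ j))
  (ℚᵘ.*-cong (toℚᵘ-ℤ→ℚ i) (toℚᵘ-ℤ→ℚ j)))

ℤ→ℚ-neg : ∀ i → ℤ→ℚ (ℤ.- i) ≡ ℚ.- ℤ→ℚ i
ℤ→ℚ-neg i = ℤ→ℚ-injective-≃ (ℤ.- i) _ (ℚᵘ.≃-trans (ℚ.toℚᵘ-homo‿- (ℤ→ℚ i)) (ℚᵘ.-‿cong (toℚᵘ-ℤ→ℚ i)))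

ℤ→ℚ-- : ∀ i j → ℤ→ℚ (i ℤ.- j) ≡ ℤ→ℚ i ℚ.- ℤ→ℚ j
ℤ→ℚ-- i j = trans (ℤ→ℚ-+ i (ℤ.- j)) (cong (ℤ→ℚ i ℚ.+_) (ℤ→ℚ-neg j))

0≤ℕ→ℚ : ∀ n → 0ℚ ℚ.≤ ℕ→ℚ n
0≤ℕ→ℚ n = ℕ→ℚ-mono {0} {n} ℕ.z≤n

ℕ→ℚ-* : ∀ m n → ℕ→ℚ (m ℕ.* n) ≡ ℕ→ℚ m ℚ.* ℕ→ℚ n
ℕ→ℚ-* m n = trans (cong ℤ→ℚ (ℤ.pos-* m n)) (ℤ→ℚ-* (+ m) (+ n))

ℕ→ℚ-cancel-≤ : ∀ {m n} → ℕ→ℚ m ℚ.≤ ℕ→ℚ n → m ℕ.≤ n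
ℕ→ℚ-cancel-≤ {m} {n} m≤n
  with *≤* h ← ℚᵘ.≤-respˡ-≃ (toℚᵘ-ℤ→ℚ (+ m)) (ℚᵘ.≤-respʳ-≃ (toℚᵘ-ℤ→ℚ (+ n)) (ℚ.toℚᵘ-mono-≤ m≤n))
  = ℤ.drop‿+≤+ (subst₂ ℤ._≤_ (ℤ.*-identityʳ (+ m)) (ℤ.*-identityʳ (+ n)) h)

∣ℤ→ℚ∣ : ∀ i → ℚ.∣ ℤ→ℚ i ∣ ≡ ℕ→ℚ ℤ.∣ i ∣
∣ℤ→ℚ∣ (+ n)        = ℚ.0≤p⇒∣p∣≡p (0≤ℕ→ℚ n)
∣ℤ→ℚ∣ (ℤ.-[1+ n ]) = trans (cong ℚ.∣_∣ (ℤ→ℚ-neg (+ suc n))) (trans (ℚ.∣-p∣≡∣p∣ (ℕ→ℚ (suc n))) (∣ℤ→ℚ∣ (+ suc n)))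

0<ℕ→ℚ : ∀ n .{{_ : NonZero n}} → 0ℚ ℚ.< ℕ→ℚ n
0<ℕ→ℚ (suc n) = 0<ℕ→ℚ-suc n

reciprocal : ∀ n .{{_ : NonZero n}} → ∃[ q ] (0ℚ ℚ.< q × q ℚ.* ℕ→ℚ n ≡ 1ℚ)
reciprocal n = Estimates.inverse (ℕ→ℚ n) (0<ℕ→ℚ n)

module RationalPoints
  (p J a : ℕ) {{_ : NonZero p}} (2≤p : 2 ℕ.≤ p) (g : ℤ)
  (anisotropic-g : Anisotropic p g)
  where

  open Points p J a 2≤p g anisotropic-g public
  open import Data.Rational.Base using (_+_; _-_; _*_; _≤_; ∣_∣)
  open Estimates
  open +-*-Solver using (solve; _:+_; _:*_; :-_; _:-_; _:=_; con)

  instance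
    side≢0 : NonZero (side p J a)
    side≢0 = ℕ.m*n≢0 (p ℕ.^ sideExponent J a) p {{ℕ.m^n≢0 p (sideExponent J a)}}

  unit : ℚ
  unit = proj₁ (reciprocal (side p J a))

  unit*side : unit * ℕ→ℚ (side p J a) ≡ 1ℚ
  unit*side = proj₂ (proj₂ (reciprocal (side p J a)))

  pointℕ : Fin (count p J a) → ⊤ ⊎ Coord → ℕ
  pointℕ i (inj₁ _) = time (xOf i)
  pointℕ i (inj₂ c) = yOf i c

  pointℚ : Fin (count p J a) → ⊤ ⊎ Coord → ℚ
  pointℚ i k = ℕ→ℚ (pointℕ i k) * unit

  1/denominator : ∀ c → ∃[ q ] (0ℚ ℚ.< q × q * ℕ→ℚ (denominator c) ≡ 1ℚ)
  1/denominator c = reciprocal (denominator c) {{denominator≢0 c}}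

  directionℚ : Fin (count p J a) → ⊤ ⊎ Coord → ℚ
  directionℚ i (inj₁ _) = 1ℚ
  directionℚ i (inj₂ c) = ℕ→ℚ (numerator (xOf i) (yOf i) c) * proj₁ (1/denominator c)

  0≤pointℚ : ∀ i k → 0ℚ ≤ pointℚ i k
  0≤pointℚ i k = *-nonNeg _ unit (0≤ℕ→ℚ (pointℕ i k)) (ℚ.<⇒≤ (proj₁ (proj₂ (reciprocal (side p J a)))))

  pointℚ≤1 : ∀ i k → pointℚ i k ≤ 1ℚ
  pointℚ≤1 i k = begin
    ℕ→ℚ (pointℕ i k) * unit    ≤⟨ ℚ.*-monoʳ-≤-nonNeg unit {{ℚ.nonNegative (ℚ.<⇒≤ (proj₁ (proj₂ (reciprocal (side p J a)))))}} (ℕ→ℚ-mono (pointℕ≤side k)) ⟩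
    ℕ→ℚ (side p J a) * unit            ≡⟨ trans (ℚ.*-comm (ℕ→ℚ (side p J a)) unit) unit*side ⟩
    1ℚ                         ∎
    where
    open ℚ.≤-Reasoning
    pointℕ≤side : ∀ k → pointℕ i k ℕ.≤ side p J a
    pointℕ≤side (inj₁ _) = ℕ.<⇒≤ (time<side i)
    pointℕ≤side (inj₂ c) = ℕ.<⇒≤ (y<side i c)

  -- The parameter τ is eliminated by combining the error B of a coordinate with the error A of the
  -- time: the gap is D N B - m N A. Since m ≤ D, it is at most 2 D N ε in absolute value, which is
  -- at most D/4; this is the origin of the 8.
  near⇒≡ : ∀ {ε} → ℕ→ℚ 8 * (ℕ→ℚ (side p J a) * ε) ≤ 1ℚ → ∀ i j τ →
           (∀ k → ∣ pointℚ j k - (pointℚ i k + τ * directionℚ i k) ∣ ≤ ε) → j ≡ i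
  near⇒≡ {ε} small i j τ near = close⇒≡ i j close
    where
    open ℚ.≤-Reasoning
    N = ℕ→ℚ (side p J a)
    T = ℕ→ℚ (time (xOf i))
    T′ = ℕ→ℚ (time (xOf j))
    A = pointℚ j (inj₁ tt) - (pointℚ i (inj₁ tt) + τ * 1ℚ)

    0≤ε : 0ℚ ≤ ε
    0≤ε = ℚ.≤-trans (ℚ.0≤∣p∣ A) (near (inj₁ tt))

    close : Close (xOf i) (xOf j) (yOf i) (yOf j)
    close c = doubled (ℕ→ℚ-cancel-≤ (begin
      ℕ→ℚ (4 ℕ.* ℤ.∣ G ∣)               ≡⟨ ℕ→ℚ-* 4 ℤ.∣ G ∣ ⟩
      ℕ→ℚ 4 * ℕ→ℚ ℤ.∣ G ∣               ≡⟨ cong (ℕ→ℚ 4 *_) (trans (sym (∣ℤ→ℚ∣ G)) (cong ∣_∣ G≡)) ⟩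
      ℕ→ℚ 4 * ∣ D * (N * B) - m * (N * A) ∣
        ≤⟨ *-monoʳ (ℕ→ℚ 4) _ _ (0≤ℕ→ℚ 4) (ℚ.≤-trans (ℚ.∣p-q∣≤∣p∣+∣q∣ (D * (N * B)) (m * (N * A)))
             (ℚ.+-mono-≤ (bound D B (0≤ℕ→ℚ (denominator c)) (near (inj₂ c))) (bound m A (0≤ℕ→ℚ (numerator (xOf i) (yOf i) c)) (near (inj₁ tt))))) ⟩
      ℕ→ℚ 4 * (D * (N * ε) + m * (N * ε))
        ≤⟨ *-monoʳ (ℕ→ℚ 4) _ _ (0≤ℕ→ℚ 4) (ℚ.+-monoʳ-≤ (D * (N * ε)) (ℚ.*-monoʳ-≤-nonNeg (N * ε) {{ℚ.nonNegative 0≤Nε}} (ℕ→ℚ-mono (numerator≤denominator i c)))) ⟩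
      ℕ→ℚ 4 * (D * (N * ε) + D * (N * ε))
        ≡⟨ solve 2 (λ D e → con (ℕ→ℚ 4) :* (D :* e :+ D :* e) := D :* (con (ℕ→ℚ 8) :* e)) refl D (N * ε) ⟩
      D * (ℕ→ℚ 8 * (N * ε))
        ≤⟨ *-monoʳ D _ _ (0≤ℕ→ℚ (denominator c)) small ⟩
      D * 1ℚ                            ≡⟨ ℚ.*-identityʳ D ⟩
      ℕ→ℚ (denominator c)               ∎))
      where
      G = gap (xOf i) (xOf j) (yOf i) (yOf j) c
      D = ℕ→ℚ (denominator c)
      m = ℕ→ℚ (numerator (xOf i) (yOf i) c)
      Y = ℕ→ℚ (yOf i c)
      Y′ = ℕ→ℚ (yOf j c)
      D⁻¹ = proj₁ (1/denominator c)
      B = pointℚ j (inj₂ c) - (pointℚ i (inj₂ c) + τ * (m * D⁻¹))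

      doubled : 4 ℕ.* ℤ.∣ G ∣ ℕ.≤ denominator c → 2 ℕ.* ℤ.∣ G ∣ ℕ.< denominator c
      doubled h with ℤ.∣ G ∣
      ... | zero  = ℕ.>-nonZero⁻¹ (denominator c) {{denominator≢0 c}}
      ... | suc n = ℕ.<-≤-trans (ℕ.*-monoˡ-< (suc n) {2} {4} (ℕ.s≤s (ℕ.s≤s (ℕ.s≤s ℕ.z≤n)))) h

      0≤Nε : 0ℚ ≤ N * ε
      0≤Nε = *-nonNeg N ε (0≤ℕ→ℚ (side p J a)) 0≤ε

      bound : ∀ k z → 0ℚ ≤ k → ∣ z ∣ ≤ ε → ∣ k * (N * z) ∣ ≤ k * (N * ε)
      bound k z 0≤k z≤ε = begin
        ∣ k * (N * z) ∣      ≡⟨ trans (ℚ.∣p*q∣≡∣p∣*∣q∣ k (N * z)) (cong₂ _*_ (ℚ.0≤p⇒∣p∣≡p 0≤k)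
                                  (trans (ℚ.∣p*q∣≡∣p∣*∣q∣ N z) (cong (_* ∣ z ∣) (ℚ.0≤p⇒∣p∣≡p (0≤ℕ→ℚ (side p J a)))))) ⟩
        k * (N * ∣ z ∣)      ≤⟨ *-monoʳ k _ _ 0≤k (*-monoʳ N _ _ (0≤ℕ→ℚ (side p J a)) z≤ε) ⟩
        k * (N * ε)          ∎

      G≡ : ℤ→ℚ G ≡ D * (N * B) - m * (N * A)
      G≡ = begin-equality
        ℤ→ℚ G
          ≡⟨ trans (ℤ→ℚ-- (+ denominator c ℤ.* _) (+ numerator (xOf i) (yOf i) c ℤ.* _))
               (cong₂ _-_ (trans (ℤ→ℚ-* (+ denominator c) _) (cong (D *_) (ℤ→ℚ-- (+ yOf j c) (+ yOf i c))))
                          (trans (ℤ→ℚ-* (+ numerator (xOf i) (yOf i) c) _) (cong (m *_) (ℤ→ℚ-- (+ time (xOf j)) (+ time (xOf i)))))) ⟩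
        D * (Y′ - Y) - m * (T′ - T)
          -- Factors 1 are inserted exactly where the next step replaces them by `unit * N` and
          -- `D⁻¹ * D`; the ring solver does not know these relations.
          ≡⟨ solve 8 (λ D Y′ Y m T′ T τ N → D :* (Y′ :- Y) :- m :* (T′ :- T) :=
               con 1ℚ :* (D :* (Y′ :- Y)) :- N :* τ :* (m :* con 1ℚ) :- m :* (con 1ℚ :* (T′ :- T)) :+ m :* (N :* τ)) refl D Y′ Y m T′ T τ N ⟩
        1ℚ * (D * (Y′ - Y)) - N * τ * (m * 1ℚ) - m * (1ℚ * (T′ - T)) + m * (N * τ)
          ≡⟨ cong₂ (λ v w → v * (D * (Y′ - Y)) - N * τ * (m * w) - m * (v * (T′ - T)) + m * (N * τ)) (sym unit*side) (sym (proj₂ (proj₂ (1/denominator c)))) ⟩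
        unit * N * (D * (Y′ - Y)) - N * τ * (m * (D⁻¹ * D)) - m * (unit * N * (T′ - T)) + m * (N * τ)
          ≡⟨ solve 10 (λ u N D Y′ Y τ m d T′ T →
               u :* N :* (D :* (Y′ :- Y)) :- N :* τ :* (m :* (d :* D)) :- m :* (u :* N :* (T′ :- T)) :+ m :* (N :* τ) :=
               D :* (N :* (Y′ :* u :- (Y :* u :+ τ :* (m :* d)))) :- m :* (N :* (T′ :* u :- (T :* u :+ τ :* con 1ℚ))))
               refl unit N D Y′ Y τ m D⁻¹ T′ T ⟩
        D * (N * B) - m * (N * A) ∎

-- Real coordinates

open import Defs

Eventually : (ℕ → Set) → Set
Eventually P = ∃[ N ] ∀ n → N ℕ.≤ n → P n

eventually-× : ∀ {P Q} → Eventually P → Eventually Q → Eventually (λ n → P n × Q n)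
eventually-× (M , p) (N , q) = M ℕ.⊔ N , λ n le → p n (⊔≤ˡ M N le) , q n (⊔≤ʳ M N le)

eventually-map : ∀ {P Q : ℕ → Set} → (∀ n → P n → Q n) → Eventually P → Eventually Q
eventually-map f (N , p) = N , λ n le → f n (p n le)

eventually-∀ : ∀ {d} {P : Fin d → ℕ → Set} → (∀ k → Eventually (P k)) → Eventually (λ n → ∀ k → P k n)
eventually-∀ {zero}  h = 0 , λ _ _ ()
eventually-∀ {suc d} h = eventually-map (λ { n (p , ps) zero → p ; n (p , ps) (suc k) → ps k })
  (eventually-× (h zero) (eventually-∀ (h ∘ suc)))

∣seq∣≤‖‖∞ : ∀ {d} (v : Point d) n k → ℚ.∣ seq (v k) n ∣ ℚ.≤ seq ‖ v ‖∞ n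
∣seq∣≤‖‖∞ {suc d} v n zero = abs-≤
  (ℚ.≤-trans (ℚ.p≤p⊔q (seq (v zero) n) _) (ℚ.p≤p⊔q _ (seq ‖ v ∘ suc ‖∞ n)))
  (ℚ.≤-trans (ℚ.p≤q⊔p (seq (v zero) n) _) (ℚ.p≤p⊔q _ (seq ‖ v ∘ suc ‖∞ n)))
∣seq∣≤‖‖∞ {suc d} v n (suc k) = ℚ.≤-trans (∣seq∣≤‖‖∞ (v ∘ suc) n k) (ℚ.p≤q⊔p (seq ∣ v zero ∣ n) (seq ‖ v ∘ suc ‖∞ n))

seq-fromℕ-^ : ∀ n k m → seq (fromℕ n ^ k) m ≡ ℕ→ℚ (n ℕ.^ k)
seq-fromℕ-^ n zero    m = refl
seq-fromℕ-^ n (suc k) m = trans (cong (ℕ→ℚ n ℚ.*_) (seq-fromℕ-^ n k m)) (sym (ℕ→ℚ-* n (n ℕ.^ k)))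

1≤*-^ : ∀ c y k m → 1ℚ ℚ.≤ ℕ→ℚ c ℚ.* seq y m → 1ℚ ℚ.≤ ℕ→ℚ (c ℕ.^ k) ℚ.* seq (y ^ k) m
1≤*-^ c y zero    m h = ℚ.≤-refl
1≤*-^ c y (suc k) m h = begin
  1ℚ ℚ.* 1ℚ
    ≤⟨ *-mono 1ℚ (ℕ→ℚ c ℚ.* seq y m) 1ℚ (ℕ→ℚ (c ℕ.^ k) ℚ.* seq (y ^ k) m) 0≤1 (ℚ.≤-trans 0≤1 ih) h ih ⟩
  ℕ→ℚ c ℚ.* seq y m ℚ.* (ℕ→ℚ (c ℕ.^ k) ℚ.* seq (y ^ k) m)
    ≡⟨ solve 4 (λ c y C Y → c :* y :* (C :* Y) := c :* C :* (y :* Y)) refl (ℕ→ℚ c) (seq y m) (ℕ→ℚ (c ℕ.^ k)) (seq (y ^ k) m) ⟩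
  ℕ→ℚ c ℚ.* ℕ→ℚ (c ℕ.^ k) ℚ.* (seq y m ℚ.* seq (y ^ k) m)
    ≡⟨ cong (ℚ._* (seq y m ℚ.* seq (y ^ k) m)) (sym (ℕ→ℚ-* c (c ℕ.^ k))) ⟩
  ℕ→ℚ (c ℕ.^ suc k) ℚ.* seq (y ^ suc k) m ∎
  where
  open ℚ.≤-Reasoning
  ih = 1≤*-^ c y k m h
  0≤1 = 0≤ℕ→ℚ 1

-- For the exponent - k / (1 + q), `IsPower` yields y^(1+q) n^k ≤ 1, to be compared with c y ≥ 1.
-- The factor 2 comes from reading this inequality of reals with tolerance 1.
isPower-lower : ∀ {n t y} c k q → fromℕ (suc q) * t ≤ fromℕ 0 - fromℕ k → IsPower n t y →
                Eventually (λ m → 1ℚ ℚ.≤ ℕ→ℚ c ℚ.* seq y m) → n ℕ.^ k ℕ.≤ 2 ℕ.* c ℕ.^ suc q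
isPower-lower {n} {t} {y} c k q t≤ (_ , power) large =
  let N , h = eventually-× large (proj₂ (power 0 k q) t≤ 1ℚ (ℚ.positive⁻¹ 1ℚ))
      c*y≥1 , y*n≤1 = h N ℕ.≤-refl
      C = ℕ→ℚ (c ℕ.^ suc q)
      Y = seq (y ^ suc q) N
  in ℕ→ℚ-cancel-≤ (begin
    ℕ→ℚ (n ℕ.^ k)                            ≡⟨ sym (ℚ.*-identityˡ _) ⟩
    1ℚ ℚ.* ℕ→ℚ (n ℕ.^ k)                     ≤⟨ ℚ.*-monoʳ-≤-nonNeg (ℕ→ℚ (n ℕ.^ k)) {{ℚ.nonNegative (0≤ℕ→ℚ (n ℕ.^ k))}} (1≤*-^ c y (suc q) N c*y≥1) ⟩
    C ℚ.* Y ℚ.* ℕ→ℚ (n ℕ.^ k)                ≡⟨ trans (ℚ.*-assoc C Y _) (cong (λ z → C ℚ.* (Y ℚ.* z)) (sym (seq-fromℕ-^ n k N))) ⟩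
    C ℚ.* (Y ℚ.* seq (fromℕ n ^ k) N)        ≤⟨ *-monoʳ C _ _ (0≤ℕ→ℚ (c ℕ.^ suc q)) y*n≤1 ⟩
    C ℚ.* (1ℚ ℚ.+ 1ℚ)                        ≡⟨ ℚ.*-comm C (ℕ→ℚ 2) ⟩
    ℕ→ℚ 2 ℚ.* C                              ≡⟨ sym (ℕ→ℚ-* 2 (c ℕ.^ suc q)) ⟩
    ℕ→ℚ (2 ℕ.* c ℕ.^ suc q)                  ∎)
  where open ℚ.≤-Reasoning

-- ν = 1/(48 n): then 3ν = 1/(16 n) will bound the radius from below, and 6ν = 1/(8 n) is the
-- tolerance of `near⇒≡`.
thresholds : ∀ n .{{_ : NonZero n}} → ∃[ ν ] (0ℚ ℚ.< ν × ℕ→ℚ (16 ℕ.* n) ℚ.* (ν ℚ.+ ν ℚ.+ ν) ≡ 1ℚ ×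
             ℕ→ℚ 8 ℚ.* (ℕ→ℚ n ℚ.* (ν ℚ.+ ν ℚ.+ ν ℚ.+ (ν ℚ.+ ν ℚ.+ ν))) ℚ.≤ 1ℚ)
thresholds n with u , 0<u , uN≡1 ← reciprocal n | h , 0<h , h48≡1 ← reciprocal 48 =
  h ℚ.* u , *-pos h u 0<h 0<u , 16*3ν≡1 , ℚ.≤-reflexive (trans
    (solve 3 (λ h u N → con (ℕ→ℚ 8) :* (N :* (h :* u :+ h :* u :+ h :* u :+ (h :* u :+ h :* u :+ h :* u))) := h :* con (ℕ→ℚ 48) :* (u :* N)) refl h u N)
    (cong₂ ℚ._*_ h48≡1 uN≡1))
  where
  N = ℕ→ℚ n
  16*3ν≡1 : ℕ→ℚ (16 ℕ.* n) ℚ.* (h ℚ.* u ℚ.+ h ℚ.* u ℚ.+ h ℚ.* u) ≡ 1ℚ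
  16*3ν≡1 = trans (cong (ℚ._* (h ℚ.* u ℚ.+ h ℚ.* u ℚ.+ h ℚ.* u)) (ℕ→ℚ-* 16 n))
    (trans (solve 3 (λ h u N → con (ℕ→ℚ 16) :* N :* (h :* u :+ h :* u :+ h :* u) := h :* con (ℕ→ℚ 48) :* (u :* N)) refl h u N)
      (cong₂ ℚ._*_ h48≡1 uN≡1))

-- Three of the six ν bound r; the others are the errors in q lying on the line, in δ being its
-- distance, and in δ ≤ r.
dist-chain : ∀ {q D δ r ν x y} → ℚ.∣ x ℚ.- q ∣ ℚ.≤ D → ℚ.∣ q ℚ.- y ∣ ℚ.≤ ν → ℚ.∣ D ℚ.- δ ∣ ℚ.≤ ν → δ ℚ.≤ r ℚ.+ ν →
             r ℚ.≤ ν ℚ.+ ν ℚ.+ ν → ℚ.∣ x ℚ.- y ∣ ℚ.≤ ν ℚ.+ ν ℚ.+ ν ℚ.+ (ν ℚ.+ ν ℚ.+ ν)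
dist-chain {q} {D} {δ} {r} {ν} {x} {y} x-q q-y D-δ δ≤ r≤ = begin
  ℚ.∣ x ℚ.- y ∣
    ≤⟨ triangle x q y ⟩
  ℚ.∣ x ℚ.- q ∣ ℚ.+ ℚ.∣ q ℚ.- y ∣
    ≤⟨ ℚ.+-mono-≤ x-q q-y ⟩
  D ℚ.+ ν
    ≤⟨ ℚ.+-monoˡ-≤ ν (ℚ.≤-trans (≤+dist D δ) (ℚ.+-mono-≤ (ℚ.≤-trans δ≤ (ℚ.+-monoˡ-≤ ν r≤)) D-δ)) ⟩
  ν ℚ.+ ν ℚ.+ ν ℚ.+ ν ℚ.+ ν ℚ.+ ν
    ≡⟨ solve 1 (λ v → v :+ v :+ v :+ v :+ v :+ v := v :+ v :+ v :+ (v :+ v :+ v)) refl ν ⟩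
  ν ℚ.+ ν ℚ.+ ν ℚ.+ (ν ℚ.+ ν ℚ.+ ν) ∎
  where open ℚ.≤-Reasoning

module RealPoints
  (p J a : ℕ) {{_ : NonZero p}} (2≤p : 2 ℕ.≤ p) (g : ℤ)
  (anisotropic-g : Anisotropic p g)
  where

  open RationalPoints p J a 2≤p g anisotropic-g public

  axis : Fin (dimension J a) → ⊤ ⊎ Coord
  axis = Inverse.from Axis↔Fin

  axis⁻¹ : ⊤ ⊎ Coord → Fin (dimension J a)
  axis⁻¹ = Inverse.to Axis↔Fin

  axis-axis⁻¹ : ∀ k → axis (axis⁻¹ k) ≡ k
  axis-axis⁻¹ = Inverse.strictlyInverseʳ Axis↔Fin

  point : Fin (count p J a) → Point (dimension J a)
  point i k = fromℚ (pointℚ i (axis k))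

  line : Fin (count p J a) → Line (dimension J a)
  line i = record
    { base      = point i
    ; direction = λ k → fromℚ (directionℚ i (axis k))
    ; nonzero   = axis⁻¹ (inj₁ tt) ,
        subst (λ k → 0ℝ < ∣ fromℚ (directionℚ i k) ∣) (sym (axis-axis⁻¹ (inj₁ tt)))
          (1ℚ , ℚ.positive⁻¹ 1ℚ , 0 , λ _ _ → ℚ.≤-refl)
    }

  point-inUnitCube : ∀ i → InUnitCube (point i)
  point-inUnitCube i k =
    (λ ε 0<ε → 0 , λ _ _ → ℚ.≤-trans (0≤pointℚ i (axis k)) (p≤p+q (ℚ.<⇒≤ 0<ε))) ,
    (λ ε 0<ε → 0 , λ _ _ → ℚ.≤-trans (pointℚ≤1 i (axis k)) (p≤p+q (ℚ.<⇒≤ 0<ε)))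

  point∈line : ∀ i → point i ∈ line i
  point∈line i = 0ℝ , λ k ε 0<ε → 0 , λ _ _ → begin
    ℚ.∣ pointℚ i (axis k) ℚ.- (pointℚ i (axis k) ℚ.+ 0ℚ ℚ.* directionℚ i (axis k)) ∣
      ≡⟨ cong ℚ.∣_∣ (solve 2 (λ p v → p :- (p :+ con 0ℚ :* v) := con 0ℚ) refl (pointℚ i (axis k)) (directionℚ i (axis k))) ⟩
    0ℚ
      ≤⟨ ℚ.<⇒≤ 0<ε ⟩
    ε ∎
    where open ℚ.≤-Reasoning

  -- All real data are read off at one late index m, where the order of rationals is decidable: a
  -- radius of at most 3ν would put point i within 6ν of a rational point of line j, forcing i ≡ j.
  distance-lower : ∀ {ν} → 0ℚ ℚ.< ν → ℕ→ℚ 8 ℚ.* (ℕ→ℚ (side p J a) ℚ.* (ν ℚ.+ ν ℚ.+ ν ℚ.+ (ν ℚ.+ ν ℚ.+ ν))) ℚ.≤ 1ℚ →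
                   ∀ {i j} → i ≢ j → ∀ {δ r} → IsDistance (point i) (line j) δ → δ ≤ r →
                   Eventually (λ m → ν ℚ.+ ν ℚ.+ ν ℚ.≤ seq r m)
  distance-lower {ν} 0<ν 8*6ν≤1 {i} {j} i≢j {δ} {r} ((q , (t , q≈) , dist≈δ) , _) δ≤r =
    let N , h = eventually-× (eventually-∀ q-near) (eventually-× (dist≈δ ν 0<ν) (δ≤r ν 0<ν))
    in N , λ m N≤m → large m (h m N≤m)
    where
    near? : ⊤ ⊎ Coord → ℚ → ℚ → Set
    near? k x m = ℚ.∣ x ℚ.- (pointℚ j k ℚ.+ m ℚ.* directionℚ j k) ∣ ℚ.≤ ν

    q-near : ∀ k → Eventually (λ m → near? (axis k) (seq (q k) m) (seq t m))
    q-near k = q≈ k ν 0<ν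

    large : ∀ m → (∀ k → near? (axis k) (seq (q k) m) (seq t m)) ×
                  (ℚ.∣ seq (dist∞ (point i) q) m ℚ.- seq δ m ∣ ℚ.≤ ν × seq δ m ℚ.≤ seq r m ℚ.+ ν) →
            ν ℚ.+ ν ℚ.+ ν ℚ.≤ seq r m
    large m (near , dist-near , δ≤) = [ (λ h → h) , (λ r≤ → contradiction (equal r≤) i≢j) ]′ (ℚ.≤-total (ν ℚ.+ ν ℚ.+ ν) (seq r m))
      where
      equal : seq r m ℚ.≤ ν ℚ.+ ν ℚ.+ ν → i ≡ j
      equal r≤ = near⇒≡ 8*6ν≤1 j i (seq t m) λ k → subst near-j (axis-axis⁻¹ k) (chain (axis⁻¹ k))
        where
        x y : ⊤ ⊎ Coord → ℚ
        x k = pointℚ i k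
        y k = pointℚ j k ℚ.+ seq t m ℚ.* directionℚ j k

        near-j : ⊤ ⊎ Coord → Set
        near-j k = ℚ.∣ x k ℚ.- y k ∣ ℚ.≤ ν ℚ.+ ν ℚ.+ ν ℚ.+ (ν ℚ.+ ν ℚ.+ ν)

        x-q : ∀ k → ℚ.∣ x (axis k) ℚ.- seq (q k) m ∣ ℚ.≤ seq (dist∞ (point i) q) m
        x-q k = ∣seq∣≤‖‖∞ (zipWith _-_ (point i) q) m k

        chain : ∀ k → near-j (axis k)
        chain k = dist-chain {seq (q k) m} {seq (dist∞ (point i) q) m} {seq δ m} {seq r m} {ν} {x (axis k)} {y (axis k)}
          (x-q k) (near k) dist-near δ≤ r≤

  no-near-pair : ∀ t k q → fromℕ (suc q) * t ≤ fromℕ 0 - fromℕ k →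
                 2 ℕ.* (16 ℕ.* side p J a) ℕ.^ suc q ℕ.< count p J a ℕ.^ k →
                 ¬ (∃[ i ] ∃[ j ] (i ≢ j × ∃[ δ ] ∃[ r ]
                     (IsDistance (point i) (line j) δ × IsPower (count p J a) t r × δ ≤ r)))
  no-near-pair t k q t≤ many (i , j , i≢j , δ , r , isDistance , isPower , δ≤r) =
    let ν , 0<ν , 16*3ν≡1 , 8*6ν≤1 = thresholds (side p J a)
        N , 3ν≤r = distance-lower 0<ν 8*6ν≤1 i≢j {δ} {r} isDistance δ≤r
        scale = ℕ→ℚ (16 ℕ.* side p J a)
    in ℕ.<⇒≱ many (isPower-lower {t = t} {y = r} (16 ℕ.* side p J a) k q t≤ isPower (N , λ m N≤m →
         subst (ℚ._≤ scale ℚ.* seq r m) 16*3ν≡1 (*-monoʳ scale (ν ℚ.+ ν ℚ.+ ν) (seq r m) (0≤ℕ→ℚ (16 ℕ.* side p J a)) (3ν≤r m N≤m))))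

-- Choice of the parameters

ambient : ℕ → ℕ
ambient a = dimension (vars a) a

^-distribʳ-* : ∀ k m n → (m ℕ.* n) ℕ.^ k ≡ m ℕ.^ k ℕ.* n ℕ.^ k
^-distribʳ-* zero    m n = refl
^-distribʳ-* (suc k) m n = trans (cong (m ℕ.* n ℕ.*_) (^-distribʳ-* k m n)) (lemma m n (m ℕ.^ k) (n ℕ.^ k))
  where
  lemma : ∀ a b c d → a ℕ.* b ℕ.* (c ℕ.* d) ≡ a ℕ.* c ℕ.* (b ℕ.* d)
  lemma = ℕ.solve-∀

1+n≤2^n : ∀ n → suc n ℕ.≤ 2 ℕ.^ n
1+n≤2^n zero    = ℕ.≤-refl
1+n≤2^n (suc n) = begin
  suc (suc n)                   ≤⟨ ℕ.+-mono-≤ (ℕ.≤-trans (ℕ.s≤s ℕ.z≤n) (1+n≤2^n n)) (1+n≤2^n n) ⟩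
  2 ℕ.^ n ℕ.+ 2 ℕ.^ n           ≡⟨ cong (2 ℕ.^ n ℕ.+_) (sym (ℕ.+-identityʳ (2 ℕ.^ n))) ⟩
  2 ℕ.^ suc n                   ∎
  where open ℕ.≤-Reasoning

n<vars : ∀ n → n ℕ.< vars n
n<vars zero    = ℕ.≤-refl
n<vars (suc n) = ℕ.+-mono-≤ (ℕ.≤-trans (ℕ.s≤s ℕ.z≤n) (n<vars n)) (n<vars n)

-- Doubling turns the recursion m ↦ 2 m² into squaring.
2*monomials : ∀ a → monomials a ℕ.+ monomials a ≡ 4 ℕ.^ vars a
2*monomials zero    = refl
2*monomials (suc a) = begin
  mm ℕ.+ mm ℕ.+ (mm ℕ.+ mm)                       ≡⟨ lemma m ⟩
  (m ℕ.+ m) ℕ.* (m ℕ.+ m)                         ≡⟨ cong₂ ℕ._*_ (2*monomials a) (2*monomials a) ⟩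
  4 ℕ.^ vars a ℕ.* 4 ℕ.^ vars a                   ≡⟨ sym (ℕ.^-distribˡ-+-* 4 (vars a) (vars a)) ⟩
  4 ℕ.^ (vars a ℕ.+ vars a)                       ∎
  where
  open ≡-Reasoning
  m = monomials a
  mm = m ℕ.* m
  lemma : ∀ m → m ℕ.* m ℕ.+ m ℕ.* m ℕ.+ (m ℕ.* m ℕ.+ m ℕ.* m) ≡ (m ℕ.+ m) ℕ.* (m ℕ.+ m)
  lemma = ℕ.solve-∀

1≤monomials : ∀ a → 1 ℕ.≤ monomials a
1≤monomials zero    = ℕ.s≤s ℕ.z≤n
1≤monomials (suc a) = ℕ.≤-trans (ℕ.*-mono-≤ (1≤monomials a) (1≤monomials a)) (ℕ.m≤m+n _ _)

ambient≤16^ : ∀ a → ambient a ℕ.≤ 16 ℕ.^ vars a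
ambient≤16^ a = begin
  ambient a                                             ≤⟨ ℕ.m≤m+n (ambient a) (k ℕ.+ m ℕ.+ (k ℕ.* m ℕ.+ k ℕ.* m) ℕ.+ k ℕ.* k) ⟩
  ambient a ℕ.+ (k ℕ.+ m ℕ.+ (k ℕ.* m ℕ.+ k ℕ.* m) ℕ.+ k ℕ.* k)  ≡⟨ lemma k m ⟩
  (1 ℕ.+ k) ℕ.* (1 ℕ.+ k) ℕ.* (1 ℕ.+ m)                 ≤⟨ ℕ.*-mono-≤ (ℕ.*-mono-≤ (1+n≤2^n k) (1+n≤2^n k)) (ℕ.≤-trans (ℕ.+-monoˡ-≤ m (1≤monomials a)) (ℕ.≤-reflexive (2*monomials a))) ⟩
  2 ℕ.^ k ℕ.* 2 ℕ.^ k ℕ.* 4 ℕ.^ k                       ≡⟨ cong (ℕ._* 4 ℕ.^ k) (sym (^-distribʳ-* k 2 2)) ⟩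
  4 ℕ.^ k ℕ.* 4 ℕ.^ k                                   ≡⟨ sym (^-distribʳ-* k 4 4) ⟩
  16 ℕ.^ k                                              ∎
  where
  open ℕ.≤-Reasoning
  k = vars a
  m = monomials a
  lemma : ∀ k m → 1 ℕ.+ (k ℕ.+ k ℕ.* (k ℕ.* m)) ℕ.+ (k ℕ.+ m ℕ.+ (k ℕ.* m ℕ.+ k ℕ.* m) ℕ.+ k ℕ.* k) ≡ (1 ℕ.+ k) ℕ.* (1 ℕ.+ k) ℕ.* (1 ℕ.+ m)
  lemma = ℕ.solve-∀

-- Descends while half as many variables still suffice. Where it stops, either half falls below θ,
-- whence the bound 2θ, or there is only one variable.
findLevel : ∀ {θ q} a → θ ℚ.≤ ℕ→ℚ (vars a) ℚ.* q →
            ∃[ a′ ] (θ ℚ.≤ ℕ→ℚ (vars a′) ℚ.* q × (ℕ→ℚ (vars a′) ℚ.* q ℚ.≤ θ ℚ.+ θ ⊎ vars a′ ≡ 1))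
findLevel zero h = 0 , h , inj₂ refl
findLevel {θ} {q} (suc a) h = [ findLevel a , (λ small → suc a , h , inj₁ (bound small)) ]′ (ℚ.≤-total θ (ℕ→ℚ (vars a) ℚ.* q))
  where
  open ℚ.≤-Reasoning
  v = vars a
  bound : ℕ→ℚ v ℚ.* q ℚ.≤ θ → ℕ→ℚ (v ℕ.+ v) ℚ.* q ℚ.≤ θ ℚ.+ θ
  bound small = begin
    ℕ→ℚ (v ℕ.+ v) ℚ.* q                 ≡⟨ cong (ℚ._* q) (ℤ→ℚ-+ (+ v) (+ v)) ⟩
    (ℕ→ℚ v ℚ.+ ℕ→ℚ v) ℚ.* q             ≡⟨ ℚ.*-distribʳ-+ q (ℕ→ℚ v) (ℕ→ℚ v) ⟩
    ℕ→ℚ v ℚ.* q ℚ.+ ℕ→ℚ v ℚ.* q         ≤⟨ ℚ.+-mono-≤ small small ⟩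
    θ ℚ.+ θ                             ∎

level-exists : ∀ {θ q} → 0ℚ ℚ.< q →
               ∃[ a ] (θ ℚ.≤ ℕ→ℚ (vars a) ℚ.* q × (ℕ→ℚ (vars a) ℚ.* q ℚ.≤ θ ℚ.+ θ ⊎ vars a ≡ 1))
level-exists {θ} {q} 0<q with q⁻¹ , 0<q⁻¹ , eq ← inverse q 0<q with n , θ/q≤n ← archimedean (q⁻¹ ℚ.* θ) =
  findLevel n (begin
    θ                         ≡⟨ sym (cancel q q⁻¹ θ eq) ⟩
    q ℚ.* (q⁻¹ ℚ.* θ)         ≤⟨ *-monoʳ q _ _ (ℚ.<⇒≤ 0<q) (ℚ.≤-trans θ/q≤n (ℕ→ℚ-mono (ℕ.<⇒≤ (n<vars n)))) ⟩
    q ℚ.* ℕ→ℚ (vars n)        ≡⟨ ℚ.*-comm q (ℕ→ℚ (vars n)) ⟩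
    ℕ→ℚ (vars n) ℚ.* q        ∎)
  where open ℚ.≤-Reasoning

-- The k-th term is at least (16 k)^k / k!, and k! ≤ k^k.
16^≤expTerm : ∀ {x} k → ℕ→ℚ (16 ℕ.* k) ℚ.≤ x → ℕ→ℚ (16 ℕ.^ k) ℚ.≤ expTerm x k
16^≤expTerm zero h = ℚ.≤-refl
16^≤expTerm {x} (suc k) h = begin
  ℕ→ℚ (16 ℕ.^ suc k)
    ≡⟨ trans (cong ℕ→ℚ (ℕ.*-comm 16 (16 ℕ.^ k))) (trans (ℕ→ℚ-* (16 ℕ.^ k) 16) (sym (ℚ.*-identityʳ _))) ⟩
  P ℚ.* ℕ→ℚ 16 ℚ.* 1ℚ
    ≡⟨ cong (P ℚ.* ℕ→ℚ 16 ℚ.*_) (sym (1/suc-inverse k)) ⟩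
  P ℚ.* ℕ→ℚ 16 ℚ.* (r ℚ.* ℕ→ℚ (suc k))
    ≡⟨ solve 4 (λ P s r n → P :* s :* (r :* n) := P :* (s :* n) :* r) refl P (ℕ→ℚ 16) r (ℕ→ℚ (suc k)) ⟩
  P ℚ.* (ℕ→ℚ 16 ℚ.* ℕ→ℚ (suc k)) ℚ.* r
    ≡⟨ cong (λ z → P ℚ.* z ℚ.* r) (sym (ℕ→ℚ-* 16 (suc k))) ⟩
  P ℚ.* ℕ→ℚ (16 ℕ.* suc k) ℚ.* r
    ≤⟨ ℚ.*-monoʳ-≤-nonNeg r {{ℚ.nonNegative (ℚ.<⇒≤ (0<1/suc k))}}
         (*-mono P (expTerm x k) (ℕ→ℚ (16 ℕ.* suc k)) x (0≤ℕ→ℚ (16 ℕ.^ k)) (ℚ.≤-trans (0≤ℕ→ℚ (16 ℕ.* suc k)) h)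
           (16^≤expTerm k (ℚ.≤-trans (ℕ→ℚ-mono (ℕ.*-monoʳ-≤ 16 (ℕ.n≤1+n k))) h)) h) ⟩
  expTerm x k ℚ.* x ℚ.* r ∎
  where
  open ℚ.≤-Reasoning
  P = ℕ→ℚ (16 ℕ.^ k)
  r = + 1 ℚ./ suc k

expTerm≤expSum : ∀ {x} → 0ℚ ℚ.< x → ∀ {k m} → k ℕ.≤ m → expTerm x k ℚ.≤ expSum x m
expTerm≤expSum {x} 0<x {m = zero} ℕ.z≤n = ℚ.≤-refl
expTerm≤expSum {x} 0<x {k} {suc m} k≤1+m with ℕ.m≤n⇒m<n∨m≡n k≤1+m
... | inj₁ k<1+m = ℚ.≤-trans (expTerm≤expSum 0<x (ℕ.s≤s⁻¹ k<1+m)) (p≤p+q (0≤t x 0<x (suc m)))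
... | inj₂ refl  = p≤q+p (ℚ.≤-trans (0≤t x 0<x 0) (expTerm≤expSum 0<x {0} {m} ℕ.z≤n))

-- Here x will be d - γ. In (1 + q)/x = q/x + 1/x, the first summand is at least k, and the second,
-- at least 1/c, absorbs (1 + q) e.
exponent-≤ : ∀ x (0<x : 0ℝ < x) e k q c {η} → 0ℚ ℚ.≤ η → ℕ→ℚ (suc q) ℚ.* η ℚ.* ℕ→ℚ c ≡ 1ℚ →
             Eventually (λ m → 0ℚ ℚ.< seq x m × ℕ→ℚ k ℚ.* seq x m ℚ.≤ ℕ→ℚ q × seq x m ℚ.≤ ℕ→ℚ c × seq e m ℚ.≤ η) →
             fromℕ (suc q) * (- recip x 0<x + e) ≤ fromℕ 0 - fromℕ k
exponent-≤ x (_ , _ , _ , _) e k q c {η} 0≤η Qηc≡1 (N , h) ε 0<ε = N , λ m N≤m →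
  let 0<x , kx≤q , x≤c , e≤η = h m N≤m
      X = seq x m
      R = inv X
      0≤R = inv-nonNeg 0<x
      k≤qR : ℕ→ℚ k ℚ.≤ ℕ→ℚ q ℚ.* R
      k≤qR = begin
        ℕ→ℚ k                    ≡⟨ trans (sym (ℚ.*-identityʳ (ℕ→ℚ k))) (cong (ℕ→ℚ k ℚ.*_) (sym (inv-inverse 0<x))) ⟩
        ℕ→ℚ k ℚ.* (X ℚ.* R)      ≡⟨ sym (ℚ.*-assoc (ℕ→ℚ k) X R) ⟩
        ℕ→ℚ k ℚ.* X ℚ.* R        ≤⟨ ℚ.*-monoʳ-≤-nonNeg R {{ℚ.nonNegative 0≤R}} kx≤q ⟩
        ℕ→ℚ q ℚ.* R              ∎
      1≤cR : 1ℚ ℚ.≤ ℕ→ℚ c ℚ.* R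
      1≤cR = begin
        1ℚ                       ≡⟨ sym (inv-inverse 0<x) ⟩
        X ℚ.* R                  ≤⟨ ℚ.*-monoʳ-≤-nonNeg R {{ℚ.nonNegative 0≤R}} x≤c ⟩
        ℕ→ℚ c ℚ.* R              ∎
      Qη = ℕ→ℚ (suc q) ℚ.* η
      Qe≤R : ℕ→ℚ (suc q) ℚ.* seq e m ℚ.≤ R
      Qe≤R = begin
        ℕ→ℚ (suc q) ℚ.* seq e m  ≤⟨ *-monoʳ (ℕ→ℚ (suc q)) _ _ (0≤ℕ→ℚ (suc q)) e≤η ⟩
        Qη                       ≡⟨ sym (ℚ.*-identityʳ Qη) ⟩
        Qη ℚ.* 1ℚ                ≤⟨ *-monoʳ Qη _ _ 0≤Qη 1≤cR ⟩
        Qη ℚ.* (ℕ→ℚ c ℚ.* R)     ≡⟨ trans (sym (ℚ.*-assoc Qη (ℕ→ℚ c) R)) (trans (cong (ℚ._* R) Qηc≡1) (ℚ.*-identityˡ R)) ⟩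
        R                        ∎
  in begin
    ℕ→ℚ (suc q) ℚ.* (ℚ.- R ℚ.+ seq e m)
      ≡⟨ solve 3 (λ Q R e → Q :* (:- R :+ e) := Q :* e :- Q :* R) refl (ℕ→ℚ (suc q)) R (seq e m) ⟩
    ℕ→ℚ (suc q) ℚ.* seq e m ℚ.- ℕ→ℚ (suc q) ℚ.* R
      ≤⟨ ℚ.+-monoˡ-≤ (ℚ.- (ℕ→ℚ (suc q) ℚ.* R)) Qe≤R ⟩
    R ℚ.- ℕ→ℚ (suc q) ℚ.* R
      ≡⟨ cong (λ z → R ℚ.- z ℚ.* R) (ℕ→ℚ-suc q) ⟩
    R ℚ.- (ℕ→ℚ q ℚ.+ 1ℚ) ℚ.* R
      ≡⟨ solve 2 (λ q R → R :- (q :+ con 1ℚ) :* R := :- (q :* R)) refl (ℕ→ℚ q) R ⟩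
    ℚ.- (ℕ→ℚ q ℚ.* R)
      ≤⟨ ℚ.neg-antimono-≤ k≤qR ⟩
    ℚ.- ℕ→ℚ k
      ≡⟨ sym (ℚ.+-identityˡ (ℚ.- ℕ→ℚ k)) ⟩
    0ℚ ℚ.- ℕ→ℚ k
      ≤⟨ p≤p+q (ℚ.<⇒≤ 0<ε) ⟩
    0ℚ ℚ.- ℕ→ℚ k ℚ.+ ε ∎
  where
  open ℚ.≤-Reasoning
  0≤Qη : 0ℚ ℚ.≤ ℕ→ℚ (suc q) ℚ.* η
  0≤Qη = *-nonNeg _ η (0≤ℕ→ℚ (suc q)) 0≤η

-- Number of points against side length

module _ (a : ℕ) where
  private
    k = vars a
    c = coefficientCount k a
    s⁻ = sideExponent k a
    E = k ℕ.* k ℕ.+ (suc s⁻ ℕ.* c ℕ.+ s⁻ ℕ.* k)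

  -- With W = suc s⁻ and d = ambient a, the left-hand side is (W d − (4 k + 2)) k.
  exponents : ∀ q → 5 ℕ.+ q ≡ k ℕ.* ambient a → E ℕ.* k ≡ suc s⁻ ℕ.* suc q ℕ.+ (10 ℕ.* k ℕ.+ 8)
  exponents q eq = ℕ.+-cancelʳ-≡ (k ℕ.* (4 ℕ.* k ℕ.+ 2)) _ _ (begin
    E ℕ.* k ℕ.+ k ℕ.* (4 ℕ.* k ℕ.+ 2)                                             ≡⟨ lemma k c ⟩
    suc s⁻ ℕ.* (k ℕ.* ambient a)                                                  ≡⟨ cong (suc s⁻ ℕ.*_) (sym eq) ⟩
    suc s⁻ ℕ.* (5 ℕ.+ q)                                                          ≡⟨ lemma₂ k q ⟩
    suc s⁻ ℕ.* suc q ℕ.+ (10 ℕ.* k ℕ.+ 8) ℕ.+ k ℕ.* (4 ℕ.* k ℕ.+ 2)               ∎)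
    where
    open ≡-Reasoning
    lemma : ∀ k c → (k ℕ.* k ℕ.+ (suc (k ℕ.+ (suc k ℕ.+ k ℕ.* suc k)) ℕ.* c ℕ.+ (k ℕ.+ (suc k ℕ.+ k ℕ.* suc k)) ℕ.* k)) ℕ.* k ℕ.+ k ℕ.* (4 ℕ.* k ℕ.+ 2)
            ≡ suc (k ℕ.+ (suc k ℕ.+ k ℕ.* suc k)) ℕ.* (k ℕ.* (1 ℕ.+ (k ℕ.+ c)))
    lemma = ℕ.solve-∀
    lemma₂ : ∀ k q → suc (k ℕ.+ (suc k ℕ.+ k ℕ.* suc k)) ℕ.* (5 ℕ.+ q) ≡ suc (k ℕ.+ (suc k ℕ.+ k ℕ.* suc k)) ℕ.* suc q ℕ.+ (10 ℕ.* k ℕ.+ 8) ℕ.+ k ℕ.* (4 ℕ.* k ℕ.+ 2)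
    lemma₂ = ℕ.solve-∀

  module _ (p : ℕ) .{{_ : NonZero p}} where
    side≡^ : side p k a ≡ p ℕ.^ suc s⁻
    side≡^ = ℕ.*-comm (p ℕ.^ s⁻) p

    count≡^ : count p k a ≡ p ℕ.^ E
    count≡^ = begin
      (p ℕ.^ k) ℕ.^ k ℕ.* (side p k a ℕ.^ c ℕ.* (p ℕ.^ s⁻) ℕ.^ k)
        ≡⟨ cong₂ ℕ._*_ (ℕ.^-*-assoc p k k) (cong₂ ℕ._*_ (trans (cong (ℕ._^ c) side≡^) (ℕ.^-*-assoc p (suc s⁻) c)) (ℕ.^-*-assoc p s⁻ k)) ⟩
      p ℕ.^ (k ℕ.* k) ℕ.* (p ℕ.^ (suc s⁻ ℕ.* c) ℕ.* p ℕ.^ (s⁻ ℕ.* k))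
        ≡⟨ cong (p ℕ.^ (k ℕ.* k) ℕ.*_) (sym (ℕ.^-distribˡ-+-* p (suc s⁻ ℕ.* c) (s⁻ ℕ.* k))) ⟩
      p ℕ.^ (k ℕ.* k) ℕ.* p ℕ.^ (suc s⁻ ℕ.* c ℕ.+ s⁻ ℕ.* k)
        ≡⟨ sym (ℕ.^-distribˡ-+-* p (k ℕ.* k) (suc s⁻ ℕ.* c ℕ.+ s⁻ ℕ.* k)) ⟩
      p ℕ.^ E ∎
      where open ≡-Reasoning

    p≤count : ∀ q → 5 ℕ.+ q ≡ k ℕ.* ambient a → p ℕ.≤ count p k a
    p≤count q eq = subst (p ℕ.≤_) (sym count≡^) (positive E λ E≡0 →
      ℕ.m+1+n≢0 (suc s⁻ ℕ.* suc q ℕ.+ 10 ℕ.* k) (trans (ℕ.+-assoc (suc s⁻ ℕ.* suc q) (10 ℕ.* k) 8) (trans (sym (exponents q eq)) (cong (ℕ._* k) E≡0))))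
      where
      positive : ∀ e → e ≢ 0 → p ℕ.≤ p ℕ.^ e
      positive zero    e≢0 = contradiction refl e≢0
      positive (suc e) _   = ℕ.m≤m*n p (p ℕ.^ e) {{ℕ.m^n≢0 p e}}

    -- With W = (k + 1)(k + 2) the side is p^W. The digits lose p^(3k+2) against a full coordinate
    -- and the constraints lose p^k, so the count is p^(W d - (4k + 2)). Its k-th power exceeds the
    -- (1 + q)-th power of the side by p^(10k+8), of which one factor p outweighs the constant.
    count-large : ∀ q → 5 ℕ.+ q ≡ k ℕ.* ambient a → 2 ℕ.* 16 ℕ.^ suc q ℕ.< p →
                  2 ℕ.* (16 ℕ.* side p k a) ℕ.^ suc q ℕ.< count p k a ℕ.^ k
    count-large q eq big = begin-strict
      2 ℕ.* (16 ℕ.* side p k a) ℕ.^ suc q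
        ≡⟨ cong (2 ℕ.*_) (^-distribʳ-* (suc q) 16 (side p k a)) ⟩
      2 ℕ.* (16 ℕ.^ suc q ℕ.* side p k a ℕ.^ suc q)
        ≡⟨ sym (ℕ.*-assoc 2 (16 ℕ.^ suc q) (side p k a ℕ.^ suc q)) ⟩
      2 ℕ.* 16 ℕ.^ suc q ℕ.* side p k a ℕ.^ suc q
        ≡⟨ cong (2 ℕ.* 16 ℕ.^ suc q ℕ.*_) (trans (cong (ℕ._^ suc q) side≡^) (ℕ.^-*-assoc p (suc s⁻) (suc q))) ⟩
      2 ℕ.* 16 ℕ.^ suc q ℕ.* p ℕ.^ F
        <⟨ ℕ.*-monoˡ-< (p ℕ.^ F) {{ℕ.m^n≢0 p F}} big ⟩
      p ℕ.* p ℕ.^ F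
        ≤⟨ ℕ.m≤m*n (p ℕ.* p ℕ.^ F) (p ℕ.^ G) {{ℕ.m^n≢0 p G}} ⟩
      p ℕ.* p ℕ.^ F ℕ.* p ℕ.^ G
        ≡⟨ sym (ℕ.^-distribˡ-+-* p (suc F) G) ⟩
      p ℕ.^ (suc F ℕ.+ G)
        ≡⟨ cong (p ℕ.^_) (trans (sym (ℕ.+-suc F G)) (trans (cong (F ℕ.+_) (sym (ℕ.+-suc (10 ℕ.* k) 7))) (sym (exponents q eq)))) ⟩
      p ℕ.^ (E ℕ.* k)
        ≡⟨ sym (ℕ.^-*-assoc p E k) ⟩
      (p ℕ.^ E) ℕ.^ k
        ≡⟨ cong (ℕ._^ k) (sym count≡^) ⟩
      count p k a ℕ.^ k ∎
      where
      open ℕ.≤-Reasoning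
      F = suc s⁻ ℕ.* suc q
      G = 10 ℕ.* k ℕ.+ 7

open ℚ.≤-Reasoning

-- The number of variables has to be chosen by comparisons, which are decidable for rationals. Half
-- of a late term c of γ serves, as later terms differ from c by at most c/2.
rational-bounds : ∀ γ → 0ℝ < γ →
                  ∃[ q ] (0ℚ ℚ.< q × Eventually (λ m → q ℚ.≤ seq γ m × seq γ m ℚ.≤ q ℚ.+ q ℚ.+ q))
rational-bounds γ (δ , 0<δ , N₀ , δ≤γ)
  with N₁ , close ← cauchy γ (½ ℚ.* δ) (*-pos ½ δ (ℚ.positive⁻¹ ½) 0<δ)
  = q , *-pos ½ c (ℚ.positive⁻¹ ½) (ℚ.<-≤-trans 0<δ δ≤c) , N , λ m N≤m →
    (begin
      q                                         ≡⟨ solve 1 (λ c → con ½ :* c := c :- con ½ :* c) refl c ⟩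
      c ℚ.- q                                   ≤⟨ ℚ.+-monoˡ-≤ (ℚ.- q) (≤+dist c (seq γ m)) ⟩
      seq γ m ℚ.+ ℚ.∣ c ℚ.- seq γ m ∣ ℚ.- q     ≤⟨ ℚ.+-monoˡ-≤ (ℚ.- q) (ℚ.+-monoʳ-≤ (seq γ m) (ℚ.≤-trans (close N m (ℕ.m≤n⊔m N₀ N₁) (⊔≤ʳ N₀ N₁ N≤m)) ½δ≤q)) ⟩
      seq γ m ℚ.+ q ℚ.- q                       ≡⟨ solve 2 (λ g q → g :+ q :- q := g) refl (seq γ m) q ⟩
      seq γ m                                   ∎) ,
    (begin
      seq γ m                                   ≤⟨ ≤+dist (seq γ m) c ⟩
      c ℚ.+ ℚ.∣ seq γ m ℚ.- c ∣                 ≤⟨ ℚ.+-monoʳ-≤ c (ℚ.≤-trans (close m N (⊔≤ʳ N₀ N₁ N≤m) (ℕ.m≤n⊔m N₀ N₁)) ½δ≤q) ⟩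
      c ℚ.+ q                                   ≡⟨ solve 1 (λ c → c :+ con ½ :* c := con ½ :* c :+ con ½ :* c :+ con ½ :* c) refl c ⟩
      q ℚ.+ q ℚ.+ q                             ∎)
  where
  N = N₀ ℕ.⊔ N₁
  c = seq γ N
  q = ½ ℚ.* c

  δ≤c : δ ℚ.≤ c
  δ≤c = subst (ℚ._≤ c) (ℚ.+-identityˡ δ) (δ≤γ N (ℕ.m≤m⊔n N₀ N₁))

  ½δ≤q : ½ ℚ.* δ ℚ.≤ q
  ½δ≤q = *-monoʳ ½ δ c (ℚ.<⇒≤ (ℚ.positive⁻¹ ½)) δ≤c

-- The summand 5 gives k γ ≥ 5: the loss of points takes less than 4, and the remaining 1 pays for
-- the o(1). The summand 3q · q gives k ≥ 3q ≥ γ, so that d > γ.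
module _ (γ : ℝ) (0<γ : 0ℝ < γ) (a : ℕ) {q : ℚ} (0<q : 0ℚ ℚ.< q)
         (bounds : Eventually (λ m → q ℚ.≤ seq γ m × seq γ m ℚ.≤ q ℚ.+ q ℚ.+ q))
         (θ≤kq : ℕ→ℚ 5 ℚ.+ (q ℚ.+ q ℚ.+ q) ℚ.* q ℚ.≤ ℕ→ℚ (vars a) ℚ.* q) where
  private
    k = vars a
    d = ambient a
    3q = q ℚ.+ q ℚ.+ q
    0≤q = ℚ.<⇒≤ 0<q

    0≤3q : 0ℚ ℚ.≤ 3q
    0≤3q = ℚ.≤-trans 0≤q (p≤q+p (ℚ.≤-trans 0≤q (p≤p+q 0≤q)))

    q≤3q : q ℚ.≤ 3q
    q≤3q = p≤q+p (ℚ.≤-trans 0≤q (p≤p+q 0≤q))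

    5≤kq : ℕ→ℚ 5 ℚ.≤ ℕ→ℚ k ℚ.* q
    5≤kq = ℚ.≤-trans (p≤p+q (*-nonNeg 3q q 0≤3q 0≤q)) θ≤kq

    3q≤k : 3q ℚ.≤ ℕ→ℚ k
    3q≤k = *-cancel q 3q (ℕ→ℚ k) 0<q (begin
      q ℚ.* 3q                        ≡⟨ ℚ.*-comm q 3q ⟩
      3q ℚ.* q                        ≤⟨ p≤q+p (0≤ℕ→ℚ 5) ⟩
      ℕ→ℚ 5 ℚ.+ 3q ℚ.* q              ≤⟨ θ≤kq ⟩
      ℕ→ℚ k ℚ.* q                     ≡⟨ ℚ.*-comm (ℕ→ℚ k) q ⟩
      q ℚ.* ℕ→ℚ k                     ∎)

    1+k≤d : suc k ℕ.≤ d
    1+k≤d = ℕ.s≤s (ℕ.m≤m+n k (k ℕ.* (k ℕ.* monomials a)))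

    1≤d-3q : 1ℚ ℚ.≤ ℕ→ℚ d ℚ.- 3q
    1≤d-3q = begin
      1ℚ                              ≡⟨ solve 1 (λ k → con 1ℚ := k :+ con 1ℚ :- k) refl (ℕ→ℚ k) ⟩
      ℕ→ℚ k ℚ.+ 1ℚ ℚ.- ℕ→ℚ k          ≡⟨ cong (ℚ._- ℕ→ℚ k) (sym (CauchyProofs.ℕ→ℚ-suc k)) ⟩
      ℕ→ℚ (suc k) ℚ.- ℕ→ℚ k           ≤⟨ ℚ.+-mono-≤ (ℕ→ℚ-mono 1+k≤d) (ℚ.neg-antimono-≤ 3q≤k) ⟩
      ℕ→ℚ d ℚ.- 3q                    ∎

    1≤d-γ : ∀ {g} → g ℚ.≤ 3q → 1ℚ ℚ.≤ ℕ→ℚ d ℚ.- g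
    1≤d-γ g≤3q = ℚ.≤-trans 1≤d-3q (ℚ.+-monoʳ-≤ (ℕ→ℚ d) (ℚ.neg-antimono-≤ g≤3q))

  γ<ambient : 0ℝ < fromℕ d - γ
  γ<ambient = 1ℚ , ℚ.positive⁻¹ 1ℚ , proj₁ bounds , λ m N≤m →
    subst (ℚ._≤ ℕ→ℚ d ℚ.- seq γ m) (sym (ℚ.+-identityˡ 1ℚ)) (1≤d-γ (proj₂ (proj₂ bounds m N≤m)))

  5≤k*d : 5 ℕ.≤ k ℕ.* d
  5≤k*d = ℕ→ℚ-cancel-≤ (begin
    ℕ→ℚ 5                      ≤⟨ 5≤kq ⟩
    ℕ→ℚ k ℚ.* q                ≤⟨ *-monoʳ (ℕ→ℚ k) q (ℕ→ℚ d) (0≤ℕ→ℚ k) (ℚ.≤-trans q≤3q (ℚ.≤-trans 3q≤k (ℕ→ℚ-mono (ℕ.<⇒≤ 1+k≤d)))) ⟩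
    ℕ→ℚ k ℚ.* ℕ→ℚ d            ≡⟨ sym (ℕ→ℚ-* k d) ⟩
    ℕ→ℚ (k ℕ.* d)              ∎)

  module _ {r : ℕ} (5+r≡kd : 5 ℕ.+ r ≡ k ℕ.* d) where

    k*[d-γ]≤r : ∀ {g} → q ℚ.≤ g → ℕ→ℚ k ℚ.* (ℕ→ℚ d ℚ.- g) ℚ.≤ ℕ→ℚ r
    k*[d-γ]≤r {g} q≤g = begin
      ℕ→ℚ k ℚ.* (ℕ→ℚ d ℚ.- g)
        ≤⟨ *-monoʳ (ℕ→ℚ k) _ _ (0≤ℕ→ℚ k) (ℚ.+-monoʳ-≤ (ℕ→ℚ d) (ℚ.neg-antimono-≤ q≤g)) ⟩
      ℕ→ℚ k ℚ.* (ℕ→ℚ d ℚ.- q)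
        ≡⟨ solve 3 (λ k d q → k :* (d :- q) := k :* d :- k :* q) refl (ℕ→ℚ k) (ℕ→ℚ d) q ⟩
      ℕ→ℚ k ℚ.* ℕ→ℚ d ℚ.- ℕ→ℚ k ℚ.* q
        ≤⟨ ℚ.+-monoʳ-≤ (ℕ→ℚ k ℚ.* ℕ→ℚ d) (ℚ.neg-antimono-≤ 5≤kq) ⟩
      ℕ→ℚ k ℚ.* ℕ→ℚ d ℚ.- ℕ→ℚ 5
        ≡⟨ cong (ℚ._- ℕ→ℚ 5) (trans (sym (ℕ→ℚ-* k d)) (trans (cong ℕ→ℚ (sym 5+r≡kd)) (ℤ→ℚ-+ (+ 5) (+ r)))) ⟩
      ℕ→ℚ 5 ℚ.+ ℕ→ℚ r ℚ.- ℕ→ℚ 5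
        ≡⟨ solve 2 (λ s r → s :+ r :- s := r) refl (ℕ→ℚ 5) (ℕ→ℚ r) ⟩
      ℕ→ℚ r ∎

    exponent-bound : ∀ γ<d e {η} → 0ℚ ℚ.< η → ℕ→ℚ (suc r) ℚ.* (η ℚ.+ η) ℚ.* ℕ→ℚ d ≡ 1ℚ → ∣ e ∣ ≤ fromℚ η →
                     fromℕ (suc r) * (- recip (fromℕ d - γ) γ<d + e) ≤ fromℕ 0 - fromℕ k
    exponent-bound γ<d e {η} 0<η eq e≤η =
      -- The real inequality |e| ≤ η, read with tolerance η, bounds the terms of e by 2η.
      let N , h = eventually-× bounds (e≤η η 0<η)
      in exponent-≤ (fromℕ d - γ) γ<d e k r d {η ℚ.+ η} (ℚ.≤-trans (ℚ.<⇒≤ 0<η) (p≤p+q (ℚ.<⇒≤ 0<η))) eq (N , λ m N≤m →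
        let (q≤γ , γ≤3q) , ∣e∣≤2η = h m N≤m
        in ℚ.<-≤-trans (ℚ.positive⁻¹ 1ℚ) (1≤d-γ γ≤3q) ,
           k*[d-γ]≤r q≤γ ,
           subst (ℕ→ℚ d ℚ.- seq γ m ℚ.≤_) (ℚ.+-identityʳ (ℕ→ℚ d)) (ℚ.+-monoʳ-≤ (ℕ→ℚ d) (ℚ.neg-antimono-≤ (ℚ.≤-trans 0≤q q≤γ))) ,
           ℚ.≤-trans (ℚ.p≤p⊔q (seq e m) (ℚ.- seq e m)) ∣e∣≤2η)

    no-pairs : ∀ {p g} → Anisotropic p g →
               2 ℕ.* 16 ℕ.^ suc r ℕ.< p → ∀ {N} → N ℕ.≤ p → (t : ℕ → ℝ) →
               (∀ n → N ℕ.≤ n → fromℕ (suc r) * t n ≤ fromℕ 0 - fromℕ k) →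
               ¬ (∀ n → N ℕ.≤ n → (x : Fin n → Point d) (ℓ : Fin n → Line d) →
                  (∀ i → InUnitCube (x i)) → (∀ i → x i ∈ ℓ i) →
                  ∃[ i ] ∃[ j ] (i ≢ j × ∃[ δ ] ∃[ y ]
                    (IsDistance (x i) (ℓ j) δ × IsPower n (t n) y × δ ≤ y)))
    no-pairs {p} {g} anisotropic-g big {N} N≤p t t≤ pairs =
      no-near-pair (t n) k r (t≤ n N≤n) (count-large a p r 5+r≡kd big)
        (pairs n N≤n point line point-inUnitCube point∈line)
      where
      instance
        p≢0 : NonZero p
        p≢0 = ℕ.>-nonZero (ℕ.≤-<-trans ℕ.z≤n big)

      2≤p : 2 ℕ.≤ p
      2≤p = ℕ.≤-trans (ℕ.m≤m*n 2 (16 ℕ.^ suc r) {{ℕ.m^n≢0 16 (suc r)}}) (ℕ.<⇒≤ big)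

      open RealPoints p k a 2≤p g anisotropic-g

      n = count p k a

      N≤n : N ℕ.≤ n
      N≤n = ℕ.≤-trans N≤p (p≤count a p r 5+r≡kd)

    PL-fails : ∀ γ<d → ¬ PL d γ γ<d
    PL-fails γ<d (ε , ε→0 , N , pl) =
      let u , 0<u , u*≡1 = reciprocal (suc r ℕ.* d)
          -- So that 2η = 1/((1 + r) d), as `exponent-bound` requires.
          η = ½ ℚ.* u
          0<η = *-pos ½ u (ℚ.positive⁻¹ ½) 0<u
          N′ , ε-small = ε→0 (fromℚ η) (η , 0<η , 0 , λ _ _ → ℚ.≤-reflexive (ℚ.+-identityˡ η))
          -- The count is at least p, so a prime above N and N′ also makes the number of points
          -- large enough for both.
          p , big , g , anisotropic-g = anisotropic-prime (N ℕ.⊔ N′ ℕ.⊔ 2 ℕ.* 16 ℕ.^ suc r)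
      in no-pairs {p} {g} anisotropic-g (ℕ.≤-<-trans (ℕ.m≤n⊔m (N ℕ.⊔ N′) _) big)
           (ℕ.≤-trans (ℕ.m≤m⊔n (N ℕ.⊔ N′) _) (ℕ.<⇒≤ big))
           (λ n → - recip (fromℕ d - γ) γ<d + ε n)
           (λ n N≤n → exponent-bound γ<d (ε n) 0<η (eq u u*≡1) (ε-small n (⊔≤ʳ N N′ N≤n)))
           (λ n N≤n → pl n (⊔≤ˡ N N′ N≤n))
      where
      eq : ∀ u → u ℚ.* ℕ→ℚ (suc r ℕ.* d) ≡ 1ℚ → ℕ→ℚ (suc r) ℚ.* (½ ℚ.* u ℚ.+ ½ ℚ.* u) ℚ.* ℕ→ℚ d ≡ 1ℚ
      eq u u*≡1 = begin-equality
        ℕ→ℚ (suc r) ℚ.* (½ ℚ.* u ℚ.+ ½ ℚ.* u) ℚ.* ℕ→ℚ d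
          ≡⟨ solve 3 (λ r u d → r :* (con ½ :* u :+ con ½ :* u) :* d := u :* (r :* d)) refl (ℕ→ℚ (suc r)) u (ℕ→ℚ d) ⟩
        u ℚ.* (ℕ→ℚ (suc r) ℚ.* ℕ→ℚ d)
          ≡⟨ cong (u ℚ.*_) (sym (ℕ→ℚ-* (suc r) d)) ⟩
        u ℚ.* ℕ→ℚ (suc r ℕ.* d)
          ≡⟨ u*≡1 ⟩
        1ℚ ∎

  -- A bound exp(C/γ) on the dimension can only hold for bounded γ, since d > γ while exp(C/γ)
  -- decreases to 1.
  module _ (kq≤2θ : ℕ→ℚ k ℚ.* q ℚ.≤ (ℕ→ℚ 5 ℚ.+ 3q ℚ.* q) ℚ.+ (ℕ→ℚ 5 ℚ.+ 3q ℚ.* q) ⊎ k ≡ 1) (γ≤1 : γ ≤ 1ℝ) where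

    q≤2 : q ℚ.≤ ℕ→ℚ 2
    q≤2 = let N , h = eventually-× bounds (γ≤1 1ℚ (ℚ.positive⁻¹ 1ℚ))
              (q≤γ , _) , γ≤2 = h N ℕ.≤-refl
          in ℚ.≤-trans q≤γ γ≤2

    kq≤34 : ℕ→ℚ k ℚ.* q ℚ.≤ ℕ→ℚ 34
    kq≤34 = [ (λ kq≤2θ → ℚ.≤-trans kq≤2θ (ℚ.+-mono-≤ θ≤17 θ≤17)) , k≡1⇒ ]′ kq≤2θ
      where
      -- 5 + 6 · 2, because q ≤ 2; doubled this gives 34.
      θ≤17 : ℕ→ℚ 5 ℚ.+ 3q ℚ.* q ℚ.≤ ℕ→ℚ 17
      θ≤17 = ℚ.+-monoʳ-≤ (ℕ→ℚ 5) (*-mono 3q (ℕ→ℚ 6) q (ℕ→ℚ 2) 0≤3q (0≤ℕ→ℚ 2) (ℚ.+-mono-≤ (ℚ.+-mono-≤ q≤2 q≤2) q≤2) q≤2)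

      k≡1⇒ : k ≡ 1 → ℕ→ℚ k ℚ.* q ℚ.≤ ℕ→ℚ 34
      k≡1⇒ k≡1 = begin
        ℕ→ℚ k ℚ.* q   ≡⟨ cong (λ k → ℕ→ℚ k ℚ.* q) k≡1 ⟩
        1ℚ ℚ.* q      ≡⟨ ℚ.*-identityˡ q ⟩
        q             ≤⟨ q≤2 ⟩
        ℕ→ℚ 2         ≤⟨ ℕ→ℚ-mono (ℕ.m≤m+n 2 32) ⟩
        ℕ→ℚ 34        ∎

    -- 16 k g ≤ 48 k q ≤ 48 · 34 = 1632, rounded up to 2000.
    16k≤ : ∀ {g} → q ℚ.≤ g → g ℚ.≤ 3q → ℕ→ℚ (16 ℕ.* k) ℚ.≤ ℕ→ℚ 2000 ℚ.* inv g
    16k≤ {g} q≤g g≤3q = begin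
      ℕ→ℚ (16 ℕ.* k)
        ≡⟨ trans (ℕ→ℚ-* 16 k) (trans (sym (ℚ.*-identityʳ _)) (cong (ℕ→ℚ 16 ℚ.* ℕ→ℚ k ℚ.*_) (sym (inv-inverse 0<g)))) ⟩
      ℕ→ℚ 16 ℚ.* ℕ→ℚ k ℚ.* (g ℚ.* inv g)
        ≡⟨ sym (ℚ.*-assoc (ℕ→ℚ 16 ℚ.* ℕ→ℚ k) g (inv g)) ⟩
      ℕ→ℚ 16 ℚ.* ℕ→ℚ k ℚ.* g ℚ.* inv g
        ≤⟨ ℚ.*-monoʳ-≤-nonNeg (inv g) {{ℚ.nonNegative (inv-nonNeg 0<g)}} bound ⟩
      ℕ→ℚ 2000 ℚ.* inv g ∎
      where
      0<g = ℚ.<-≤-trans 0<q q≤g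
      bound : ℕ→ℚ 16 ℚ.* ℕ→ℚ k ℚ.* g ℚ.≤ ℕ→ℚ 2000
      bound = begin
        ℕ→ℚ 16 ℚ.* ℕ→ℚ k ℚ.* g      ≤⟨ *-monoʳ (ℕ→ℚ 16 ℚ.* ℕ→ℚ k) g 3q (*-nonNeg _ _ (0≤ℕ→ℚ 16) (0≤ℕ→ℚ k)) g≤3q ⟩
        ℕ→ℚ 16 ℚ.* ℕ→ℚ k ℚ.* 3q     ≡⟨ solve 2 (λ k q → con (ℕ→ℚ 16) :* k :* (q :+ q :+ q) := con (ℕ→ℚ 48) :* (k :* q)) refl (ℕ→ℚ k) q ⟩
        ℕ→ℚ 48 ℚ.* (ℕ→ℚ k ℚ.* q)    ≤⟨ *-monoʳ (ℕ→ℚ 48) _ _ (0≤ℕ→ℚ 48) kq≤34 ⟩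
        ℕ→ℚ 48 ℚ.* ℕ→ℚ 34           ≡⟨ sym (ℕ→ℚ-* 48 34) ⟩
        ℕ→ℚ 1632                    ≤⟨ ℕ→ℚ-mono (ℕ.m≤m+n 1632 368) ⟩
        ℕ→ℚ 2000                    ∎

    ambient≤exp : fromℕ d ≤ exp (fromℕ 2000 * recip γ 0<γ)
    -- From index k on, the diagonal partial sum of the exponential contains the k-th term, which
    -- alone exceeds 16^k.
    ambient≤exp ε 0<ε = proj₁ bounds ℕ.⊔ k , λ m N≤m →
      let q≤g , g≤3q = proj₂ bounds m (⊔≤ˡ (proj₁ bounds) k N≤m)
          16k≤x = 16k≤ q≤g g≤3q
          0<x = ℚ.<-≤-trans (0<ℕ→ℚ (16 ℕ.* k) {{ℕ.m*n≢0 16 k {{_}} {{ℕ.>-nonZero (ℕ.≤-<-trans ℕ.z≤n (n<vars a))}}}}) 16k≤x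
      in begin
        ℕ→ℚ d                         ≤⟨ ℕ→ℚ-mono (ambient≤16^ a) ⟩
        ℕ→ℚ (16 ℕ.^ k)                ≤⟨ 16^≤expTerm k 16k≤x ⟩
        expTerm (ℕ→ℚ 2000 ℚ.* inv (seq γ m)) k                   ≤⟨ expTerm≤expSum 0<x (⊔≤ʳ (proj₁ bounds) k N≤m) ⟩
        expSum (ℕ→ℚ 2000 ℚ.* inv (seq γ m)) m          ≤⟨ p≤p+q (ℚ.<⇒≤ 0<ε) ⟩
        expSum (ℕ→ℚ 2000 ℚ.* inv (seq γ m)) m ℚ.+ ε    ∎

dimension-exists : ∀ γ (0<γ : 0ℝ < γ) →
                   (∃[ q ] (0ℚ ℚ.< q × Eventually (λ m → q ℚ.≤ seq γ m × seq γ m ℚ.≤ q ℚ.+ q ℚ.+ q))) →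
                   ∃[ d₀ ] Σ[ γ<d₀ ∈ 0ℝ < fromℕ d₀ - γ ]
                   (¬ PL d₀ γ γ<d₀ × (γ ≤ 1ℝ → fromℕ d₀ ≤ exp (fromℕ 2000 * recip γ 0<γ)))
dimension-exists γ 0<γ (q , 0<q , bounds) = at-level (level-exists 0<q)
  where
  θ = ℕ→ℚ 5 ℚ.+ (q ℚ.+ q ℚ.+ q) ℚ.* q

  at-level : ∃[ a ] (θ ℚ.≤ ℕ→ℚ (vars a) ℚ.* q × (ℕ→ℚ (vars a) ℚ.* q ℚ.≤ θ ℚ.+ θ ⊎ vars a ≡ 1)) →
             ∃[ d₀ ] Σ[ γ<d₀ ∈ 0ℝ < fromℕ d₀ - γ ]
             (¬ PL d₀ γ γ<d₀ × (γ ≤ 1ℝ → fromℕ d₀ ≤ exp (fromℕ 2000 * recip γ 0<γ)))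
  at-level (a , θ≤kq , kq≤2θ) = ambient a , γ<d ,
    PL-fails γ 0<γ a 0<q bounds θ≤kq (proj₂ (ℕ.m≤n⇒∃[o]m+o≡n (5≤k*d γ 0<γ a 0<q bounds θ≤kq))) γ<d ,
    ambient≤exp γ 0<γ a 0<q bounds θ≤kq kq≤2θ
    where γ<d = γ<ambient γ 0<γ a 0<q bounds θ≤kq

corollary1p17 : ∃[ C ] (0ℝ < C ×
    ((γ : ℝ) (0<γ : 0ℝ < γ) →
    ∃[ d₀ ] Σ[ γ<d₀ ∈ 0ℝ < fromℕ d₀ - γ ]
    (¬ PL d₀ γ γ<d₀ ×
    (γ ≤ 1ℝ → fromℕ d₀ ≤ exp (C * recip γ 0<γ)))))
corollary1p17 = fromℕ 2000 ,
  (ℕ→ℚ 2000 , 0<ℕ→ℚ 2000 , 0 , λ _ _ → ℚ.≤-reflexive (ℚ.+-identityˡ (ℕ→ℚ 2000))) ,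
  λ γ 0<γ → dimension-exists γ 0<γ (rational-bounds γ 0<γ)
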